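{- Let $\mathsf{FAMMV}_2\subseteq\mathcal{A}$ be the $\mathbb{Q}$-vector space generated by all finite alternating multiple mixed values of weight $2$. Then $$\mathsf{FAMMV}_2=\big\langle\, \mathtt{q}_2^2,\ G_{\mathcal A},\ (-1)^{p'}\mathtt{q}_2^2,\ (-1)^{p'}G_{\mathcal A}\,\big\rangle_{\mathbb{Q}},$$ i.e. $\mathsf{FAMMV}_2$ is the $\mathbb{Q}$-linear span of these four elements of $\mathcal A$.
   Context: Let $\mathcal{P}$ be the set of primes and $\mathcal{A}=\prod_{p\in\mathcal P}(\mathbb{Z}/p\mathbb{Z})\big/\bigoplus_{p\in\mathcal P}(\mathbb{Z}/p\mathbb{Z})$, a $\mathbb{Q}$-algebra; an element is represented by a family of residues mod $p$ defined for all but finitely many $p$, and two families are equal iff they agree for all but finitely many $p$. Finite alternating multiple mixed values: for $\mathbf{s}=(s_1,\dots,s_d)\in\mathbb{N}^d$ (positive integers), $\boldsymbol\varepsilon=(\varepsilon_1,\dots,\varepsilon_d)\in\{\pm1\}^d$, $\boldsymbol\sigma=(\sigma_1,\dots,\sigma_d)\in\{\pm1\}^d$, let $$M_{\mathcal A}(\mathbf{s};\boldsymbol\varepsilon;\boldsymbol\sigma)=\Bigg(\sum_{\substack{p>k_1>\cdots>k_d>0\\ k_j \text{ even if }\varepsilon_j=1,\ k_j\text{ odd if }\varepsilon_j=-1}}\ \prod_{j=1}^d\frac{\sigma_j^{(2k_j+1-\varepsilon_j)/4}}{k_j^{s_j}} \bmod p\Bigg)_{p\in\mathcal P}\in\mathcal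 A .$$ (So the exponent of $\sigma_j$ is $k_j/2$ if $\varepsilon_j=1$ and $(k_j+1)/2$ if $\varepsilon_j=-1$.) Its weight is $s_1+\cdots+s_d$; the depth $d$ is arbitrary. $\mathtt{q}_2=\big((2^{p-1}-1)/p \bmod p\big)_{p>2}\in\mathcal A$. The Euler numbers $E_n$ are defined by $\frac{2}{e^t+e^{ -t}}=\sum_{n\ge0}E_n\frac{t^n}{n!}$, and $G_{\mathcal A}=\big(E_{p-3}/2 \bmod p\big)_{p>3}\in\mathcal A$. Finally $(-1)^{p'}$ denotes the element $\big((-1)^{(p-1)/2}\big)_{p\ge3}\in\mathcal A$. -}

module Defs where

open import Algebra.Bundles using (Ring; CommutativeRing)
open import Algebra.Module.Bundles using (LeftModule)
open import Data.Integer.Base as ℤ using (ℤ; +_; 0ℤ; 1ℤ; -1ℤ; _◃_)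
import Data.Integer.Properties as ℤ
open import Data.Integer.Divisibility.Signed using (_∣_; divides; ∣m⇒∣-m; ∣m∣n⇒∣m+n; ∣m⇒∣m*n; ∣n⇒∣m*n)
open import Data.Integer.Tactic.RingSolver using (solve-∀)
open import Data.List.Base using (List; []; _∷_; foldr; map; filter; downFrom; applyDownFrom)
open import Data.Nat.Base as ℕ using (ℕ; zero; suc; _∸_; _!; z≤n; s≤s)
import Data.Nat.Divisibility as ℕ
import Data.Nat.Properties as ℕ
open import Data.Nat.DivMod using (_/_)
open import Data.Nat.GCD using (GCD; module Bézout)
open import Data.Nat.Primality using (Prime; ¬prime[1]; prime⇒nonZero; prime⇒irreducible)
open import Data.Product.Base using (∃; _×_; _,_; proj₁; proj₂)
open import Data.Rational.Base as ℚ using (ℚ; 0ℚ; 1ℚ; ½; ↥_; ↧_; ↧ₙ_; toℚᵘ; _÷_)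
import Data.Rational.Properties as ℚ
import Data.Rational.Unnormalised.Base as ℚᵘ
open import Data.Sign.Base using (Sign)
open import Data.Sum.Base using (inj₁; inj₂)
open import Data.Vec.Base as Vec using (Vec; []; _∷_)
open import Data.Vec.Relation.Unary.All using (All)
open import Function.Base using (_∘_)
open import Level using (Level; 0ℓ; _⊔_)
open import Relation.Binary.Bundles using (Setoid)
open import Relation.Binary.PropositionalEquality
import Relation.Binary.Reasoning.Setoid as SetoidReasoning
open import Relation.Nullary using (¬_; ¬?)
open import Relation.Nullary.Negation using (contradiction)
open import Relation.Unary using (Pred; Decidable)

------------------------------------------------------------------------
-- Integers modulo n

infix 4 _≡_[mod_]

-- ℤ/nℤ is ℤ with this relation as its setoid equality.
record _≡_[mod_] (a b : ℤ) (n : ℕ) : Set where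
  constructor congruent
  field difference : + n ∣ a ℤ.- b

module _ {n : ℕ} where

  ≡⇒mod : ∀ {a b} → a ≡ b → a ≡ b [mod n ]
  ≡⇒mod {a} refl = congruent (divides 0ℤ (ℤ.+-inverseʳ a))

  mod-sym : ∀ {a b} → a ≡ b [mod n ] → b ≡ a [mod n ]
  mod-sym {a} {b} (congruent p) = congruent (subst (+ n ∣_) (lemma a b) (∣m⇒∣-m p))
    where
    lemma : ∀ a b → ℤ.- (a ℤ.- b) ≡ b ℤ.- a
    lemma = solve-∀

  mod-trans : ∀ {a b c} → a ≡ b [mod n ] → b ≡ c [mod n ] → a ≡ c [mod n ]
  mod-trans {a} {b} {c} (congruent p) (congruent q) = congruent (subst (+ n ∣_) (lemma a b c) (∣m∣n⇒∣m+n p q))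
    where
    lemma : ∀ a b c → (a ℤ.- b) ℤ.+ (b ℤ.- c) ≡ a ℤ.- c
    lemma = solve-∀

  mod-+-cong : ∀ {a b c d} → a ≡ b [mod n ] → c ≡ d [mod n ] →
               a ℤ.+ c ≡ b ℤ.+ d [mod n ]
  mod-+-cong {a} {b} {c} {d} (congruent p) (congruent q) =
    congruent (subst (+ n ∣_) (lemma a b c d) (∣m∣n⇒∣m+n p q))
    where
    lemma : ∀ a b c d → (a ℤ.- b) ℤ.+ (c ℤ.- d) ≡ (a ℤ.+ c) ℤ.- (b ℤ.+ d)
    lemma = solve-∀

  mod-*-cong : ∀ {a b c d} → a ≡ b [mod n ] → c ≡ d [mod n ] →
               a ℤ.* c ≡ b ℤ.* d [mod n ]
  mod-*-cong {a} {b} {c} {d} (congruent p) (congruent q) =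
    congruent (subst (+ n ∣_) (lemma a b c d)
      (∣m∣n⇒∣m+n (∣m⇒∣m*n c p) (∣n⇒∣m*n b q)))
    where
    lemma : ∀ a b c d → (a ℤ.- b) ℤ.* c ℤ.+ b ℤ.* (c ℤ.- d) ≡ a ℤ.* c ℤ.- b ℤ.* d
    lemma = solve-∀

  mod-neg-cong : ∀ {a b} → a ≡ b [mod n ] → ℤ.- a ≡ ℤ.- b [mod n ]
  mod-neg-cong {a} {b} (congruent p) = congruent (subst (+ n ∣_) (lemma a b) (∣m⇒∣-m p))
    where
    lemma : ∀ a b → ℤ.- (a ℤ.- b) ≡ ℤ.- a ℤ.- ℤ.- b
    lemma = solve-∀

mod-setoid : ℕ → Setoid 0ℓ 0ℓ
mod-setoid n = record
  { Carrier       = ℤ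
  ; _≈_           = λ a b → a ≡ b [mod n ]
  ; isEquivalence = record
    { refl  = ≡⇒mod refl
    ; sym   = mod-sym
    ; trans = mod-trans
    }
  }

------------------------------------------------------------------------
-- Reduction of rational numbers modulo primes

ℙ : Set
ℙ = ∃ Prime

-- The Bézout coefficient x in  x m - y n = ± gcd(m , n), with its sign:
-- an inverse of m modulo n when m and n are coprime.
inverse : ℕ → ℕ → ℤ
inverse m n with Bézout.lemma m n
... | Bézout.result _ _ (Bézout.+- x _ _) = + x
... | Bézout.result _ _ (Bézout.-+ x _ _) = ℤ.- (+ x)

infixl 6 _mod_

-- The residue of r, meaningful when p does not divide the denominator.
_mod_ : ℚ → ℙ → ℤ
r mod (p , _) = ↥ r ℤ.* inverse (↧ₙ r) p

inverse-correct : ∀ m ((p , _) : ℙ) → ¬ p ℕ.∣ m →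
                  + m ℤ.* inverse m p ≡ 1ℤ [mod p ]
inverse-correct m (p , p-prime) p∤m with Bézout.lemma m p
... | Bézout.result d g b with prime⇒irreducible p-prime (proj₂ (GCD.commonDivisor g))
...   | inj₂ refl = contradiction (proj₁ (GCD.commonDivisor g)) p∤m
...   | inj₁ refl with b
...     | Bézout.+- x y eq = congruent (divides (+ y) (begin
  + m ℤ.* + x ℤ.- 1ℤ              ≡⟨ cong (ℤ._- 1ℤ) (ℤ.*-comm (+ m) (+ x)) ⟩
  + x ℤ.* + m ℤ.- 1ℤ              ≡⟨ cong (ℤ._- 1ℤ) (ℤ.pos-* x m) ⟨
  + (x ℕ.* m) ℤ.- 1ℤ              ≡⟨ cong (λ z → + z ℤ.- 1ℤ) eq ⟨
  + (1 ℕ.+ y ℕ.* p) ℤ.- 1ℤ        ≡⟨⟩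
  + (y ℕ.* p)                     ≡⟨ ℤ.pos-* y p ⟩
  + y ℤ.* + p                     ∎))
  where open ≡-Reasoning
...     | Bézout.-+ x y eq = congruent (divides (ℤ.- (+ y)) (begin
  + m ℤ.* ℤ.- (+ x) ℤ.- 1ℤ        ≡⟨ lemma (+ m) (+ x) ⟩
  ℤ.- (1ℤ ℤ.+ + x ℤ.* + m)        ≡⟨ cong (λ z → ℤ.- (1ℤ ℤ.+ z)) (ℤ.pos-* x m) ⟨
  ℤ.- (+ (1 ℕ.+ x ℕ.* m))         ≡⟨ cong (λ z → ℤ.- (+ z)) eq ⟩
  ℤ.- (+ (y ℕ.* p))               ≡⟨ cong ℤ.-_ (ℤ.pos-* y p) ⟩
  ℤ.- (+ y ℤ.* + p)               ≡⟨ ℤ.neg-distribˡ-* (+ y) (+ p) ⟩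
  ℤ.- (+ y) ℤ.* + p               ∎))
  where
  open ≡-Reasoning
  lemma : ∀ a b → a ℤ.* ℤ.- b ℤ.- 1ℤ ≡ ℤ.- (1ℤ ℤ.+ b ℤ.* a)
  lemma = solve-∀

module _ (P : ℙ) where

  private
    p = proj₁ P

    open module R = SetoidReasoning (mod-setoid p)

    *-congˡ : ∀ a {b c} → b ≡ c [mod p ] → a ℤ.* b ≡ a ℤ.* c [mod p ]
    *-congˡ a = mod-*-cong (≡⇒mod {a = a} refl)

    *-congʳ : ∀ a {b c} → b ≡ c [mod p ] → b ℤ.* a ≡ c ℤ.* a [mod p ]
    *-congʳ a b≡c = mod-*-cong b≡c (≡⇒mod refl)

  mod-cancelˡ : ∀ m {a b} → ¬ p ℕ.∣ m →
                + m ℤ.* a ≡ + m ℤ.* b [mod p ] → a ≡ b [mod p ]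
  mod-cancelˡ m {a} {b} p∤m ma≡mb = begin
    a                           ≡⟨ ℤ.*-identityˡ a ⟨
    1ℤ ℤ.* a                    ≈⟨ *-congʳ a (inverse-correct m P p∤m) ⟨
    + m ℤ.* i ℤ.* a             ≡⟨ lemma (+ m) i a ⟩
    i ℤ.* (+ m ℤ.* a)           ≈⟨ *-congˡ i ma≡mb ⟩
    i ℤ.* (+ m ℤ.* b)           ≡⟨ lemma (+ m) i b ⟨
    + m ℤ.* i ℤ.* b             ≈⟨ *-congʳ b (inverse-correct m P p∤m) ⟩
    1ℤ ℤ.* b                    ≡⟨ ℤ.*-identityˡ b ⟩
    b                           ∎
    where
    i = inverse m p
    lemma : ∀ m i a → m ℤ.* i ℤ.* a ≡ i ℤ.* (m ℤ.* a)
    lemma = solve-∀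

  mod-correct : ∀ r → ¬ p ℕ.∣ ↧ₙ r → ↧ r ℤ.* (r mod P) ≡ ↥ r [mod p ]
  mod-correct r p∤r = begin
    ↧ r ℤ.* (↥ r ℤ.* i)    ≡⟨ lemma (↧ r) (↥ r) i ⟩
    ↥ r ℤ.* (↧ r ℤ.* i)    ≈⟨ *-congˡ (↥ r) (inverse-correct (↧ₙ r) P p∤r) ⟩
    ↥ r ℤ.* 1ℤ             ≡⟨ ℤ.*-identityʳ (↥ r) ⟩
    ↥ r                    ∎
    where
    i = inverse (↧ₙ r) p
    lemma : ∀ d n i → d ℤ.* (n ℤ.* i) ≡ n ℤ.* (d ℤ.* i)
    lemma = solve-∀

  mod-unique : ∀ r {a} → ¬ p ℕ.∣ ↧ₙ r → ↧ r ℤ.* a ≡ ↥ r [mod p ] → r mod P ≡ a [mod p ]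
  mod-unique r {a} p∤r h = mod-cancelˡ (↧ₙ r) p∤r
    (mod-trans (mod-correct r p∤r)
      (mod-sym h))

  1-mod : 1ℚ mod P ≡ 1ℤ [mod p ]
  1-mod = mod-unique 1ℚ p∤1 (≡⇒mod refl)
    where
    p∤1 : ¬ p ℕ.∣ 1
    p∤1 p∣1 = ¬prime[1] (subst Prime (ℕ.∣1⇒≡1 p∣1) (proj₂ P))

  private
    ↥↧ : ∀ t {u} → toℚᵘ t ℚᵘ.≃ u → ↥ t ℤ.* ℚᵘ.↧ u ≡ ℚᵘ.↥ u ℤ.* ↧ t
    ↥↧ record{} (ℚᵘ.*≡* eq) = eq

    ↥↧-+ : ∀ r s → ↥ (r ℚ.+ s) ℤ.* (↧ r ℤ.* ↧ s) ≡
                   (↥ r ℤ.* ↧ s ℤ.+ ↥ s ℤ.* ↧ r) ℤ.* ↧ (r ℚ.+ s)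
    ↥↧-+ r@record{} s@record{} = ↥↧ (r ℚ.+ s) (ℚ.toℚᵘ-homo-+ r s)

    ↥↧-* : ∀ r s → ↥ (r ℚ.* s) ℤ.* (↧ r ℤ.* ↧ s) ≡ (↥ r ℤ.* ↥ s) ℤ.* ↧ (r ℚ.* s)
    ↥↧-* r@record{} s@record{} = ↥↧ (r ℚ.* s) (ℚ.toℚᵘ-homo-* r s)

  +-mod : ∀ r s → ¬ p ℕ.∣ ↧ₙ r → ¬ p ℕ.∣ ↧ₙ s → ¬ p ℕ.∣ ↧ₙ (r ℚ.+ s) →
          (r ℚ.+ s) mod P ≡ (r mod P) ℤ.+ (s mod P) [mod p ]
  +-mod r s p∤r p∤s p∤t =
    mod-unique t p∤t
      (mod-cancelˡ (↧ₙ r) p∤r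
        (mod-cancelˡ (↧ₙ s) p∤s (begin
          ↧ s ℤ.* (↧ r ℤ.* (↧ t ℤ.* (x ℤ.+ y)))
            ≡⟨ lemma₁ (↧ s) (↧ r) (↧ t) x y ⟩
          (↧ r ℤ.* x ℤ.* ↧ s ℤ.+ ↧ s ℤ.* y ℤ.* ↧ r) ℤ.* ↧ t
            ≈⟨ *-congʳ (↧ t) (mod-+-cong
                 (*-congʳ (↧ s) (mod-correct r p∤r))
                 (*-congʳ (↧ r) (mod-correct s p∤s))) ⟩
          (↥ r ℤ.* ↧ s ℤ.+ ↥ s ℤ.* ↧ r) ℤ.* ↧ t
            ≡⟨ ↥↧-+ r s ⟨
          ↥ t ℤ.* (↧ r ℤ.* ↧ s)
            ≡⟨ lemma₂ (↥ t) (↧ r) (↧ s) ⟩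
          ↧ s ℤ.* (↧ r ℤ.* ↥ t) ∎)))
    where
    t = r ℚ.+ s
    x = r mod P
    y = s mod P
    lemma₁ : ∀ d b e x y → d ℤ.* (b ℤ.* (e ℤ.* (x ℤ.+ y))) ≡
                           (b ℤ.* x ℤ.* d ℤ.+ d ℤ.* y ℤ.* b) ℤ.* e
    lemma₁ = solve-∀
    lemma₂ : ∀ n b d → n ℤ.* (b ℤ.* d) ≡ d ℤ.* (b ℤ.* n)
    lemma₂ = solve-∀

  *-mod : ∀ r s → ¬ p ℕ.∣ ↧ₙ r → ¬ p ℕ.∣ ↧ₙ s → ¬ p ℕ.∣ ↧ₙ (r ℚ.* s) →
          (r ℚ.* s) mod P ≡ (r mod P) ℤ.* (s mod P) [mod p ]
  *-mod r s p∤r p∤s p∤t =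
    mod-unique t p∤t
      (mod-cancelˡ (↧ₙ r) p∤r
        (mod-cancelˡ (↧ₙ s) p∤s (begin
          ↧ s ℤ.* (↧ r ℤ.* (↧ t ℤ.* (x ℤ.* y)))
            ≡⟨ lemma₁ (↧ s) (↧ r) (↧ t) x y ⟩
          (↧ r ℤ.* x) ℤ.* (↧ s ℤ.* y) ℤ.* ↧ t
            ≈⟨ *-congʳ (↧ t) (mod-*-cong
                 (mod-correct r p∤r) (mod-correct s p∤s)) ⟩
          ↥ r ℤ.* ↥ s ℤ.* ↧ t
            ≡⟨ ↥↧-* r s ⟨
          ↥ t ℤ.* (↧ r ℤ.* ↧ s)
            ≡⟨ lemma₂ (↥ t) (↧ r) (↧ s) ⟩
          ↧ s ℤ.* (↧ r ℤ.* ↥ t) ∎)))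
    where
    t = r ℚ.* s
    x = r mod P
    y = s mod P
    lemma₁ : ∀ d b e x y → d ℤ.* (b ℤ.* (e ℤ.* (x ℤ.* y))) ≡
                           (b ℤ.* x) ℤ.* (d ℤ.* y) ℤ.* e
    lemma₁ = solve-∀
    lemma₂ : ∀ n b d → n ℤ.* (b ℤ.* d) ≡ d ℤ.* (b ℤ.* n)
    lemma₂ = solve-∀

------------------------------------------------------------------------
-- The ℚ-algebra 𝒜 = ∏ ℤ/p / ⨁ ℤ/p
--
-- Families are total; a family defined for all but finitely many p is
-- extended by arbitrary residues, which does not affect its class.

𝒜 : Set
𝒜 = ℙ → ℤ

infix  4 _≈_
infixl 6 _⊕_
infixl 7 _⊗_
infixr 7 _•_

_≈_ : 𝒜 → 𝒜 → Set
x ≈ y = ∃ λ N → ∀ (P@(p , _) : ℙ) → N ℕ.< p → x P ≡ y P [mod p ]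

_⊕_ _⊗_ : 𝒜 → 𝒜 → 𝒜
(x ⊕ y) P = x P ℤ.+ y P
(x ⊗ y) P = x P ℤ.* y P

⊖_ : 𝒜 → 𝒜
(⊖ x) P = ℤ.- x P

𝟘 𝟙 : 𝒜
𝟘 _ = 0ℤ
𝟙 _ = 1ℤ

_•_ : ℚ → 𝒜 → 𝒜
(r • x) P = (r mod P) ℤ.* x P

private
  pointwise : ∀ {x y} → (∀ P → x P ≡ y P) → x ≈ y
  pointwise h = 0 , λ P _ → ≡⇒mod (h P)

  eventually₂ : ∀ {x y u v z w} →
    (∀ P → x P ≡ y P [mod proj₁ P ] → u P ≡ v P [mod proj₁ P ] → z P ≡ w P [mod proj₁ P ]) →
    x ≈ y → u ≈ v → z ≈ w
  eventually₂ h (M , f) (N , g) = M ℕ.+ N , λ P M+N<p → h P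
    (f P (ℕ.≤-<-trans (ℕ.m≤m+n M N) M+N<p))
    (g P (ℕ.≤-<-trans (ℕ.m≤n+m N M) M+N<p))

  ∤-large : ∀ {m p} .{{_ : ℕ.NonZero m}} → m ℕ.< p → ¬ p ℕ.∣ m
  ∤-large m<p p∣m = ℕ.<⇒≱ m<p (ℕ.∣⇒≤ p∣m)

  ∤-large₃ : ∀ r s t {p} → ↧ₙ r ℕ.+ ↧ₙ s ℕ.+ ↧ₙ t ℕ.< p →
             ¬ p ℕ.∣ ↧ₙ r × ¬ p ℕ.∣ ↧ₙ s × ¬ p ℕ.∣ ↧ₙ t
  ∤-large₃ r@record{} s@record{} t@record{} h =
      ∤-large (ℕ.≤-<-trans (ℕ.≤-trans (ℕ.m≤m+n (↧ₙ r) (↧ₙ s)) (ℕ.m≤m+n _ (↧ₙ t))) h)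
    , ∤-large (ℕ.≤-<-trans (ℕ.≤-trans (ℕ.m≤n+m (↧ₙ s) (↧ₙ r)) (ℕ.m≤m+n _ (↧ₙ t))) h)
    , ∤-large (ℕ.≤-<-trans (ℕ.m≤n+m (↧ₙ t) (↧ₙ r ℕ.+ ↧ₙ s)) h)

  ≈-refl : ∀ {x} → x ≈ x
  ≈-refl = pointwise λ _ → refl

  •-distribʳ : ∀ x r s → (r ℚ.+ s) • x ≈ (r • x) ⊕ (s • x)
  •-distribʳ x r s = ↧ₙ r ℕ.+ ↧ₙ s ℕ.+ ↧ₙ (r ℚ.+ s) , λ P h →
    let (p∤r , p∤s , p∤t) = ∤-large₃ r s (r ℚ.+ s) h
        a = r mod P ; b = s mod P ; c = (r ℚ.+ s) mod P
    in mod-trans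
      (mod-*-cong (+-mod P r s p∤r p∤s p∤t) (≡⇒mod refl))
      (≡⇒mod (ℤ.*-distribʳ-+ (x P) a b))

  •-assoc : ∀ r s x → (r ℚ.* s) • x ≈ r • (s • x)
  •-assoc r s x = ↧ₙ r ℕ.+ ↧ₙ s ℕ.+ ↧ₙ (r ℚ.* s) , λ P h →
    let (p∤r , p∤s , p∤t) = ∤-large₃ r s (r ℚ.* s) h
        a = r mod P ; b = s mod P ; c = (r ℚ.* s) mod P
    in mod-trans
      (mod-*-cong (*-mod P r s p∤r p∤s p∤t) (≡⇒mod refl))
      (≡⇒mod (ℤ.*-assoc a b (x P)))

  •-identityˡ : ∀ x → 1ℚ • x ≈ x
  •-identityˡ x = 0 , λ P _ →
    mod-trans
      (mod-*-cong (1-mod P) (≡⇒mod refl))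
      (≡⇒mod (ℤ.*-identityˡ (x P)))

𝒜-commutativeRing : CommutativeRing 0ℓ 0ℓ
𝒜-commutativeRing = record
  { Carrier = 𝒜
  ; _≈_     = _≈_
  ; _+_     = _⊕_
  ; _*_     = _⊗_
  ; -_      = ⊖_
  ; 0#      = 𝟘
  ; 1#      = 𝟙
  ; isCommutativeRing = record
    { isRing = record
      { +-isAbelianGroup = record
        { isGroup = record
          { isMonoid = record
            { isSemigroup = record
              { isMagma = record
                { isEquivalence = record
                  { refl  = ≈-refl
                  ; sym   = λ { (N , f) → N , λ P h → mod-sym (f P h) }
                  ; trans = eventually₂ λ _ → mod-trans
                  }
                ; ∙-cong = eventually₂ λ _ → mod-+-cong
                }
              ; assoc = λ x y z → pointwise λ P → ℤ.+-assoc (x P) (y P) (z P)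
              }
            ; identity = (λ x → pointwise λ P → ℤ.+-identityˡ (x P))
                       , (λ x → pointwise λ P → ℤ.+-identityʳ (x P))
            }
          ; inverse = (λ x → pointwise λ P → ℤ.+-inverseˡ (x P))
                    , (λ x → pointwise λ P → ℤ.+-inverseʳ (x P))
          ; ⁻¹-cong = λ { (N , f) → N , λ P h → mod-neg-cong (f P h) }
          }
        ; comm = λ x y → pointwise λ P → ℤ.+-comm (x P) (y P)
        }
      ; *-cong = eventually₂ λ _ → mod-*-cong
      ; *-assoc = λ x y z → pointwise λ P → ℤ.*-assoc (x P) (y P) (z P)
      ; *-identity = (λ x → pointwise λ P → ℤ.*-identityˡ (x P))
                   , (λ x → pointwise λ P → ℤ.*-identityʳ (x P))
      ; distrib = (λ x y z → pointwise λ P → ℤ.*-distribˡ-+ (x P) (y P) (z P))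
                , (λ x y z → pointwise λ P → ℤ.*-distribʳ-+ (x P) (y P) (z P))
      }
    ; *-comm = λ x y → pointwise λ P → ℤ.*-comm (x P) (y P)
    }
  }

𝒜-vectorSpace : LeftModule ℚ.+-*-ring 0ℓ 0ℓ
𝒜-vectorSpace = record
  { Carrierᴹ = 𝒜
  ; _≈ᴹ_     = _≈_
  ; _+ᴹ_     = _⊕_
  ; _*ₗ_     = _•_
  ; 0ᴹ       = 𝟘
  ; -ᴹ_      = ⊖_
  ; isLeftModule = record
    { isLeftSemimodule = record
      { +ᴹ-isCommutativeMonoid = A.+-isCommutativeMonoid
      ; isPreleftSemimodule = record
        { *ₗ-cong      = λ { {r} refl → A.*-cong (≈-refl {λ P → r mod P}) }
        ; *ₗ-zeroˡ     = λ x → pointwise λ P → refl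
        ; *ₗ-distribʳ  = •-distribʳ
        ; *ₗ-identityˡ = •-identityˡ
        ; *ₗ-assoc     = •-assoc
        ; *ₗ-zeroʳ     = λ r → pointwise λ P → ℤ.*-zeroʳ (r mod P)
        ; *ₗ-distribˡ  = λ r x y → pointwise λ P → ℤ.*-distribˡ-+ (r mod P) (x P) (y P)
        }
      }
    ; -ᴹ‿cong    = A.-‿cong
    ; -ᴹ‿inverse = A.-‿inverse
    }
  }
  where module A = CommutativeRing 𝒜-commutativeRing

module _ {r ℓr m ℓm : Level} {R : Ring r ℓr} (M : LeftModule R m ℓm) where
  open LeftModule M

  linearCombination : ∀ {i} {I : Set i} → (I → Carrierᴹ) → List (Ring.Carrier R × I) → Carrierᴹ
  linearCombination v []             = 0ᴹ
  linearCombination v ((c , i) ∷ cs) = (c *ₗ v i) +ᴹ linearCombination v cs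

  Span : ∀ {i} {I : Set i} → (I → Carrierᴹ) → Pred Carrierᴹ (r ⊔ i ⊔ ℓm)
  Span v x = ∃ λ cs → x ≈ᴹ linearCombination v cs

------------------------------------------------------------------------
-- Finite alternating multiple mixed values

sumℚ : List ℚ → ℚ
sumℚ = foldr ℚ._+_ 0ℚ

HasParity : Sign → Pred ℕ 0ℓ
HasParity Sign.+ k = 2 ℕ.∣ k
HasParity Sign.- k = ¬ 2 ℕ.∣ k

hasParity? : ∀ ε → Decidable (HasParity ε)
hasParity? Sign.+ k = 2 ℕ.∣? k
hasParity? Sign.- k = ¬? (2 ℕ.∣? k)

-- (2 k + 1 - ε) / 4
exponent : Sign → ℕ → ℕ
exponent Sign.+ k = k / 2
exponent Sign.- k = suc k / 2

term : ℕ → Sign → Sign → (k : ℕ) .{{_ : ℕ.NonZero k}} → ℚ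
term s ε σ k = ((σ ◃ 1) ℤ.^ exponent ε k) ℚ./ (k ℕ.^ s)
  where instance _ = ℕ.m^n≢0 k s

-- The sum over n > k₁ > ⋯ > k_d > 0.  The list is indexed by j = k₁ - 1,
-- so that k₁ = suc j is visibly nonzero.
mixedSum : ℕ → ∀ {d} → Vec ℕ d → Vec Sign d → Vec Sign d → ℚ
mixedSum n []       []       []       = 1ℚ
mixedSum n (s ∷ 𝐬) (ε ∷ 𝛆) (σ ∷ 𝛔) =
  sumℚ (map (λ j → term s ε σ (suc j) ℚ.* mixedSum (suc j) 𝐬 𝛆 𝛔)
            (filter (λ j → hasParity? ε (suc j)) (downFrom (n ∸ 1))))

M𝒜 : ∀ {d} → Vec ℕ d → Vec Sign d → Vec Sign d → 𝒜
M𝒜 𝐬 𝛆 𝛔 P@(p , _) = mixedSum p 𝐬 𝛆 𝛔 mod P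

record MixedIndex (w : ℕ) : Set where
  field
    depth    : ℕ
    𝐬        : Vec ℕ depth
    𝛆        : Vec Sign depth
    𝛔        : Vec Sign depth
    positive : All ℕ.NonZero 𝐬
    weight   : Vec.sum 𝐬 ≡ w

FAMMV : ℕ → Pred 𝒜 0ℓ
FAMMV w = Span 𝒜-vectorSpace {I = MixedIndex w} λ i →
  let open MixedIndex i in M𝒜 𝐬 𝛆 𝛔

------------------------------------------------------------------------
-- Formal power series over ℚ and Euler numbers

PowerSeries : Set
PowerSeries = ℕ → ℚ

infixl 7 _⋆_

_⋆_ : PowerSeries → PowerSeries → PowerSeries
(f ⋆ g) n = sumℚ (applyDownFrom (λ k → f k ℚ.* g (n ∸ k)) (suc n))

-- e^{a t}
exp : ℤ → PowerSeries
exp a n = (a ℤ.^ n) ℚ./ (n !)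
  where instance _ = n ℕ.!≢0

constant : ℚ → PowerSeries
constant c zero    = c
constant c (suc n) = 0ℚ

private
  convolve : List ℚ → PowerSeries → ℚ
  convolve []       g = 0ℚ
  convolve (c ∷ cs) g = c ℚ.* g 0 ℚ.+ convolve cs (g ∘ suc)

-- The quotient q = f / g is determined by
--   q_n g_0 = f_n - (q_{n-1} g_1 + q_{n-2} g_2 + ⋯ + q_0 g_n).
module _ (f g : PowerSeries) .{{_ : ℚ.NonZero (g 0)}} where

  private
    next : ℕ → List ℚ → ℚ
    next n earlier = (f n ℚ.- convolve earlier (g ∘ suc)) ÷ g 0

    extend : ℕ → List ℚ → List ℚ
    extend n earlier = next n earlier ∷ earlier

    -- [ q_{n-1} , … , q_0 ]
    prefix : ℕ → List ℚ
    prefix zero    = []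
    prefix (suc n) = extend n (prefix n)

  quotient : PowerSeries
  quotient n = next n (prefix n)

  private
    prefix-quotient : ∀ n → prefix n ≡ applyDownFrom quotient n
    prefix-quotient zero    = refl
    prefix-quotient (suc n) = cong (quotient n ∷_) (prefix-quotient n)

    convolve-sum : ∀ (q h : PowerSeries) n e →
      convolve (applyDownFrom q n) (λ k → h (e ℕ.+ k)) ≡
      sumℚ (applyDownFrom (λ k → q k ℚ.* h ((e ℕ.+ n) ∸ suc k)) n)
    convolve-sum q h zero    e = refl
    convolve-sum q h (suc n) e = cong₂ ℚ._+_
      (cong (λ i → q n ℚ.* h i) (begin
        e ℕ.+ 0                    ≡⟨ cong (e ℕ.+_) (ℕ.n∸n≡0 n) ⟨
        e ℕ.+ (suc n ∸ suc n)      ≡⟨ ℕ.+-∸-assoc e {suc n} ℕ.≤-refl ⟨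
        (e ℕ.+ suc n) ∸ suc n      ∎))
      (begin
        convolve (applyDownFrom q n) (λ k → h (e ℕ.+ suc k))
          ≡⟨ convolve-cong (applyDownFrom q n) (λ k → cong h (ℕ.+-suc e k)) ⟩
        convolve (applyDownFrom q n) (λ k → h (suc e ℕ.+ k))
          ≡⟨ convolve-sum q h n (suc e) ⟩
        sumℚ (applyDownFrom (λ k → q k ℚ.* h ((suc e ℕ.+ n) ∸ suc k)) n)
          ≡⟨ cong (λ z → sumℚ (applyDownFrom (λ k → q k ℚ.* h (z ∸ suc k)) n)) (ℕ.+-suc e n) ⟨
        sumℚ (applyDownFrom (λ k → q k ℚ.* h ((e ℕ.+ suc n) ∸ suc k)) n) ∎)
      where
      open ≡-Reasoning
      convolve-cong : ∀ cs {g h : PowerSeries} → (∀ k → g k ≡ h k) →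
                      convolve cs g ≡ convolve cs h
      convolve-cong []       eq = refl
      convolve-cong (c ∷ cs) eq =
        cong₂ ℚ._+_ (cong (c ℚ.*_) (eq 0)) (convolve-cong cs (eq ∘ suc))

  quotient-correct : ∀ n → (quotient ⋆ g) n ≡ f n
  quotient-correct n = begin
    sumℚ (applyDownFrom (λ k → quotient k ℚ.* g (n ∸ k)) (suc n))
      ≡⟨ convolve-sum quotient g (suc n) 0 ⟨
    quotient n ℚ.* g 0 ℚ.+ convolve (applyDownFrom quotient n) (g ∘ suc)
      ≡⟨ cong (λ cs → quotient n ℚ.* g 0 ℚ.+ convolve cs (g ∘ suc)) (prefix-quotient n) ⟨
    (f n ℚ.- c) ÷ g 0 ℚ.* g 0 ℚ.+ c
      ≡⟨ cong (ℚ._+ c) (ℚ.*-assoc (f n ℚ.- c) (ℚ.1/ g 0) (g 0)) ⟩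
    (f n ℚ.- c) ℚ.* (ℚ.1/ g 0 ℚ.* g 0) ℚ.+ c
      ≡⟨ cong (λ z → (f n ℚ.- c) ℚ.* z ℚ.+ c) (ℚ.*-inverseˡ (g 0)) ⟩
    (f n ℚ.- c) ℚ.* 1ℚ ℚ.+ c
      ≡⟨ cong (ℚ._+ c) (ℚ.*-identityʳ (f n ℚ.- c)) ⟩
    (f n ℚ.- c) ℚ.+ c
      ≡⟨ ℚ.+-assoc (f n) (ℚ.- c) c ⟩
    f n ℚ.+ (ℚ.- c ℚ.+ c)
      ≡⟨ cong (f n ℚ.+_) (ℚ.+-inverseˡ c) ⟩
    f n ℚ.+ 0ℚ
      ≡⟨ ℚ.+-identityʳ (f n) ⟩
    f n ∎
    where
    open ≡-Reasoning
    c = convolve (prefix n) (g ∘ suc)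

-- e^t + e^{-t}
exp+exp⁻ : PowerSeries
exp+exp⁻ n = exp 1ℤ n ℚ.+ exp -1ℤ n

-- E n / n! is the coefficient of t^n in 2 / (e^t + e^{-t}).
E : ℕ → ℚ
E n = (+ (n !) ℚ./ 1) ℚ.* quotient (constant (+ 2 ℚ./ 1)) exp+exp⁻ n

------------------------------------------------------------------------
-- Special elements of 𝒜

-- The division is exact for p > 2.
q₂ : 𝒜
q₂ (p , p-prime) = + ((2 ℕ.^ (p ∸ 1) ∸ 1) / p)
  where instance _ = prime⇒nonZero p-prime

G𝒜 : 𝒜
G𝒜 P@(p , _) = (E (p ∸ 3) ℚ.* ½) mod P

[-1]^p′ : 𝒜
[-1]^p′ (p , _) = -1ℤ ℤ.^ ((p ∸ 1) / 2)

{-# OPTIONS --safe #-}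

-- Let p = 2m + 1 be prime, χ = (-1)ᵐ, and put e_σ(j) = σ^{j+1}/(2j + 2), o_σ(j) = σ^{j+1}/(2j + 1)
-- for 0 ≤ j < m.  The reflection k ↦ p - k gives o_σ(j) ≡ κ_σ e_σ(m - 1 - j) with κ₊ = -1 and κ₋ = χ,
-- so every mixed value of depth 2 is, up to such factors, the sum of e_σ(j) e_τ(i) over i < j, over
-- i + j < m - 1 or over i + j ≥ m - 1.  Shuffle products and partial fractions relate these sums; what
-- is missing comes from the identities
--   ∑ (1/l) (1 - y)ˡ (1 + y)ᵖ⁻ˡ ≡ q₂ (1 - yᵖ) + ∑ yⁿ/n        (l odd),
--   2 ∑ (1/kl) (1 - y)ᵏ (1 + y)ᵖ⁻ᵏ ≡ - ∑ yⁿ/n²                (k even, l odd, k > l)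
-- in 𝔽_p[y], where all indices lie between 0 and p.  They reflect the behaviour of artanh y under
-- y ↦ (1 - y)/(1 + y) and follow by differentiation, since 4y = (1 + y)² - (1 - y)² makes the
-- derivatives telescope.  The substitution maps i to -i, so taking real parts at y = i yields
-- 2 ∑ e₋ ≡ ∑ e₊ and 2 ∑_{i ≤ j} e₋(j) o₊(i) ≡ - ∑ e₋ e₊.  Moreover ∑ e₊ ≡ - q₂, and
-- E_n ≡ ∑_{j < p} (-1)ʲ (2j + 1)ⁿ for n < p gives G ≡ χ ∑ e₋ e₊ by Fermat's little theorem.
module Submission where

open import Algebra.Bundles using (Ring)
open import Algebra.Module.Bundles using (LeftModule)
open import Data.Fin.Base using (Fin)
open import Data.Fin.Patterns using (0F; 1F; 2F; 3F)
open import Data.Integer.Base as ℤ using (ℤ; 0ℤ; 1ℤ; -1ℤ; _+_; _*_; -_; _-_; _^_)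
open import Data.Integer.Divisibility.Signed using (_∣_; divides; ∣⇒∣ᵤ)
open import Data.Integer.GCD using (gcd)
import Data.Integer.Properties as ℤ
open import Data.Integer.Tactic.RingSolver using (solve-∀)
open import Data.List.Base using (List; []; _∷_; _++_; map; filter; downFrom; applyDownFrom)
open import Data.List.Properties using (map-applyDownFrom; filter-accept; filter-reject)
open import Data.Nat.Base as ℕ using (ℕ; zero; suc; _∸_; _!; z≤n; s≤s)
import Data.Nat.Coprimality as Coprimality
import Data.Nat.Divisibility as ℕ
open import Data.Nat.DivMod using (_/_; m/n*n≡m; m*n/n≡m)
open import Data.Nat.Primality using (Prime; prime⇒nonTrivial; prime⇒nonZero; prime⇒irreducible; euclidsLemma; ¬prime[1])
import Data.Nat.Properties as ℕ
open import Data.Product.Base using (∃; _×_; _,_; proj₁; proj₂)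
open import Data.Rational.Base as ℚ using (ℚ; 0ℚ; 1ℚ; ½; ↥_; ↧_; ↧ₙ_; toℚᵘ)
import Data.Rational.Properties as ℚ
import Data.Rational.Unnormalised.Base as ℚᵘ
open import Data.Sign.Base as Sign using (Sign)
open import Data.Sum.Base using (_⊎_; inj₁; inj₂; [_,_]′)
open import Data.Vec.Base using ([]; _∷_; lookup)
open import Data.Vec.Relation.Unary.All using ([]; _∷_)
open import Function.Base using (_∘_)
open import Relation.Binary.PropositionalEquality
import Relation.Binary.Reasoning.Setoid as SetoidReasoning
open import Relation.Nullary using (¬_)
open import Relation.Nullary.Negation using (contradiction)
open import Relation.Unary using (_≐_; _⊆_)
open import Defs

-- Finite sums

-- Shuffle products give `a Sign.+ Sign.+` and `a Sign.- Sign.-` as halves of squares of `h`, but of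
-- the mixed sums `a Sign.+ Sign.-` and `a Sign.- Sign.+` only the total, up to `τ`; partial
-- fractions merely express `b` through `a`. Two relations stay open: `h Sign.-` against `h Sign.+`,
-- and one mixed double sum. Each polynomial identity settles one of them, by comparing the real
-- part computed from its coefficients with the real parts of its summands. The exponents l and p -
-- l are paired so that p - l ≡ - l modulo p, which collapses the derivative to a single product. As
-- -1 need not be a square modulo p, i is never adjoined: the real part is the alternating sum of
-- the even coefficients, and ((1 - i)/(1 + i))² = -1 enters as divisibility of (1 + y)² + (1 - y)²
-- by 1 + y². Since p is odd, the coefficient of yᵖ never enters. The primes 2 and 3 are discarded
-- because the vanishing of the sum of inverse squares is obtained by cancelling 6.

infixr 7.5 ∑
∑ : ℕ → (ℕ → ℤ) → ℤ
∑ zero    f = 0ℤ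
∑ (suc n) f = f n + ∑ n f

syntax ∑ n (λ i → e) = ∑[ i < n ] e

∑-ext : ∀ n {f g} → (∀ i → i ℕ.< n → f i ≡ g i) → ∑ n f ≡ ∑ n g
∑-ext zero    h = refl
∑-ext (suc n) h = cong₂ _+_ (h n ℕ.≤-refl) (∑-ext n λ i i<n → h i (ℕ.m≤n⇒m≤1+n i<n))

∑-cong : ∀ {p} n {f g} → (∀ i → i ℕ.< n → f i ≡ g i [mod p ]) → ∑ n f ≡ ∑ n g [mod p ]
∑-cong zero    h = ≡⇒mod refl
∑-cong (suc n) h = mod-+-cong (h n ℕ.≤-refl) (∑-cong n λ i i<n → h i (ℕ.m≤n⇒m≤1+n i<n))

∑-zero : ∀ n → ∑[ i < n ] 0ℤ ≡ 0ℤ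
∑-zero zero    = refl
∑-zero (suc n) = trans (ℤ.+-identityˡ _) (∑-zero n)

∑-+ : ∀ n (f g : ℕ → ℤ) → ∑[ i < n ] (f i + g i) ≡ ∑ n f + ∑ n g
∑-+ zero    f g = refl
∑-+ (suc n) f g = trans (cong (λ z → f n + g n + z) (∑-+ n f g)) (lemma (f n) (g n) (∑ n f) (∑ n g))
  where
  lemma : ∀ a b c d → a + b + (c + d) ≡ a + c + (b + d)
  lemma = solve-∀

*-∑ : ∀ n c (f : ℕ → ℤ) → c * ∑ n f ≡ ∑[ i < n ] (c * f i)
*-∑ zero    c f = ℤ.*-zeroʳ c
*-∑ (suc n) c f = trans (ℤ.*-distribˡ-+ c (f n) (∑ n f)) (cong (λ z → c * f n + z) (*-∑ n c f))

∑-swap : ∀ m n (f : ℕ → ℕ → ℤ) → ∑[ i < m ] ∑[ j < n ] f i j ≡ ∑[ j < n ] ∑[ i < m ] f i j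
∑-swap zero    n f = sym (∑-zero n)
∑-swap (suc m) n f = trans (cong (λ z → ∑ n (f m) + z) (∑-swap m n f)) (sym (∑-+ n (f m) _))

∑-head : ∀ n (f : ℕ → ℤ) → ∑ (suc n) f ≡ f 0 + ∑ n (f ∘ suc)
∑-head zero    f = refl
∑-head (suc n) f = trans (cong (f (suc n) +_) (∑-head n f)) (lemma (f (suc n)) (f 0) (∑ n (f ∘ suc)))
  where
  lemma : ∀ a b c → a + (b + c) ≡ b + (a + c)
  lemma = solve-∀

rev : ℕ → ℕ → ℕ
rev n i = n ∸ suc i

∑-reverse : ∀ n (f : ℕ → ℤ) → ∑ n f ≡ ∑ n (f ∘ rev n)
∑-reverse zero    f = refl
∑-reverse (suc n) f = sym (trans (∑-head n (f ∘ rev (suc n))) (cong (f n +_) (sym (∑-reverse n f))))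

∑-telescope : ∀ n (v : ℕ → ℤ) → ∑[ i < n ] (v i - v (suc i)) ≡ v 0 - v n
∑-telescope zero    v = sym (ℤ.+-inverseʳ (v 0))
∑-telescope (suc n) v = trans (cong (λ z → v n - v (suc n) + z) (∑-telescope n v)) (lemma (v n) (v (suc n)) (v 0))
  where
  lemma : ∀ a b c → a - b + (c - a) ≡ c - b
  lemma = solve-∀

-- Abel summation. It reduces the second polynomial identity, whose weights are partial sums of `w`,
-- to the first, whose weights are `w`.
∑-byParts : ∀ n (w v : ℕ → ℤ) →
  ∑[ j < n ] (∑ (suc j) w * (v j - v (suc j))) ≡ ∑[ j < n ] (w j * v j) - ∑ n w * v n
∑-byParts zero    w v = refl
∑-byParts (suc n) w v =
  trans (cong (λ z → ∑ (suc n) w * (v n - v (suc n)) + z) (∑-byParts n w v))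
        (lemma (w n) (∑ n w) (v n) (v (suc n)) (∑[ j < n ] (w j * v j)))
  where
  lemma : ∀ a s x y z → (a + s) * (x - y) + (z - s * x) ≡ a * x + z - (a + s) * y
  lemma = solve-∀

-- Recursive, so that a sum up to `double (suc n)` unfolds into two terms by computation.
double : ℕ → ℕ
double zero    = zero
double (suc n) = suc (suc (double n))

∑-parity : ∀ n (f : ℕ → ℤ) → ∑ (double n) f ≡ ∑ n (f ∘ double) + ∑ n (f ∘ suc ∘ double)
∑-parity zero    f = refl
∑-parity (suc n) f = trans
  (cong (λ z → f (suc (double n)) + (f (double n) + z)) (∑-parity n f))
  (lemma (f (suc (double n))) (f (double n)) (∑ n (f ∘ double)) (∑ n (f ∘ suc ∘ double)))
  where
  lemma : ∀ a b c d → a + (b + (c + d)) ≡ b + c + (a + d)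
  lemma = solve-∀

∑-split : ∀ m n (f : ℕ → ℤ) → ∑ (m ℕ.+ n) f ≡ ∑ m f + ∑[ i < n ] f (m ℕ.+ i)
∑-split zero    n f = sym (ℤ.+-identityˡ _)
∑-split (suc m) n f = begin
  ∑ (suc (m ℕ.+ n)) f
    ≡⟨ ∑-head (m ℕ.+ n) f ⟩
  f 0 + ∑ (m ℕ.+ n) (f ∘ suc)
    ≡⟨ cong (f 0 +_) (∑-split m n (f ∘ suc)) ⟩
  f 0 + (∑ m (f ∘ suc) + ∑[ i < n ] f (suc m ℕ.+ i))
    ≡⟨ ℤ.+-assoc (f 0) (∑ m (f ∘ suc)) _ ⟨
  f 0 + ∑ m (f ∘ suc) + ∑[ i < n ] f (suc m ℕ.+ i)
    ≡⟨ cong (_+ ∑[ i < n ] f (suc m ℕ.+ i)) (∑-head m f) ⟨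
  ∑ (suc m) f + ∑[ i < n ] f (suc m ℕ.+ i) ∎
  where open ≡-Reasoning

△ : ℕ → (f g : ℕ → ℤ) → ℤ
△ n f g = ∑[ j < n ] (f j * ∑ j g)

△-ext : ∀ n {f f′ g g′} → (∀ i → i ℕ.< n → f i ≡ f′ i) → (∀ i → i ℕ.< n → g i ≡ g′ i) →
        △ n f g ≡ △ n f′ g′
△-ext n h k = ∑-ext n λ j j<n → cong₂ _*_ (h j j<n) (∑-ext j λ i i<j → k i (ℕ.<-trans i<j j<n))

△-cong : ∀ {p} n {f f′ g g′} → (∀ i → i ℕ.< n → f i ≡ f′ i [mod p ]) →
         (∀ i → i ℕ.< n → g i ≡ g′ i [mod p ]) → △ n f g ≡ △ n f′ g′ [mod p ]
△-cong n h k = ∑-cong n λ j j<n → mod-*-cong (h j j<n) (∑-cong j λ i i<j → k i (ℕ.<-trans i<j j<n))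

△-* : ∀ n c d f g → △ n (λ i → c * f i) (λ i → d * g i) ≡ c * d * △ n f g
△-* n c d f g = trans
  (∑-ext n λ j _ → trans (cong (λ z → c * f j * z) (sym (*-∑ j d g))) (lemma c (f j) d (∑ j g)))
  (sym (*-∑ n (c * d) _))
  where
  lemma : ∀ a b c d → a * b * (c * d) ≡ a * c * (b * d)
  lemma = solve-∀

-- The diagonal is given to the first summand, as even against odd denominators require: 2i + 1 < 2j
-- + 2 exactly when i ≤ j.
△-shuffle : ∀ n (f g : ℕ → ℤ) → ∑ n f * ∑ n g ≡ ∑[ j < n ] (f j * ∑ (suc j) g) + △ n g f
△-shuffle zero    f g = refl
△-shuffle (suc n) f g = trans (lemma (f n) (g n) (∑ n f) (∑ n g))
  (trans (cong (λ z → f n * (g n + ∑ n g) + (g n * ∑ n f + z)) (△-shuffle n f g))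
    (lemma′ (f n * (g n + ∑ n g)) (g n * ∑ n f) (∑[ j < n ] (f j * ∑ (suc j) g)) (△ n g f)))
  where
  lemma : ∀ a b c d → (a + c) * (b + d) ≡ a * (b + d) + (b * c + c * d)
  lemma = solve-∀
  lemma′ : ∀ a b c d → a + (b + (c + d)) ≡ a + c + (b + d)
  lemma′ = solve-∀

△-diagonal : ∀ n (f g : ℕ → ℤ) → ∑[ j < n ] (f j * ∑ (suc j) g) ≡ ∑[ j < n ] (f j * g j) + △ n f g
△-diagonal n f g = trans (∑-ext n λ j _ → ℤ.*-distribˡ-+ (f j) (g j) (∑ j g)) (∑-+ n _ _)

△-head : ∀ n (f g : ℕ → ℤ) → △ (suc n) f g ≡ g 0 * ∑ n (f ∘ suc) + △ n (f ∘ suc) (g ∘ suc)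
△-head n f g = begin
  △ (suc n) f g
    ≡⟨ ∑-head n (λ j → f j * ∑ j g) ⟩
  f 0 * 0ℤ + ∑[ j < n ] (f (suc j) * ∑ (suc j) g)
    ≡⟨ cong (_+ ∑[ j < n ] (f (suc j) * ∑ (suc j) g)) (ℤ.*-zeroʳ (f 0)) ⟩
  0ℤ + ∑[ j < n ] (f (suc j) * ∑ (suc j) g)
    ≡⟨ ℤ.+-identityˡ _ ⟩
  ∑[ j < n ] (f (suc j) * ∑ (suc j) g)
    ≡⟨ ∑-ext n (λ j _ → trans (cong (f (suc j) *_) (∑-head j g)) (lemma (f (suc j)) (g 0) (∑ j (g ∘ suc)))) ⟩
  ∑[ j < n ] (g 0 * f (suc j) + f (suc j) * ∑ j (g ∘ suc))
    ≡⟨ ∑-+ n (λ j → g 0 * f (suc j)) (λ j → f (suc j) * ∑ j (g ∘ suc)) ⟩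
  ∑[ j < n ] (g 0 * f (suc j)) + △ n (f ∘ suc) (g ∘ suc)
    ≡⟨ cong (_+ △ n (f ∘ suc) (g ∘ suc)) (*-∑ n (g 0) (f ∘ suc)) ⟨
  g 0 * ∑ n (f ∘ suc) + △ n (f ∘ suc) (g ∘ suc) ∎
  where
  open ≡-Reasoning
  lemma : ∀ a b c → a * (b + c) ≡ b * a + a * c
  lemma = solve-∀

-- Reversal turns i < j into i > j, so the two functions trade places.
△-reverse : ∀ n (f g : ℕ → ℤ) → △ n (f ∘ rev n) (g ∘ rev n) ≡ △ n g f
△-reverse zero    f g = refl
△-reverse (suc n) f g = trans (△-head n (f ∘ rev (suc n)) (g ∘ rev (suc n)))
  (cong₂ (λ x y → g n * x + y) (sym (∑-reverse n f)) (△-reverse n f g))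

-- With j′ = n - 1 - j the condition i < j reads i + j′ < n - 1, and pairs are collected by k = i +
-- j′ + 1. For a fixed k the denominators 2j′ + 2 and 2i + 2 have the constant sum 2k + 2, as
-- partial fractions need.
△-antidiagonal : ∀ n (f g : ℕ → ℤ) → △ n (f ∘ rev n) g ≡ ∑[ k < n ] ∑[ i < k ] (f (rev k i) * g i)
△-antidiagonal zero    f g = refl
△-antidiagonal (suc n) f g = begin
  f (n ∸ n) * ∑ n g + △ n (f ∘ rev (suc n)) g
    ≡⟨ cong₂ (λ i t → f i * ∑ n g + t) (ℕ.n∸n≡0 n)
         (△-ext n {g = g} (λ j j<n → cong f (shift j<n)) (λ _ _ → refl)) ⟩
  f 0 * ∑ n g + △ n (f ∘ suc ∘ rev n) g
    ≡⟨ cong₂ _+_ (*-∑ n (f 0) g) (△-antidiagonal n (f ∘ suc) g) ⟩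
  ∑[ k < n ] (f 0 * g k) + ∑[ k < n ] ∑[ i < k ] (f (suc (rev k i)) * g i)
    ≡⟨ ∑-+ n (λ k → f 0 * g k) (λ k → ∑[ i < k ] (f (suc (rev k i)) * g i)) ⟨
  ∑[ k < n ] (f 0 * g k + ∑[ i < k ] (f (suc (rev k i)) * g i))
    ≡⟨ ∑-ext n (λ k _ → cong₂ (λ j t → f j * g k + t) (ℕ.n∸n≡0 k)
         (∑-ext k λ i i<k → cong (λ j → f j * g i) (shift i<k))) ⟨
  ∑[ k < n ] ∑[ i < suc k ] (f (rev (suc k) i) * g i)
    ≡⟨ ℤ.+-identityˡ _ ⟨
  0ℤ + ∑[ k < n ] ∑[ i < suc k ] (f (rev (suc k) i) * g i)
    ≡⟨ ∑-head n (λ k → ∑[ i < k ] (f (rev k i) * g i)) ⟨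
  ∑[ k < suc n ] ∑[ i < k ] (f (rev k i) * g i) ∎
  where
  open ≡-Reasoning
  shift : ∀ {k j} → j ℕ.< k → k ∸ j ≡ suc (rev k j)
  shift {suc k} {j} (s≤s j≤k) = ℕ.+-∸-assoc 1 j≤k

-- Arithmetic modulo p

double-+ : ∀ m n → double (m ℕ.+ n) ≡ double m ℕ.+ double n
double-+ zero    n = refl
double-+ (suc m) n = cong (suc ∘ suc) (double-+ m n)

double-mono-≤ : ∀ {m n} → m ℕ.≤ n → double m ℕ.≤ double n
double-mono-≤ z≤n     = z≤n
double-mono-≤ (s≤s h) = s≤s (s≤s (double-mono-≤ h))

pos-double : ∀ n → ℤ.+ double n ≡ ℤ.+ 2 * ℤ.+ n
pos-double n = trans (cong ℤ.+_ (double≡2* n)) (ℤ.pos-* 2 n)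
  where
  double≡2* : ∀ n → double n ≡ 2 ℕ.* n
  double≡2* zero    = refl
  double≡2* (suc n) = cong suc (trans (cong suc (double≡2* n)) (sym (ℕ.+-suc n (n ℕ.+ 0))))

double≡+ : ∀ n → double n ≡ n ℕ.+ n
double≡+ zero    = refl
double≡+ (suc n) = cong suc (trans (cong suc (double≡+ n)) (sym (ℕ.+-suc n n)))

rev-+ : ∀ {n i} → i ℕ.< n → suc (i ℕ.+ rev n i) ≡ n
rev-+ = ℕ.m+[n∸m]≡n

sgn : Sign → ℤ
sgn s = s ℤ.◃ 1

sgn-^-square : ∀ s n → sgn s ^ n * sgn s ^ n ≡ 1ℤ
sgn-^-square s zero    = refl
sgn-^-square s (suc n) = trans (lemma (sgn s) (sgn s ^ n)) (cong₂ _*_ (square s) (sgn-^-square s n))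
  where
  square : ∀ s → sgn s * sgn s ≡ 1ℤ
  square Sign.+ = refl
  square Sign.- = refl
  lemma : ∀ s x → s * x * (s * x) ≡ s * s * (x * x)
  lemma = solve-∀

sgn-*-^ : ∀ s t n → sgn (s Sign.* t) ^ n ≡ sgn s ^ n * sgn t ^ n
sgn-*-^ s t zero    = refl
sgn-*-^ s t (suc n) = trans (cong₂ _*_ (sgn-* s t) (sgn-*-^ s t n)) (lemma (sgn s) (sgn t) (sgn s ^ n) (sgn t ^ n))
  where
  sgn-* : ∀ s t → sgn (s Sign.* t) ≡ sgn s * sgn t
  sgn-* Sign.+ Sign.+ = refl
  sgn-* Sign.+ Sign.- = refl
  sgn-* Sign.- Sign.+ = refl
  sgn-* Sign.- Sign.- = refl
  lemma : ∀ s t x y → s * t * (x * y) ≡ s * x * (t * y)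
  lemma = solve-∀

-- The exponents i + 1 and rev n i + 1 add up to n + 1, and a power of a sign is its own inverse.
sgn-^-complement : ∀ s {n i} → i ℕ.< n → sgn s ^ suc i ≡ sgn s ^ suc n * sgn s ^ suc (rev n i)
sgn-^-complement s {n} {i} i<n = begin
  x ^ suc i                              ≡⟨ ℤ.*-identityʳ (x ^ suc i) ⟨
  x ^ suc i * 1ℤ                         ≡⟨ cong (x ^ suc i *_) (sgn-^-square s (suc r)) ⟨
  x ^ suc i * (x ^ suc r * x ^ suc r)    ≡⟨ ℤ.*-assoc (x ^ suc i) (x ^ suc r) (x ^ suc r) ⟨
  x ^ suc i * x ^ suc r * x ^ suc r      ≡⟨ cong (_* x ^ suc r) (ℤ.^-distribˡ-+-* x (suc i) (suc r)) ⟨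
  x ^ (suc i ℕ.+ suc r) * x ^ suc r      ≡⟨ cong (λ n → x ^ n * x ^ suc r) (trans (ℕ.+-suc (suc i) r) (cong suc (rev-+ i<n))) ⟩
  x ^ suc n * x ^ suc r                  ∎
  where
  open ≡-Reasoning
  r = rev n i
  x = sgn s

module Modulo (m : ℕ) (p-prime : Prime (suc (double m))) where

  p : ℕ
  p = suc (double m)

  P : ℙ
  P = p , p-prime

  infix 4 _≃_
  _≃_ : ℤ → ℤ → Set
  a ≃ b = a ≡ b [mod p ]

  open module ≃-Reasoning = SetoidReasoning (mod-setoid p) public

  *-congˡ : ∀ a {b c} → b ≃ c → a * b ≃ a * c
  *-congˡ a = mod-*-cong (≡⇒mod {a = a} refl)

  *-congʳ : ∀ a {b c} → b ≃ c → b * a ≃ c * a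
  *-congʳ a h = mod-*-cong h (≡⇒mod {a = a} refl)

  +-congˡ : ∀ a {b c} → b ≃ c → a + b ≃ a + c
  +-congˡ a = mod-+-cong (≡⇒mod {a = a} refl)

  +-congʳ : ∀ a {b c} → b ≃ c → b + a ≃ c + a
  +-congʳ a h = mod-+-cong h (≡⇒mod {a = a} refl)

  p≃0 : ℤ.+ p ≃ 0ℤ
  p≃0 = congruent (divides 1ℤ (lemma (ℤ.+ p)))
    where
    lemma : ∀ a → a - 0ℤ ≡ 1ℤ * a
    lemma = solve-∀

  ∤-small : ∀ {k} → 0 ℕ.< k → k ℕ.< p → ¬ p ℕ.∣ k
  ∤-small {suc k} _ k<p p∣k = ℕ.<⇒≱ k<p (ℕ.∣⇒≤ p∣k)

  cancelˡ : ∀ k {a b} → 0 ℕ.< k → k ℕ.< p → ℤ.+ k * a ≃ ℤ.+ k * b → a ≃ b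
  cancelˡ k 0<k k<p = mod-cancelˡ P k (∤-small 0<k k<p)

  ι : ℕ → ℤ
  ι k = inverse k p

  ι-inverse : ∀ {k} → 0 ℕ.< k → k ℕ.< p → ℤ.+ k * ι k ≃ 1ℤ
  ι-inverse {k} 0<k k<p = inverse-correct k P (∤-small 0<k k<p)

  ι-unique : ∀ {k a} → 0 ℕ.< k → k ℕ.< p → ℤ.+ k * a ≃ 1ℤ → ι k ≃ a
  ι-unique {k} 0<k k<p h = cancelˡ k 0<k k<p (mod-trans (ι-inverse 0<k k<p) (mod-sym h))

  ι-complement : ∀ {k l} → 0 ℕ.< k → 0 ℕ.< l → k ℕ.+ l ≡ p → ι k ≃ - ι l
  ι-complement {k} {l} 0<k 0<l k+l≡p = ι-unique 0<k (subst (k ℕ.<_) k+l≡p (ℕ.m<m+n k 0<l)) (begin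
    ℤ.+ k * - ι l                           ≡⟨ lemma (ℤ.+ k) (ℤ.+ l) (ι l) ⟩
    ℤ.+ l * ι l - (ℤ.+ k + ℤ.+ l) * ι l     ≡⟨ cong (λ n → ℤ.+ l * ι l - n * ι l) (trans (sym (ℤ.pos-+ k l)) (cong ℤ.+_ k+l≡p)) ⟩
    ℤ.+ l * ι l - ℤ.+ p * ι l               ≈⟨ mod-+-cong (ι-inverse 0<l (subst (l ℕ.<_) k+l≡p (ℕ.m<n+m l 0<k)))
                                                 (mod-neg-cong (*-congʳ (ι l) p≃0)) ⟩
    1ℤ                                      ∎)
    where
    lemma : ∀ k l x → k * - x ≡ l * x - (k + l) * x
    lemma = solve-∀

  -- The summands with k = 2j + 2 and with k = 2j + 1
  e o : Sign → ℕ → ℤ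
  e s j = sgn s ^ suc j * ι (double (suc j))
  o s j = sgn s ^ suc j * ι (suc (double j))

  κ : Sign → ℤ
  κ s = - sgn s ^ suc m

  even<p : ∀ {j} → j ℕ.< m → double (suc j) ℕ.< p
  even<p j<m = s≤s (double-mono-≤ j<m)

  odd<p : ∀ {j} → j ℕ.< m → suc (double j) ℕ.< p
  odd<p j<m = ℕ.<-trans ℕ.≤-refl (even<p j<m)

  o-reflect : ∀ s i → i ℕ.< m → o s i ≃ κ s * e s (rev m i)
  o-reflect s i i<m = begin
    sgn s ^ suc i * ι (suc (double i))
      ≈⟨ *-congˡ (sgn s ^ suc i) (ι-complement (s≤s z≤n) (s≤s z≤n) 2i+1+2r≡p) ⟩
    sgn s ^ suc i * - x
      ≡⟨ cong (λ z → z * - x) (sgn-^-complement s i<m) ⟩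
    sgn s ^ suc m * sgn s ^ suc r * - x
      ≡⟨ lemma (sgn s ^ suc m) (sgn s ^ suc r) x ⟩
    κ s * (sgn s ^ suc r * x) ∎
    where
    r = rev m i
    x = ι (double (suc r))
    2i+1+2r≡p : suc (double i) ℕ.+ double (suc r) ≡ p
    2i+1+2r≡p = cong suc (trans (sym (double-+ i (suc r)))
      (cong double (trans (ℕ.+-suc i r) (rev-+ i<m))))
    lemma : ∀ a b x → a * b * - x ≡ - a * (b * x)
    lemma = solve-∀

  -- This is 1/(ab) = (1/a + 1/b)/(a + b) with a = 2(k - i), b = 2i + 2 and a + b = 2k + 2. The
  -- product of signs arises because t to the power i + 1 equals t to the power k + 1 times t to the
  -- power `suc (rev k i)`, and likewise for s.
  partialFractions : ∀ s t k → k ℕ.< m → ∀ i → i ℕ.< k →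
    e s (rev k i) * e t i ≃ e t k * e (s Sign.* t) (rev k i) + e s k * e (s Sign.* t) i
  partialFractions s t k k<m i i<k = begin
    A * x * (B * y)
      ≡⟨ lemma₁ A B x y ⟩
    A * B * (1ℤ * y * 1ℤ * x)
      -- The factors 1 become `a * x` and `c * z`, so that `c ≡ a + b` can split the product.
      ≈⟨ *-congˡ (A * B) (mod-*-cong (mod-*-cong (*-congʳ y (mod-sym ax)) (mod-sym cz)) (≡⇒mod {a = x} refl)) ⟩
    A * B * (a * x * y * (c * z) * x)
      ≡⟨ cong (λ w → A * B * (a * x * y * (w * z) * x)) c≡a+b ⟩
    A * B * (a * x * y * ((a + b) * z) * x)
      ≡⟨ lemma₂ A B a b x y z ⟩
    A * B * z * ((a * x) * (a * x) * y + (a * x) * (b * y) * x)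
      ≈⟨ *-congˡ (A * B * z) (mod-+-cong (*-congʳ y (mod-*-cong ax ax)) (*-congʳ x (mod-*-cong ax by))) ⟩
    A * B * z * (1ℤ * 1ℤ * y + 1ℤ * 1ℤ * x)
      ≡⟨ lemma₃ A B x y z ⟩
    B * 1ℤ * z * (A * x) + 1ℤ * A * z * (B * y)
      ≡⟨ cong₂ (λ u v → B * u * z * (A * x) + v * A * z * (B * y)) (sgn-^-square t (suc r)) (sgn-^-square s (suc i)) ⟨
    B * (B′ * B′) * z * (A * x) + A′ * A′ * A * z * (B * y)
      ≡⟨ lemma₄ A B A′ B′ x y z ⟩
    B * B′ * z * (A * B′ * x) + A′ * A * z * (A′ * B * y)
      ≡⟨ cong₂ _+_
           (cong₂ (λ u v → u * z * (v * x)) (power (sgn t)) (sgn-*-^ s t (suc r)))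
           (cong₂ (λ u v → u * z * (v * y)) (power (sgn s)) (sgn-*-^ s t (suc i))) ⟨
    e t k * e (s Sign.* t) r + e s k * e (s Sign.* t) i ∎
    where
    r = rev k i
    A = sgn s ^ suc r
    B = sgn t ^ suc i
    A′ = sgn s ^ suc i
    B′ = sgn t ^ suc r
    x = ι (double (suc r))
    y = ι (double (suc i))
    z = ι (double (suc k))
    a = ℤ.+ double (suc r)
    b = ℤ.+ double (suc i)
    c = ℤ.+ double (suc k)
    i+r : suc i ℕ.+ suc r ≡ suc k
    i+r = trans (ℕ.+-suc (suc i) r) (cong suc (rev-+ i<k))
    r<k : r ℕ.< k
    r<k = subst (r ℕ.<_) (rev-+ i<k) (s≤s (ℕ.m≤n+m r i))
    c≡a+b : c ≡ a + b
    c≡a+b = trans (cong (ℤ.+_ ∘ double) (trans (sym i+r) (ℕ.+-comm (suc i) (suc r))))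
      (trans (cong ℤ.+_ (double-+ (suc r) (suc i))) (ℤ.pos-+ (double (suc r)) (double (suc i))))
    power : ∀ u → u ^ suc k ≡ u ^ suc i * u ^ suc r
    power u = trans (cong (u ^_) (sym i+r)) (ℤ.^-distribˡ-+-* u (suc i) (suc r))
    ax = ι-inverse (s≤s z≤n) (even<p (ℕ.<-trans r<k k<m))
    by = ι-inverse (s≤s z≤n) (even<p (ℕ.<-trans i<k k<m))
    cz = ι-inverse (s≤s z≤n) (even<p k<m)
    lemma₁ : ∀ A B x y → A * x * (B * y) ≡ A * B * (1ℤ * y * 1ℤ * x)
    lemma₁ = solve-∀
    lemma₂ : ∀ A B a b x y z → A * B * (a * x * y * ((a + b) * z) * x) ≡
             A * B * z * ((a * x) * (a * x) * y + (a * x) * (b * y) * x)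
    lemma₂ = solve-∀
    lemma₃ : ∀ A B x y z → A * B * z * (1ℤ * 1ℤ * y + 1ℤ * 1ℤ * x) ≡
             B * 1ℤ * z * (A * x) + 1ℤ * A * z * (B * y)
    lemma₃ = solve-∀
    lemma₄ : ∀ A B C D x y z → B * (D * D) * z * (A * x) + C * C * A * z * (B * y) ≡
             B * D * z * (A * D * x) + C * A * z * (C * B * y)
    lemma₄ = solve-∀

-- Double sums of inverses: reflection, shuffle products and partial fractions

module DoubleSums (m : ℕ) (p-prime : Prime (suc (double m))) where
  open Modulo m p-prime

  h : Sign → ℤ
  h s = ∑ m (e s)

  -- In `b` the reversal turns i < j into i + j < m - 1, the region in which the two even
  -- denominators add up to less than p.
  a b : Sign → Sign → ℤ
  a s t = △ m (e s) (e t)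
  b s t = △ m (e s ∘ rev m) (e t)

  -- On each antidiagonal the sum 2k + 2 of the denominators is invertible because k < m, and it
  -- becomes the outer index of an `a`.
  b-partialFractions : ∀ s t → b s t ≃ a t (s Sign.* t) + a s (s Sign.* t)
  b-partialFractions s t = begin
    △ m (e s ∘ rev m) (e t)
      ≡⟨ △-antidiagonal m (e s) (e t) ⟩
    ∑[ k < m ] ∑[ i < k ] (e s (rev k i) * e t i)
      ≈⟨ ∑-cong m (λ k k<m → ∑-cong k λ i i<k → partialFractions s t k k<m i i<k) ⟩
    ∑[ k < m ] ∑[ i < k ] (e t k * e (s Sign.* t) (rev k i) + e s k * e (s Sign.* t) i)
      ≡⟨ ∑-ext m (λ k _ → split k) ⟩
    ∑[ k < m ] (e t k * ∑ k (e (s Sign.* t)) + e s k * ∑ k (e (s Sign.* t)))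
      ≡⟨ ∑-+ m _ _ ⟩
    a t (s Sign.* t) + a s (s Sign.* t) ∎
    where
    split : ∀ k → ∑[ i < k ] (e t k * e (s Sign.* t) (rev k i) + e s k * e (s Sign.* t) i)
                ≡ e t k * ∑ k (e (s Sign.* t)) + e s k * ∑ k (e (s Sign.* t))
    split k = trans (∑-+ k (λ i → e t k * e (s Sign.* t) (rev k i)) (λ i → e s k * e (s Sign.* t) i))
      (cong₂ _+_
        (trans (sym (*-∑ k (e t k) (e (s Sign.* t) ∘ rev k)))
               (cong (e t k *_) (sym (∑-reverse k (e (s Sign.* t))))))
        (sym (*-∑ k (e s k) (e (s Sign.* t)))))

  ∑-o : ∀ s → ∑ m (o s) ≃ κ s * h s
  ∑-o s = begin
    ∑ m (o s)                          ≈⟨ ∑-cong m (o-reflect s) ⟩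
    ∑[ i < m ] (κ s * e s (rev m i))   ≡⟨ *-∑ m (κ s) (e s ∘ rev m) ⟨
    κ s * ∑ m (e s ∘ rev m)            ≡⟨ cong (κ s *_) (∑-reverse m (e s)) ⟨
    κ s * h s                          ∎

  ∑-oo : ∀ s t → ∑[ i < m ] (o s i * o t i) ≃ κ s * κ t * ∑[ i < m ] (e s i * e t i)
  ∑-oo s t = begin
    ∑[ i < m ] (o s i * o t i)
      ≈⟨ ∑-cong m (λ i i<m → mod-*-cong (o-reflect s i i<m) (o-reflect t i i<m)) ⟩
    ∑[ i < m ] (κ s * e s (rev m i) * (κ t * e t (rev m i)))
      ≡⟨ ∑-ext m (λ i _ → lemma (κ s) (κ t) (e s (rev m i)) (e t (rev m i))) ⟩
    ∑[ i < m ] (κ s * κ t * (e s (rev m i) * e t (rev m i)))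
      ≡⟨ *-∑ m (κ s * κ t) (λ i → e s (rev m i) * e t (rev m i)) ⟨
    κ s * κ t * ∑[ i < m ] (e s (rev m i) * e t (rev m i))
      ≡⟨ cong (κ s * κ t *_) (∑-reverse m (λ i → e s i * e t i)) ⟨
    κ s * κ t * ∑[ i < m ] (e s i * e t i) ∎
    where
    lemma : ∀ a b c d → a * c * (b * d) ≡ a * b * (c * d)
    lemma = solve-∀

  -- Both indices are reflected, which reverses their order; hence the swapped arguments of `a`.
  △-oo : ∀ s t → △ m (o s) (o t) ≃ κ s * κ t * a t s
  △-oo s t = begin
    △ m (o s) (o t)
      ≈⟨ △-cong m (o-reflect s) (o-reflect t) ⟩
    △ m (λ i → κ s * e s (rev m i)) (λ i → κ t * e t (rev m i))
      ≡⟨ △-* m (κ s) (κ t) (e s ∘ rev m) (e t ∘ rev m) ⟩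
    κ s * κ t * △ m (e s ∘ rev m) (e t ∘ rev m)
      ≡⟨ cong (κ s * κ t *_) (△-reverse m (e s) (e t)) ⟩
    κ s * κ t * a t s ∎

  -- Only the outer index is reflected, which trades i < j for the region of `b`.
  △-oe : ∀ s t → △ m (o s) (e t) ≃ κ s * b s t
  △-oe s t = begin
    △ m (o s) (e t)
      ≈⟨ ∑-cong m (λ j j<m → *-congʳ (∑ j (e t)) (o-reflect s j j<m)) ⟩
    ∑[ j < m ] (κ s * e s (rev m j) * ∑ j (e t))
      ≡⟨ ∑-ext m (λ j _ → ℤ.*-assoc (κ s) (e s (rev m j)) (∑ j (e t))) ⟩
    ∑[ j < m ] (κ s * (e s (rev m j) * ∑ j (e t)))
      ≡⟨ *-∑ m (κ s) (λ j → e s (rev m j) * ∑ j (e t)) ⟨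
    κ s * b s t ∎

  -- Taken as the complement of `△ m (o t) (e s)` in the full product, so that `△-oe` applies. The
  -- result is a sum over i + j ≥ m - 1.
  △-eo : ∀ s t → ∑[ j < m ] (e s j * ∑ (suc j) (o t)) ≃ κ t * (h s * h t - b t s)
  △-eo s t = begin
    ∑[ j < m ] (e s j * ∑ (suc j) (o t))
      ≡⟨ lemma₁ _ (△ m (o t) (e s)) ⟩
    ∑[ j < m ] (e s j * ∑ (suc j) (o t)) + △ m (o t) (e s) - △ m (o t) (e s)
      ≡⟨ cong (_- △ m (o t) (e s)) (△-shuffle m (e s) (o t)) ⟨
    h s * ∑ m (o t) - △ m (o t) (e s)
      ≈⟨ mod-+-cong (*-congˡ (h s) (∑-o t)) (mod-neg-cong (△-oe t s)) ⟩
    h s * (κ t * h t) - κ t * b t s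
      ≡⟨ lemma₂ (h s) (κ t) (h t) (b t s) ⟩
    κ t * (h s * h t - b t s) ∎
    where
    lemma₁ : ∀ x y → x ≡ x + y - y
    lemma₁ = solve-∀
    lemma₂ : ∀ x k y z → x * (k * y) - k * z ≡ k * (x * y - z)
    lemma₂ = solve-∀

  h*h : ∀ s t → h s * h t ≡ ∑[ j < m ] (e s j * e t j) + a s t + a t s
  h*h s t = trans (△-shuffle m (e s) (e t)) (cong (_+ a t s) (△-diagonal m (e s) (e t)))

  e⁺ : ∀ j → e Sign.+ j ≡ ι (double (suc j))
  e⁺ j = trans (cong (_* ι (double (suc j))) (ℤ.^-zeroˡ (suc j))) (ℤ.*-identityˡ _)

  o⁺ : ∀ j → o Sign.+ j ≡ ι (suc (double j))
  o⁺ j = trans (cong (_* ι (suc (double j))) (ℤ.^-zeroˡ (suc j))) (ℤ.*-identityˡ _)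

  κ⁺ : κ Sign.+ ≡ -1ℤ
  κ⁺ = cong -_ (ℤ.^-zeroˡ (suc m))

  κ⁻ : κ Sign.- ≡ -1ℤ ^ m
  κ⁻ = trans (cong -_ (ℤ.-1*i≡-i (-1ℤ ^ m))) (ℤ.neg-involutive _)

  ι-double : ∀ {k} → 0 ℕ.< k → double k ℕ.< p → ι k ≃ ℤ.+ 2 * ι (double k)
  ι-double {k@(suc _)} 0<k 2k<p = ι-unique 0<k (ℕ.≤-<-trans (k≤double k) 2k<p) (begin
    ℤ.+ k * (ℤ.+ 2 * ι (double k))   ≡⟨ lemma (ℤ.+ k) (ι (double k)) ⟩
    ℤ.+ 2 * ℤ.+ k * ι (double k)     ≡⟨ cong (_* ι (double k)) (pos-double k) ⟨
    ℤ.+ double k * ι (double k)      ≈⟨ ι-inverse (s≤s z≤n) 2k<p ⟩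
    1ℤ                               ∎)
    where
    k≤double : ∀ k → k ℕ.≤ double k
    k≤double zero    = z≤n
    k≤double (suc k) = s≤s (ℕ.m≤n⇒m≤1+n (k≤double k))
    lemma : ∀ k x → k * (ℤ.+ 2 * x) ≡ ℤ.+ 2 * k * x
    lemma = solve-∀

  -- The inverse squares of 1, …, p - 1 are summed in two ways: by parity, and in pairs k, p - k.
  -- The results are 2S and 8S.
  ∑-e⁺² : 3 ℕ.< p → ∑[ j < m ] (e Sign.+ j * e Sign.+ j) ≃ 0ℤ
  ∑-e⁺² 3<p = cancelˡ 3 (s≤s z≤n) 3<p (cancelˡ 2 (s≤s z≤n) (ℕ.<-trans ℕ.≤-refl 3<p) (begin
    ℤ.+ 2 * (ℤ.+ 3 * S)          ≡⟨ lemma₁ S ⟩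
    ℤ.+ 4 * S + ℤ.+ 4 * S + - (S + S)
      ≈⟨ +-congʳ (- (S + S)) (mod-trans (mod-sym inPairs) byParity) ⟩
    S + S + - (S + S)            ≡⟨ ℤ.+-inverseʳ (S + S) ⟩
    0ℤ                           ∎))
    where
    S = ∑[ j < m ] (e Sign.+ j * e Sign.+ j)
    F : ℕ → ℤ
    F k = ι (suc k) * ι (suc k)
    lemma₁ : ∀ x → ℤ.+ 2 * (ℤ.+ 3 * x) ≡ ℤ.+ 4 * x + ℤ.+ 4 * x + - (x + x)
    lemma₁ = solve-∀
    lemma₂ : ∀ x → ℤ.+ 2 * x * (ℤ.+ 2 * x) ≡ ℤ.+ 4 * (x * x)
    lemma₂ = solve-∀
    lemma₃ : ∀ x → - x * - x ≡ x * x
    lemma₃ = solve-∀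
    evens : ∑ m (F ∘ suc ∘ double) ≡ S
    evens = ∑-ext m (λ j _ → sym (cong₂ _*_ (e⁺ j) (e⁺ j)))
    odds : ∑ m (F ∘ double) ≃ S
    odds = begin
      ∑ m (F ∘ double)                            ≡⟨ ∑-ext m (λ j _ → cong₂ _*_ (o⁺ j) (o⁺ j)) ⟨
      ∑[ j < m ] (o Sign.+ j * o Sign.+ j)        ≈⟨ ∑-oo Sign.+ Sign.+ ⟩
      κ Sign.+ * κ Sign.+ * S                     ≡⟨ cong (λ k → k * k * S) κ⁺ ⟩
      1ℤ * S                                      ≡⟨ ℤ.*-identityˡ S ⟩
      S                                           ∎
    byParity : ∑ (double m) F ≃ S + S
    byParity = mod-trans (≡⇒mod (∑-parity m F)) (mod-+-cong odds (≡⇒mod evens))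
    small : ∑ m F ≃ ℤ.+ 4 * S
    small = begin
      ∑ m F
        ≈⟨ ∑-cong m (λ j j<m → mod-*-cong (ι-double (s≤s z≤n) (even<p j<m)) (ι-double (s≤s z≤n) (even<p j<m))) ⟩
      ∑[ j < m ] (ℤ.+ 2 * ι (double (suc j)) * (ℤ.+ 2 * ι (double (suc j))))
        ≡⟨ ∑-ext m (λ j _ → trans (lemma₂ (ι (double (suc j)))) (cong (ℤ.+ 4 *_) (sym (cong₂ _*_ (e⁺ j) (e⁺ j))))) ⟩
      ∑[ j < m ] (ℤ.+ 4 * (e Sign.+ j * e Sign.+ j))
        ≡⟨ *-∑ m (ℤ.+ 4) (λ j → e Sign.+ j * e Sign.+ j) ⟨
      ℤ.+ 4 * S ∎
    large : ∀ i → i ℕ.< m → F (m ℕ.+ rev m i) ≃ F i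
    large i i<m = mod-trans (mod-*-cong ι≃ ι≃) (≡⇒mod (lemma₃ (ι (suc i))))
      where
      ι≃ : ι (suc (m ℕ.+ rev m i)) ≃ - ι (suc i)
      ι≃ = ι-complement (s≤s z≤n) (s≤s z≤n) (cong suc (trans (ℕ.+-assoc m (rev m i) (suc i))
        (trans (cong (m ℕ.+_) (ℕ.m∸n+n≡m i<m)) (sym (double≡+ m)))))
    inPairs : ∑ (double m) F ≃ ℤ.+ 4 * S + ℤ.+ 4 * S
    inPairs = begin
      ∑ (double m) F                               ≡⟨ cong (λ n → ∑ n F) (double≡+ m) ⟩
      ∑ (m ℕ.+ m) F                                ≡⟨ ∑-split m m F ⟩
      ∑ m F + ∑[ i < m ] F (m ℕ.+ i)               ≡⟨ cong (∑ m F +_) (∑-reverse m (λ i → F (m ℕ.+ i))) ⟩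
      ∑ m F + ∑[ i < m ] F (m ℕ.+ rev m i)         ≈⟨ mod-+-cong small (mod-trans (∑-cong m large) small) ⟩
      ℤ.+ 4 * S + ℤ.+ 4 * S                        ∎

-- The coefficients of (1 - y)ᵃ (1 + y)ᵇ

-- K a b n is the coefficient of yⁿ in (1 - y)ᵃ (1 + y)ᵇ.
K : ℕ → ℕ → ℕ → ℤ
K zero    zero    zero    = 1ℤ
K zero    zero    (suc n) = 0ℤ
K zero    (suc b) zero    = K zero b zero
K zero    (suc b) (suc n) = K zero b (suc n) + K zero b n
K (suc a) b       zero    = K a b zero
K (suc a) b       (suc n) = K a b (suc n) - K a b n

K-0 : ∀ a b → K a b 0 ≡ 1ℤ
K-0 zero    zero    = refl
K-0 zero    (suc b) = K-0 zero b
K-0 (suc a) b       = K-0 a b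

-- `K` strips the factors 1 - y first, so this recursion holds by definition only for a = 0; in
-- general it says that the factors commute.
K-sucʳ : ∀ a b n → K a (suc b) (suc n) ≡ K a b (suc n) + K a b n
K-sucʳ zero    b n       = refl
K-sucʳ (suc a) b zero    = trans
  (cong₂ _-_ (K-sucʳ a b 0) (trans (K-0 a (suc b)) (sym (K-0 a b))))
  (lemma (K a b 1) (K a b 0))
  where
  lemma : ∀ x y → x + y - y ≡ x - y + y
  lemma = solve-∀
K-sucʳ (suc a) b (suc n) = trans
  (cong₂ _-_ (K-sucʳ a b (suc n)) (K-sucʳ a b n))
  (lemma (K a b (suc (suc n))) (K a b (suc n)) (K a b n))
  where
  lemma : ∀ x y z → x + y - (y + z) ≡ x - y + (y - z)
  lemma = solve-∀

K-degree : ∀ a b n → a ℕ.+ b ℕ.< n → K a b n ≡ 0ℤ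
K-degree zero    zero    (suc n) _       = refl
K-degree zero    (suc b) (suc n) (s≤s h) =
  cong₂ _+_ (K-degree zero b (suc n) (ℕ.m≤n⇒m≤1+n h)) (K-degree zero b n h)
K-degree (suc a) b       (suc n) (s≤s h) =
  cong₂ _-_ (K-degree a b (suc n) (ℕ.m≤n⇒m≤1+n h)) (K-degree a b n h)

-- (1 - y) + (1 + y) = 2
K-sum : ∀ a b n → K (suc a) b n + K a (suc b) n ≡ ℤ.+ 2 * K a b n
K-sum a b zero    rewrite K-0 a b | K-0 a (suc b) = refl
K-sum a b (suc n) = trans (cong (K (suc a) b (suc n) +_) (K-sucʳ a b n)) (lemma (K a b (suc n)) (K a b n))
  where
  lemma : ∀ x y → x - y + (x + y) ≡ ℤ.+ 2 * x
  lemma = solve-∀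

-- (1 + y)² - (1 - y)² = 4y
K-difference : ∀ a b n →
  K a (suc (suc b)) (suc n) - K (suc (suc a)) b (suc n) ≡ ℤ.+ 4 * K a b n
K-difference a b zero
  rewrite K-sucʳ a (suc b) 0 | K-sucʳ a b 0 | K-0 a b | K-0 a (suc b) = lemma (K a b 1)
  where
  lemma : ∀ x → x + 1ℤ + 1ℤ - (x - 1ℤ - 1ℤ) ≡ ℤ.+ 4
  lemma = solve-∀
K-difference a b (suc n)
  rewrite K-sucʳ a (suc b) (suc n) | K-sucʳ a b (suc n) | K-sucʳ a b n =
  lemma (K a b (suc (suc n))) (K a b (suc n)) (K a b n)
  where
  lemma : ∀ x y z → x + y + (y + z) - (x - y - (y - z)) ≡ ℤ.+ 4 * y
  lemma = solve-∀

-- (1 + y)² + (1 - y)² = 2 (1 + y²)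
K-squares : ∀ a b n → K a (suc (suc b)) (suc (suc n)) + K (suc (suc a)) b (suc (suc n)) ≡
            ℤ.+ 2 * (K a b (suc (suc n)) + K a b n)
K-squares a b n
  rewrite K-sucʳ a (suc b) (suc n) | K-sucʳ a b (suc n) | K-sucʳ a b n =
  lemma (K a b (suc (suc n))) (K a b (suc n)) (K a b n)
  where
  lemma : ∀ x y z → x + y + (y + z) + (x - y - (y - z)) ≡ ℤ.+ 2 * (x + z)
  lemma = solve-∀

-- The product rule, read off at yⁿ. For an exponent zero the value of `ℕ.pred` is harmless, since
-- the factor `ℤ.+ 0` kills the term.
K-derivative : ∀ a b n → ℤ.+ suc n * K a b (suc n) ≡
               ℤ.+ b * K a (ℕ.pred b) n - ℤ.+ a * K (ℕ.pred a) b n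
K-derivative zero    zero    n       = ℤ.*-zeroʳ (ℤ.+ suc n)
K-derivative zero    (suc b) zero    = begin
  1ℤ * (K 0 b 1 + K 0 b 0)                       ≡⟨ ℤ.*-distribˡ-+ 1ℤ (K 0 b 1) (K 0 b 0) ⟩
  1ℤ * K 0 b 1 + 1ℤ * K 0 b 0                    ≡⟨ cong₂ (λ x y → x + 1ℤ * y) (K-derivative 0 b 0) (K-0 0 b) ⟩
  ℤ.+ b * K 0 (ℕ.pred b) 0 - 0ℤ + 1ℤ             ≡⟨ cong (λ x → ℤ.+ b * x - 0ℤ + 1ℤ) (K-0 0 (ℕ.pred b)) ⟩
  ℤ.+ b * 1ℤ - 0ℤ + 1ℤ                           ≡⟨ lemma (ℤ.+ b) ⟩
  (1ℤ + ℤ.+ b) * 1ℤ - 0ℤ                         ≡⟨ cong (λ x → ℤ.+ suc b * x - 0ℤ) (K-0 0 b) ⟨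
  ℤ.+ suc b * K 0 b 0 - 0ℤ                       ∎
  where
  open ≡-Reasoning
  lemma : ∀ x → x * 1ℤ - 0ℤ + 1ℤ ≡ (1ℤ + x) * 1ℤ - 0ℤ
  lemma = solve-∀
K-derivative zero    (suc b) (suc n) = begin
  ℤ.+ suc (suc n) * (K 0 b (suc (suc n)) + K 0 b (suc n))
    ≡⟨ lemma₁ (ℤ.+ suc n) (K 0 b (suc (suc n))) (K 0 b (suc n)) ⟩
  ℤ.+ suc (suc n) * K 0 b (suc (suc n)) + ℤ.+ suc n * K 0 b (suc n) + K 0 b (suc n)
    ≡⟨ cong₂ (λ x y → x + y + K 0 b (suc n)) (K-derivative 0 b (suc n)) (K-derivative 0 b n) ⟩
  ℤ.+ b * K 0 (ℕ.pred b) (suc n) - 0ℤ + (ℤ.+ b * K 0 (ℕ.pred b) n - 0ℤ) + K 0 b (suc n)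
    ≡⟨ lemma₂ (ℤ.+ b) (K 0 (ℕ.pred b) (suc n)) (K 0 (ℕ.pred b) n) (K 0 b (suc n)) ⟩
  ℤ.+ b * (K 0 (ℕ.pred b) (suc n) + K 0 (ℕ.pred b) n) + K 0 b (suc n)
    ≡⟨ cong (_+ K 0 b (suc n)) (pred-b b) ⟩
  ℤ.+ b * K 0 b (suc n) + K 0 b (suc n)
    ≡⟨ lemma₃ (ℤ.+ b) (K 0 b (suc n)) ⟩
  ℤ.+ suc b * K 0 b (suc n) - 0ℤ ∎
  where
  open ≡-Reasoning
  pred-b : ∀ b → ℤ.+ b * (K 0 (ℕ.pred b) (suc n) + K 0 (ℕ.pred b) n) ≡ ℤ.+ b * K 0 b (suc n)
  pred-b zero    = refl
  pred-b (suc b) = refl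
  lemma₁ : ∀ n x y → (1ℤ + n) * (x + y) ≡ (1ℤ + n) * x + n * y + y
  lemma₁ = solve-∀
  lemma₂ : ∀ b x y z → b * x - 0ℤ + (b * y - 0ℤ) + z ≡ b * (x + y) + z
  lemma₂ = solve-∀
  lemma₃ : ∀ b z → b * z + z ≡ (1ℤ + b) * z - 0ℤ
  lemma₃ = solve-∀
K-derivative (suc a) b zero = begin
  1ℤ * (K a b 1 - K a b 0)
    ≡⟨ lemma₁ (K a b 1) (K a b 0) ⟩
  1ℤ * K a b 1 - K a b 0
    ≡⟨ cong₂ _-_ (K-derivative a b 0) (K-0 a b) ⟩
  ℤ.+ b * K a (ℕ.pred b) 0 - ℤ.+ a * K (ℕ.pred a) b 0 - 1ℤ
    ≡⟨ cong (λ x → ℤ.+ b * K a (ℕ.pred b) 0 - ℤ.+ a * x - 1ℤ) (K-0 (ℕ.pred a) b) ⟩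
  ℤ.+ b * K a (ℕ.pred b) 0 - ℤ.+ a * 1ℤ - 1ℤ
    ≡⟨ lemma₂ (ℤ.+ b * K a (ℕ.pred b) 0) (ℤ.+ a) ⟩
  ℤ.+ b * K a (ℕ.pred b) 0 - (1ℤ + ℤ.+ a) * 1ℤ
    ≡⟨ cong (λ x → ℤ.+ b * K a (ℕ.pred b) 0 - ℤ.+ suc a * x) (K-0 a b) ⟨
  ℤ.+ b * K a (ℕ.pred b) 0 - ℤ.+ suc a * K a b 0 ∎
  where
  open ≡-Reasoning
  lemma₁ : ∀ x y → 1ℤ * (x - y) ≡ 1ℤ * x - y
  lemma₁ = solve-∀
  lemma₂ : ∀ x a → x - a * 1ℤ - 1ℤ ≡ x - (1ℤ + a) * 1ℤ
  lemma₂ = solve-∀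
K-derivative (suc a) b (suc n) = begin
  ℤ.+ suc (suc n) * (K a b (suc (suc n)) - K a b (suc n))
    ≡⟨ lemma₁ (ℤ.+ suc n) (K a b (suc (suc n))) (K a b (suc n)) ⟩
  ℤ.+ suc (suc n) * K a b (suc (suc n)) - ℤ.+ suc n * K a b (suc n) - K a b (suc n)
    ≡⟨ cong₂ (λ x y → x - y - K a b (suc n)) (K-derivative a b (suc n)) (K-derivative a b n) ⟩
  ℤ.+ b * K a b′ (suc n) - ℤ.+ a * K a′ b (suc n) - (ℤ.+ b * K a b′ n - ℤ.+ a * K a′ b n) - K a b (suc n)
    ≡⟨ lemma₂ (ℤ.+ b) (ℤ.+ a) (K a b′ (suc n)) (K a′ b (suc n)) (K a b′ n) (K a′ b n) (K a b (suc n)) ⟩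
  ℤ.+ b * (K a b′ (suc n) - K a b′ n) - (ℤ.+ a * (K a′ b (suc n) - K a′ b n) + K a b (suc n))
    ≡⟨ cong (λ x → ℤ.+ b * K (suc a) b′ (suc n) - (x + K a b (suc n))) (pred-a a) ⟩
  ℤ.+ b * K (suc a) b′ (suc n) - (ℤ.+ a * K a b (suc n) + K a b (suc n))
    ≡⟨ cong (λ x → ℤ.+ b * K (suc a) b′ (suc n) - x) (lemma₃ (ℤ.+ a) (K a b (suc n))) ⟩
  ℤ.+ b * K (suc a) b′ (suc n) - ℤ.+ suc a * K a b (suc n) ∎
  where
  open ≡-Reasoning
  a′ = ℕ.pred a
  b′ = ℕ.pred b
  pred-a : ∀ a → ℤ.+ a * (K (ℕ.pred a) b (suc n) - K (ℕ.pred a) b n) ≡ ℤ.+ a * K a b (suc n)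
  pred-a zero    = refl
  pred-a (suc a) = refl
  lemma₁ : ∀ n x y → (1ℤ + n) * (x - y) ≡ (1ℤ + n) * x - n * y - y
  lemma₁ = solve-∀
  lemma₂ : ∀ b a x y z w u → b * x - a * y - (b * z - a * w) - u ≡ b * (x - z) - (a * (y - w) + u)
  lemma₂ = solve-∀
  lemma₃ : ∀ a x → a * x + x ≡ (1ℤ + a) * x
  lemma₃ = solve-∀

∑-linear : ∀ n m (c w : ℕ → ℤ) (F : ℕ → ℕ → ℤ) →
  ∑[ N < n ] (w N * ∑[ j < m ] (c j * F j N)) ≡ ∑[ j < m ] (c j * ∑[ N < n ] (w N * F j N))
∑-linear n m c w F = begin
  ∑[ N < n ] (w N * ∑[ j < m ] (c j * F j N))
    ≡⟨ ∑-ext n (λ N _ → *-∑ m (w N) (λ j → c j * F j N)) ⟩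
  ∑[ N < n ] ∑[ j < m ] (w N * (c j * F j N))
    ≡⟨ ∑-swap n m (λ N j → w N * (c j * F j N)) ⟩
  ∑[ j < m ] ∑[ N < n ] (w N * (c j * F j N))
    ≡⟨ ∑-ext m (λ j _ → trans (∑-ext n λ N _ → lemma (w N) (c j) (F j N)) (sym (*-∑ n (c j) (λ N → w N * F j N)))) ⟩
  ∑[ j < m ] (c j * ∑[ N < n ] (w N * F j N)) ∎
  where
  open ≡-Reasoning
  lemma : ∀ x y z → x * (y * z) ≡ y * (x * z)
  lemma = solve-∀

-- Because i²ᴺ = (-1)ᴺ, this is the even part, evaluated at y = i, of a polynomial of degree at most
-- 2m + 1; no square root of -1 is needed.
alternating : ℕ → (ℕ → ℤ) → ℤ
alternating m c = ∑[ N < suc m ] (-1ℤ ^ N * c (double N))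

-- The factor 1 + y² vanishes at i; on coefficients this is a telescoping sum. The hypothesis places
-- the boundary coefficient, of degree 2m, just above the degree a + b.
alternating-squares : ∀ m a b → suc (a ℕ.+ b) ≡ double m →
  alternating m (K a (suc (suc b))) + alternating m (K (suc (suc a)) b) ≡ 0ℤ
alternating-squares m a b a+b<2m = begin
  alternating m (K a (suc (suc b))) + alternating m (K (suc (suc a)) b)
    ≡⟨ ∑-+ (suc m) (λ N → -1ℤ ^ N * K a (suc (suc b)) (double N)) _ ⟨
  ∑[ N < suc m ] (-1ℤ ^ N * K a (suc (suc b)) (double N) + -1ℤ ^ N * K (suc (suc a)) b (double N))
    ≡⟨ ∑-ext (suc m) (λ N _ → step N) ⟩
  ∑[ N < suc m ] (v N - v (suc N))
    ≡⟨ ∑-telescope (suc m) v ⟩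
  0ℤ - v (suc m)
    ≡⟨ cong (λ z → 0ℤ - (-1ℤ ^ suc m * (ℤ.+ 2 * z))) (K-degree a b (double m) (ℕ.≤-reflexive a+b<2m)) ⟩
  0ℤ - (-1ℤ ^ suc m * (ℤ.+ 2 * 0ℤ))
    ≡⟨ cong (λ z → 0ℤ - z) (ℤ.*-zeroʳ (-1ℤ ^ suc m)) ⟩
  0ℤ ∎
  where
  open ≡-Reasoning
  v : ℕ → ℤ
  -- The pattern would continue with the coefficient of y⁻², which is zero.
  v zero    = 0ℤ
  v (suc N) = -1ℤ ^ suc N * (ℤ.+ 2 * K a b (double N))
  step : ∀ N → -1ℤ ^ N * K a (suc (suc b)) (double N) + -1ℤ ^ N * K (suc (suc a)) b (double N) ≡ v N - v (suc N)
  step zero    rewrite K-0 a b | K-0 a (suc (suc b)) = refl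
  step (suc N) = trans (sym (ℤ.*-distribˡ-+ (-1ℤ ^ suc N) (K a (suc (suc b)) (suc (suc (double N)))) _))
    (trans (cong (-1ℤ ^ suc N *_) (K-squares a b (double N)))
      (lemma (-1ℤ ^ suc N) (K a b (suc (suc (double N)))) (K a b (double N))))
    where
    lemma : ∀ s x y → s * (ℤ.+ 2 * (x + y)) ≡ s * (ℤ.+ 2 * y) - -1ℤ * s * (ℤ.+ 2 * x)
    lemma = solve-∀

-- The two polynomial identities and their real parts at y = i

module Identities (m : ℕ) (p-prime : Prime (suc (double m))) where
  open Modulo m p-prime
  open DoubleSums m p-prime

  -- The coefficients of (1 - y)ˡ (1 + y)ᵖ⁻ˡ
  D : ℕ → ℕ → ℤ
  D l = K l (p ∸ l)

  D-≡ : ∀ l {r} → l ℕ.+ r ≡ p → ∀ n → D l n ≡ K l r n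
  D-≡ l {r} l+r≡p n = cong (λ k → K l k n) (trans (cong (_∸ l) (sym l+r≡p)) (ℕ.m+n∸m≡n l r))

  D-0 : ∀ l → D l 0 ≡ 1ℤ
  D-0 l = K-0 l (p ∸ l)

  -- For l ≥ 1, (1 - y)ˡ (1 + y)ᵖ⁻ˡ has the derivative - 2l (1 - y)ˡ⁻¹ (1 + y)ᵖ⁻ˡ⁻¹ modulo p, as p -
  -- l ≡ - l and (1 - y) + (1 + y) = 2. Applying 2y d/dy and dividing by l leaves the factor - 4y,
  -- which `K-difference` turns into the difference of the two neighbours.
  D-integral : ∀ l → suc l ℕ.< p → ∀ n →
    ℤ.+ 2 * (ℤ.+ suc n * (ι (suc l) * D (suc l) (suc n))) ≃ D (suc (suc l)) (suc n) - D l (suc n)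
  D-integral l l+1<p n = begin
    ℤ.+ 2 * (N * (i * D (suc l) (suc n)))
      ≡⟨ cong (λ z → ℤ.+ 2 * (N * (i * z))) (D-≡ (suc l) l+r₁ (suc n)) ⟩
    ℤ.+ 2 * (N * (i * K (suc l) (suc r) (suc n)))
      ≡⟨ lemma₁ N i (K (suc l) (suc r) (suc n)) ⟩
    ℤ.+ 2 * i * (N * K (suc l) (suc r) (suc n))
      ≡⟨ cong (ℤ.+ 2 * i *_) (K-derivative (suc l) (suc r) n) ⟩
    ℤ.+ 2 * i * (ℤ.+ suc r * x - L * y)
      ≡⟨ cong (λ z → ℤ.+ 2 * i * (z * x - L * y)) r≡p-l ⟩
    ℤ.+ 2 * i * ((ℤ.+ p - L) * x - L * y)
      ≡⟨ lemma₂ (ℤ.+ p) L x y i ⟩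
    ℤ.+ 2 * i * x * ℤ.+ p - L * i * (ℤ.+ 2 * (x + y))
      ≈⟨ mod-+-cong (*-congˡ (ℤ.+ 2 * i * x) p≃0) (mod-neg-cong (*-congʳ (ℤ.+ 2 * (x + y)) (ι-inverse (s≤s z≤n) l+1<p))) ⟩
    ℤ.+ 2 * i * x * 0ℤ - 1ℤ * (ℤ.+ 2 * (x + y))
      ≡⟨ cong (λ z → ℤ.+ 2 * i * x * 0ℤ - 1ℤ * (ℤ.+ 2 * z)) (K-sum l r n) ⟩
    ℤ.+ 2 * i * x * 0ℤ - 1ℤ * (ℤ.+ 2 * (ℤ.+ 2 * K l r n))
      ≡⟨ lemma₃ (ℤ.+ 2 * i * x) (K l r n) ⟩
    - (ℤ.+ 4 * K l r n)
      ≡⟨ cong -_ (K-difference l r n) ⟨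
    - (K l (suc (suc r)) (suc n) - K (suc (suc l)) r (suc n))
      ≡⟨ lemma₄ (K l (suc (suc r)) (suc n)) (K (suc (suc l)) r (suc n)) ⟩
    K (suc (suc l)) r (suc n) - K l (suc (suc r)) (suc n)
      ≡⟨ cong₂ _-_ (D-≡ (suc (suc l)) l+r₂ (suc n)) (D-≡ l l+r₀ (suc n)) ⟨
    D (suc (suc l)) (suc n) - D l (suc n) ∎
    where
    N = ℤ.+ suc n
    L = ℤ.+ suc l
    i = ι (suc l)
    r = p ∸ suc (suc l)
    x = K (suc l) r n
    y = K l (suc r) n
    l+r₂ : suc (suc l) ℕ.+ r ≡ p
    l+r₂ = ℕ.m+[n∸m]≡n l+1<p
    l+r₁ : suc l ℕ.+ suc r ≡ p
    l+r₁ = trans (ℕ.+-suc (suc l) r) l+r₂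
    l+r₀ : l ℕ.+ suc (suc r) ≡ p
    l+r₀ = trans (ℕ.+-suc l (suc r)) l+r₁
    r≡p-l : ℤ.+ suc r ≡ ℤ.+ p - L
    r≡p-l = trans (lemma₀ L (ℤ.+ suc r)) (cong (λ k → ℤ.+ k - L) l+r₁)
      where
      lemma₀ : ∀ a b → b ≡ a + b - a
      lemma₀ = solve-∀
    lemma₁ : ∀ n i x → ℤ.+ 2 * (n * (i * x)) ≡ ℤ.+ 2 * i * (n * x)
    lemma₁ = solve-∀
    lemma₂ : ∀ p l x y i → ℤ.+ 2 * i * ((p - l) * x - l * y) ≡ ℤ.+ 2 * i * x * p - l * i * (ℤ.+ 2 * (x + y))
    lemma₂ = solve-∀
    lemma₃ : ∀ z k → z * 0ℤ - 1ℤ * (ℤ.+ 2 * (ℤ.+ 2 * k)) ≡ - (ℤ.+ 4 * k)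
    lemma₃ = solve-∀
    lemma₄ : ∀ x y → - (x - y) ≡ y - x
    lemma₄ = solve-∀

  -- (1 + y)ᵖ ≡ 1 + yᵖ: in the derivative every coefficient carries the factor p.
  K-0p : ∀ n → suc n ℕ.< p → K 0 p (suc n) ≃ 0ℤ
  K-0p n n<p = cancelˡ (suc n) (s≤s z≤n) n<p (begin
    ℤ.+ suc n * K 0 p (suc n)              ≡⟨ K-derivative 0 p n ⟩
    ℤ.+ p * K 0 (double m) n - 0ℤ          ≈⟨ +-congʳ (- 0ℤ) (*-congʳ (K 0 (double m) n) p≃0) ⟩
    0ℤ                                     ≡⟨ ℤ.*-zeroʳ (ℤ.+ suc n) ⟨
    ℤ.+ suc n * 0ℤ                         ∎)

  K-p0 : ∀ n → suc n ℕ.< p → K p 0 (suc n) ≃ 0ℤ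
  K-p0 n n<p = cancelˡ (suc n) (s≤s z≤n) n<p (begin
    ℤ.+ suc n * K p 0 (suc n)              ≡⟨ K-derivative p 0 n ⟩
    0ℤ - ℤ.+ p * K (double m) 0 n          ≈⟨ +-congˡ 0ℤ (mod-neg-cong (*-congʳ (K (double m) 0 n) p≃0)) ⟩
    0ℤ                                     ≡⟨ ℤ.*-zeroʳ (ℤ.+ suc n) ⟨
    ℤ.+ suc n * 0ℤ                         ∎)

  -- (1 - y)ᵖ⁻¹ ≡ (1 - yᵖ)/(1 - y): consecutive coefficients differ by a coefficient of (1 - y)ᵖ.
  K-[p-1]0 : ∀ n → n ℕ.< p → K (double m) 0 n ≃ 1ℤ
  K-[p-1]0 zero    _   = ≡⇒mod (K-0 (double m) 0)
  K-[p-1]0 (suc n) n<p = begin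
    K (double m) 0 (suc n)                                              ≡⟨ lemma _ (K (double m) 0 n) ⟩
    K (double m) 0 (suc n) - K (double m) 0 n + K (double m) 0 n        ≈⟨ mod-+-cong (K-p0 n n<p) (K-[p-1]0 n (ℕ.<-trans ℕ.≤-refl n<p)) ⟩
    1ℤ                                                                  ∎
    where
    lemma : ∀ x y → x ≡ x - y + y
    lemma = solve-∀

  D-p : ∀ n → D p n ≡ K p 0 n
  D-p n = D-≡ p (ℕ.+-identityʳ p) n

  1<p : 1 ℕ.< p
  1<p = ℕ.nonTrivial⇒n>1 p {{prime⇒nonTrivial p-prime}}

  2<p : 2 ℕ.< p
  2<p = odd 1<p
    where
    odd : ∀ {m} → 1 ℕ.< suc (double m) → 2 ℕ.< suc (double m)
    odd {zero}  (s≤s ())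
    odd {suc m} _ = s≤s (s≤s (s≤s z≤n))

  w : ℕ → ℤ
  w i = ι (suc (double i))

  -- The coefficients of ∑ (1/l) (1 - y)ˡ (1 + y)ᵖ⁻ˡ over odd l < p
  X : ℕ → ℤ
  X n = ∑[ j < m ] (w j * D (suc (double j)) n)

  -- After differentiation the sum telescopes to (1 - y)ᵖ⁻¹ (1 + y) - (1 + y)ᵖ, whose coefficients
  -- strictly between degrees 0 and p are all 2.
  X-suc : ∀ n → suc n ℕ.< p → X (suc n) ≃ ι (suc n)
  X-suc n n<p = mod-sym (ι-unique (s≤s z≤n) n<p (cancelˡ 2 (s≤s z≤n) 2<p (begin
    ℤ.+ 2 * (N * X (suc n))
      ≡⟨ cong (ℤ.+ 2 *_) (*-∑ m N (λ j → w j * D (suc (double j)) (suc n))) ⟩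
    ℤ.+ 2 * ∑[ j < m ] (N * (w j * D (suc (double j)) (suc n)))
      ≡⟨ *-∑ m (ℤ.+ 2) (λ j → N * (w j * D (suc (double j)) (suc n))) ⟩
    ∑[ j < m ] (ℤ.+ 2 * (N * (w j * D (suc (double j)) (suc n))))
      ≈⟨ ∑-cong m (λ j j<m → D-integral (double j) (odd<p j<m) n) ⟩
    ∑[ j < m ] (D (double (suc j)) (suc n) - D (double j) (suc n))
      ≡⟨ ∑-ext m (λ j _ → lemma₁ (D (double (suc j)) (suc n)) (D (double j) (suc n))) ⟩
    ∑[ j < m ] (v j - v (suc j))
      ≡⟨ ∑-telescope m v ⟩
    - D 0 (suc n) - - D (double m) (suc n)
      ≡⟨ cong (λ z → - K 0 p (suc n) - - z) (trans (D-≡ (double m) (ℕ.+-comm (double m) 1) (suc n)) (K-sucʳ (double m) 0 n)) ⟩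
    - K 0 p (suc n) - - (K (double m) 0 (suc n) + K (double m) 0 n)
      ≈⟨ mod-+-cong (mod-neg-cong (K-0p n n<p)) (mod-neg-cong (mod-neg-cong
           (mod-+-cong (K-[p-1]0 (suc n) n<p) (K-[p-1]0 n (ℕ.<-trans ℕ.≤-refl n<p))))) ⟩
    ℤ.+ 2 * 1ℤ ∎)))
    where
    N = ℤ.+ suc n
    v : ℕ → ℤ
    v j = - D (double j) (suc n)
    lemma₁ : ∀ x y → x - y ≡ - y - - x
    lemma₁ = solve-∀

  -- The coefficients of ∑ (1/kl) (1 - y)ᵏ (1 + y)ᵖ⁻ᵏ over even k and odd l with p > k > l
  Y : ℕ → ℤ
  Y n = ∑[ j < m ] (∑ (suc j) w * ι (double (suc j)) * D (double (suc j)) n)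

  -- Differentiation turns each even k into a difference of odd neighbours. Abel summation moves the
  -- difference onto the weights and leaves - `X`, so a second factor 1/n appears; the boundary term
  -- belongs to (1 - y)ᵖ and vanishes.
  Y-suc : ∀ n → suc n ℕ.< p → ℤ.+ 2 * Y (suc n) ≃ - (ι (suc n) * ι (suc n))
  Y-suc n n<p = cancelˡ (suc n) (s≤s z≤n) n<p (begin
    N * (ℤ.+ 2 * Y (suc n))
      ≡⟨ ℤ.*-assoc N (ℤ.+ 2) (Y (suc n)) ⟨
    N * ℤ.+ 2 * Y (suc n)
      ≡⟨ *-∑ m (N * ℤ.+ 2) (λ j → W j * ι (double (suc j)) * D (double (suc j)) (suc n)) ⟩
    ∑[ j < m ] (N * ℤ.+ 2 * (W j * ι (double (suc j)) * D (double (suc j)) (suc n)))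
      ≡⟨ ∑-ext m (λ j _ → lemma₁ N (W j) (ι (double (suc j))) (D (double (suc j)) (suc n))) ⟩
    ∑[ j < m ] (W j * (ℤ.+ 2 * (N * (ι (double (suc j)) * D (double (suc j)) (suc n)))))
      ≈⟨ ∑-cong m (λ j j<m → *-congˡ (W j) (D-integral (suc (double j)) (even<p j<m) n)) ⟩
    ∑[ j < m ] (W j * (v (suc j) - v j))
      ≡⟨ ∑-ext m (λ j _ → lemma₂ (W j) (v (suc j)) (v j)) ⟩
    ∑[ j < m ] (-1ℤ * (W j * (v j - v (suc j))))
      ≡⟨ *-∑ m -1ℤ (λ j → W j * (v j - v (suc j))) ⟨
    -1ℤ * ∑[ j < m ] (W j * (v j - v (suc j)))
      ≡⟨ cong (-1ℤ *_) (∑-byParts m w v) ⟩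
    -1ℤ * (X (suc n) - ∑ m w * v m)
      ≈⟨ *-congˡ -1ℤ (mod-+-cong (X-suc n n<p) (mod-neg-cong (*-congˡ (∑ m w) (mod-trans (≡⇒mod (D-p (suc n))) (K-p0 n n<p))))) ⟩
    -1ℤ * (ι (suc n) - ∑ m w * 0ℤ)
      ≡⟨ lemma₃ (ι (suc n)) (∑ m w) ⟩
    - (1ℤ * ι (suc n))
      ≈⟨ mod-neg-cong (*-congʳ (ι (suc n)) (ι-inverse (s≤s z≤n) n<p)) ⟨
    - (N * ι (suc n) * ι (suc n))
      ≡⟨ lemma₄ N (ι (suc n)) ⟩
    N * - (ι (suc n) * ι (suc n)) ∎)
    where
    N = ℤ.+ suc n
    W v : ℕ → ℤ
    W j = ∑ (suc j) w
    v j = D (suc (double j)) (suc n)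
    lemma₁ : ∀ n s i d → n * ℤ.+ 2 * (s * i * d) ≡ s * (ℤ.+ 2 * (n * (i * d)))
    lemma₁ = solve-∀
    lemma₂ : ∀ s x y → s * (x - y) ≡ -1ℤ * (s * (y - x))
    lemma₂ = solve-∀
    lemma₃ : ∀ x y → -1ℤ * (x - y * 0ℤ) ≡ - (1ℤ * x)
    lemma₃ = solve-∀
    lemma₄ : ∀ n x → - (n * x * x) ≡ n * - (x * x)
    lemma₄ = solve-∀

  -- The real part of the value at y = i
  ρ : (ℕ → ℤ) → ℤ
  ρ = alternating m

  -- This is ((1 - i)/(1 + i))² = -1.
  ρ-D : ∀ l → suc l ℕ.< p → ρ (D (suc (suc l))) ≡ -1ℤ * ρ (D l)
  ρ-D l l+1<p = trans (lemma (ρ (D l)) (ρ (D (suc (suc l)))))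
    (trans (cong (λ z → -1ℤ * ρ (D l) + z)
      (trans (cong (λ k → ρ (K l k) + ρ (D (suc (suc l)))) p∸l)
             (alternating-squares m l r (ℕ.suc-injective l+r₂))))
      (ℤ.+-identityʳ _))
    where
    r = p ∸ suc (suc l)
    l+r₂ : suc (suc l) ℕ.+ r ≡ p
    l+r₂ = ℕ.m+[n∸m]≡n l+1<p
    p∸l : p ∸ l ≡ suc (suc r)
    p∸l = trans (cong (_∸ l) (sym (trans (ℕ.+-suc l (suc r)) (trans (cong suc (ℕ.+-suc l r)) l+r₂))))
      (ℕ.m+n∸m≡n l (suc (suc r)))
    lemma : ∀ x y → y ≡ -1ℤ * x + (x + y)
    lemma = solve-∀

  ρ-D-even : ∀ j → j ℕ.≤ m → ρ (D (double j)) ≡ -1ℤ ^ j * ρ (D 0)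
  ρ-D-even zero    _   = sym (ℤ.*-identityˡ _)
  ρ-D-even (suc j) j<m = trans (ρ-D (double j) (odd<p j<m))
    (trans (cong (-1ℤ *_) (ρ-D-even j (ℕ.<⇒≤ j<m))) (sym (ℤ.*-assoc -1ℤ (-1ℤ ^ j) (ρ (D 0)))))

  ρ-D-odd : ∀ j → j ℕ.≤ m → ρ (D (suc (double j))) ≡ -1ℤ ^ j * ρ (D 1)
  ρ-D-odd zero    _   = sym (ℤ.*-identityˡ _)
  ρ-D-odd (suc j) j<m = trans (ρ-D (suc (double j)) (even<p j<m))
    (trans (cong (-1ℤ *_) (ρ-D-odd j (ℕ.<⇒≤ j<m))) (sym (ℤ.*-assoc -1ℤ (-1ℤ ^ j) (ρ (D 1)))))

  ρ-head : ∀ c → ρ c ≡ c 0 + ∑[ N < m ] (-1ℤ ^ suc N * c (double (suc N)))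
  ρ-head c = trans (∑-head m (λ N → -1ℤ ^ N * c (double N)))
    (cong (λ z → z + ∑[ N < m ] (-1ℤ ^ suc N * c (double (suc N)))) (ℤ.*-identityˡ (c 0)))

  -- Meant for (1 ± y)ᵖ ≡ 1 ± yᵖ: the term of odd degree p is imaginary at i.
  ρ≃1 : ∀ c → c 0 ≡ 1ℤ → (∀ n → suc n ℕ.< p → c (suc n) ≃ 0ℤ) → ρ c ≃ 1ℤ
  ρ≃1 c c₀ c₊ = begin
    ρ c
      ≡⟨ ρ-head c ⟩
    c 0 + ∑[ N < m ] (-1ℤ ^ suc N * c (double (suc N)))
      ≈⟨ mod-+-cong (≡⇒mod c₀) (∑-cong m λ N N<m → *-congˡ (-1ℤ ^ suc N) (c₊ _ (even<p N<m))) ⟩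
    1ℤ + ∑[ N < m ] (-1ℤ ^ suc N * 0ℤ)
      ≡⟨ cong (1ℤ +_) (trans (∑-ext m (λ N _ → ℤ.*-zeroʳ (-1ℤ ^ suc N))) (∑-zero m)) ⟩
    1ℤ ∎

  ρ-D0 : ρ (D 0) ≃ 1ℤ
  ρ-D0 = ρ≃1 (K 0 p) (K-0 0 p) K-0p

  ρ-D1 : -1ℤ ^ m * ρ (D 1) ≃ 1ℤ
  ρ-D1 = mod-trans (≡⇒mod (sym (ρ-D-odd m ℕ.≤-refl)))
    (ρ≃1 (D p) (D-0 p) (λ n n<p → mod-trans (≡⇒mod (D-p (suc n))) (K-p0 n n<p)))

  -- The real part of `X` is computed twice: from its coefficients, giving h⁻ - h⁺, and summand by
  -- summand, giving - h⁻.
  2h⁻≃h⁺ : ℤ.+ 2 * h Sign.- ≃ h Sign.+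
  2h⁻≃h⁺ = begin
    ℤ.+ 2 * h⁻                    ≡⟨ lemma₁ h⁻ h⁺ ⟩
    -1ℤ * h⁺ + h⁻ + (h⁻ + h⁺)     ≈⟨ +-congʳ (h⁻ + h⁺) (mod-trans (mod-sym ρ-X) ρ-X′) ⟩
    -1ℤ * h⁻ + (h⁻ + h⁺)          ≡⟨ lemma₂ h⁻ h⁺ ⟩
    h⁺                            ∎
    where
    h⁺ = h Sign.+
    h⁻ = h Sign.-
    lemma₁ : ∀ x y → ℤ.+ 2 * x ≡ -1ℤ * y + x + (x + y)
    lemma₁ = solve-∀
    lemma₂ : ∀ x y → -1ℤ * x + (x + y) ≡ y
    lemma₂ = solve-∀
    lemma₃ : ∀ r s x → x * (s * r) ≡ -1ℤ * r * (-1ℤ * s * x)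
    lemma₃ = solve-∀
    lemma₄ : ∀ r s x → -1ℤ * r * (s * x) ≡ -1ℤ * (s * r * x)
    lemma₄ = solve-∀
    ρ-X : ρ X ≃ -1ℤ * h⁺ + h⁻
    ρ-X = begin
      ρ X
        ≡⟨ ρ-head X ⟩
      X 0 + ∑[ N < m ] (-1ℤ ^ suc N * X (double (suc N)))
        ≈⟨ mod-+-cong
             (≡⇒mod (∑-ext m λ j _ → trans (cong (w j *_) (D-0 (suc (double j)))) (trans (ℤ.*-identityʳ (w j)) (sym (o⁺ j)))))
             (∑-cong m λ N N<m → *-congˡ (-1ℤ ^ suc N) (X-suc _ (even<p N<m))) ⟩
      ∑ m (o Sign.+) + h⁻
        ≈⟨ +-congʳ h⁻ (∑-o Sign.+) ⟩
      κ Sign.+ * h⁺ + h⁻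
        ≡⟨ cong (λ k → k * h⁺ + h⁻) κ⁺ ⟩
      -1ℤ * h⁺ + h⁻ ∎
    ρ-X′ : ρ X ≃ -1ℤ * h⁻
    ρ-X′ = begin
      ρ X
        ≡⟨ ∑-linear (suc m) m w (-1ℤ ^_) (λ j N → D (suc (double j)) (double N)) ⟩
      ∑[ j < m ] (w j * ρ (D (suc (double j))))
        ≡⟨ ∑-ext m (λ j j<m → trans (cong (w j *_) (ρ-D-odd j (ℕ.<⇒≤ j<m))) (lemma₃ (ρ (D 1)) (-1ℤ ^ j) (w j))) ⟩
      ∑[ j < m ] (-1ℤ * ρ (D 1) * o Sign.- j)
        ≡⟨ *-∑ m (-1ℤ * ρ (D 1)) (o Sign.-) ⟨
      -1ℤ * ρ (D 1) * ∑ m (o Sign.-)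
        ≈⟨ *-congˡ (-1ℤ * ρ (D 1)) (mod-trans (∑-o Sign.-) (≡⇒mod (cong (_* h⁻) κ⁻))) ⟩
      -1ℤ * ρ (D 1) * (-1ℤ ^ m * h⁻)
        ≡⟨ lemma₄ (ρ (D 1)) (-1ℤ ^ m) h⁻ ⟩
      -1ℤ * (-1ℤ ^ m * ρ (D 1) * h⁻)
        ≈⟨ *-congˡ -1ℤ (*-congʳ h⁻ ρ-D1) ⟩
      -1ℤ * (1ℤ * h⁻)
        ≡⟨ cong (-1ℤ *_) (ℤ.*-identityˡ h⁻) ⟩
      -1ℤ * h⁻ ∎

  -- The alternating sum of the inverse squares of even numbers; it will turn out to be χ times the
  -- Euler number term.
  τ : ℤ
  τ = ∑[ j < m ] (e Sign.- j * e Sign.+ j)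

  -- The real part of `Y` is computed twice. Each even k contributes a value ± 1, and this sign
  -- makes the outer sum alternating. The constant term `Y 0` is a double sum without signs; shuffle
  -- product and partial fractions reduce it to the sum of inverse squares, which is zero for p > 3.
  △-e⁻o⁺ : 3 ℕ.< p → ℤ.+ 2 * ∑[ j < m ] (e Sign.- j * ∑ (suc j) (o Sign.+)) ≃ - τ
  △-e⁻o⁺ 3<p = begin
    ℤ.+ 2 * ∑[ j < m ] (e Sign.- j * ∑ (suc j) (o Sign.+))
      ≡⟨ cong (ℤ.+ 2 *_) (∑-ext m λ j _ → trans
           (cong (e Sign.- j *_) (∑-ext (suc j) λ i _ → o⁺ i))
           (lemma₁ (-1ℤ ^ suc j) (ι (double (suc j))) (W j))) ⟩
    ℤ.+ 2 * ∑[ j < m ] (W j * ι (double (suc j)) * (-1ℤ ^ suc j * 1ℤ))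
      ≈⟨ *-congˡ (ℤ.+ 2) (∑-cong m λ j j<m → *-congˡ (W j * ι (double (suc j))) (mod-sym
           (mod-trans (≡⇒mod (ρ-D-even (suc j) j<m)) (*-congˡ (-1ℤ ^ suc j) ρ-D0)))) ⟩
    ℤ.+ 2 * ∑[ j < m ] (W j * ι (double (suc j)) * ρ (D (double (suc j))))
      ≡⟨ cong (ℤ.+ 2 *_) (∑-linear (suc m) m (λ j → W j * ι (double (suc j))) (-1ℤ ^_) (λ j N → D (double (suc j)) (double N))) ⟨
    ℤ.+ 2 * ρ Y
      ≡⟨ cong (ℤ.+ 2 *_) (ρ-head Y) ⟩
    ℤ.+ 2 * (Y 0 + ∑[ N < m ] (-1ℤ ^ suc N * Y (double (suc N))))
      ≡⟨ ℤ.*-distribˡ-+ (ℤ.+ 2) (Y 0) _ ⟩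
    ℤ.+ 2 * Y 0 + ℤ.+ 2 * ∑[ N < m ] (-1ℤ ^ suc N * Y (double (suc N)))
      ≡⟨ cong (ℤ.+ 2 * Y 0 +_) (*-∑ m (ℤ.+ 2) (λ N → -1ℤ ^ suc N * Y (double (suc N)))) ⟩
    ℤ.+ 2 * Y 0 + ∑[ N < m ] (ℤ.+ 2 * (-1ℤ ^ suc N * Y (double (suc N))))
      ≈⟨ mod-+-cong (*-congˡ (ℤ.+ 2) Y-0) (∑-cong m λ N N<m → tail N N<m) ⟩
    0ℤ + ∑[ N < m ] (-1ℤ * (e Sign.- N * e Sign.+ N))
      ≡⟨ trans (ℤ.+-identityˡ _) (sym (*-∑ m -1ℤ (λ N → e Sign.- N * e Sign.+ N))) ⟩
    -1ℤ * τ
      ≡⟨ ℤ.-1*i≡-i τ ⟩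
    - τ ∎
    where
    h⁺ = h Sign.+
    a⁺ = a Sign.+ Sign.+
    W : ℕ → ℤ
    W j = ∑ (suc j) w
    lemma₁ : ∀ s x y → s * x * y ≡ y * x * (s * 1ℤ)
    lemma₁ = solve-∀
    lemma₂ : ∀ s i → s * - (i * i) ≡ -1ℤ * (s * i * i)
    lemma₂ = solve-∀
    lemma₃ : ∀ s x → ℤ.+ 2 * (s * x) ≡ s * (ℤ.+ 2 * x)
    lemma₃ = solve-∀
    lemma₄ : ∀ x y → x * y * 1ℤ ≡ y * x
    lemma₄ = solve-∀
    lemma₅ : ∀ s a → -1ℤ * (s + a + a - (a + a)) ≡ -1ℤ * s
    lemma₅ = solve-∀
    tail : ∀ N → N ℕ.< m → ℤ.+ 2 * (-1ℤ ^ suc N * Y (double (suc N))) ≃ -1ℤ * (e Sign.- N * e Sign.+ N)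
    tail N N<m = begin
      ℤ.+ 2 * (-1ℤ ^ suc N * Y (double (suc N)))
        ≡⟨ lemma₃ (-1ℤ ^ suc N) (Y (double (suc N))) ⟩
      -1ℤ ^ suc N * (ℤ.+ 2 * Y (double (suc N)))
        ≈⟨ *-congˡ (-1ℤ ^ suc N) (Y-suc _ (even<p N<m)) ⟩
      -1ℤ ^ suc N * - (ι (double (suc N)) * ι (double (suc N)))
        ≡⟨ lemma₂ (-1ℤ ^ suc N) (ι (double (suc N))) ⟩
      -1ℤ * (e Sign.- N * ι (double (suc N)))
        ≡⟨ cong (λ z → -1ℤ * (e Sign.- N * z)) (e⁺ N) ⟨
      -1ℤ * (e Sign.- N * e Sign.+ N) ∎
    Y-0 : Y 0 ≃ 0ℤ
    Y-0 = begin
      Y 0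
        ≡⟨ ∑-ext m (λ j _ → trans (cong (W j * ι (double (suc j)) *_) (D-0 (double (suc j))))
             (trans (lemma₄ (W j) (ι (double (suc j))))
               (cong₂ _*_ (sym (e⁺ j)) (∑-ext (suc j) λ i _ → sym (o⁺ i))))) ⟩
      ∑[ j < m ] (e Sign.+ j * ∑ (suc j) (o Sign.+))
        ≈⟨ △-eo Sign.+ Sign.+ ⟩
      κ Sign.+ * (h⁺ * h⁺ - b Sign.+ Sign.+)
        ≡⟨ cong₂ (λ x y → x * (y - b Sign.+ Sign.+)) κ⁺ (h*h Sign.+ Sign.+) ⟩
      -1ℤ * (∑[ j < m ] (e Sign.+ j * e Sign.+ j) + a⁺ + a⁺ - b Sign.+ Sign.+)
        ≈⟨ *-congˡ -1ℤ (+-congˡ (∑[ j < m ] (e Sign.+ j * e Sign.+ j) + a⁺ + a⁺) (mod-neg-cong (b-partialFractions Sign.+ Sign.+))) ⟩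
      -1ℤ * (∑[ j < m ] (e Sign.+ j * e Sign.+ j) + a⁺ + a⁺ - (a⁺ + a⁺))
        ≡⟨ lemma₅ (∑[ j < m ] (e Sign.+ j * e Sign.+ j)) a⁺ ⟩
      -1ℤ * ∑[ j < m ] (e Sign.+ j * e Sign.+ j)
        ≈⟨ *-congˡ -1ℤ (∑-e⁺² 3<p) ⟩
      0ℤ ∎

-- The Fermat quotient of 2

K-value : ∀ b x → ∑[ n < suc b ] (K 0 b n * x ^ n) ≡ (1ℤ + x) ^ b
K-value zero    x = refl
K-value (suc b) x = begin
  ∑[ n < suc (suc b) ] (K 0 (suc b) n * x ^ n)
    ≡⟨ ∑-head (suc b) (λ n → K 0 (suc b) n * x ^ n) ⟩
  K 0 b 0 * 1ℤ + ∑[ n < suc b ] ((K 0 b (suc n) + K 0 b n) * (x * x ^ n))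
    ≡⟨ cong (K 0 b 0 * 1ℤ +_) (trans
         (∑-ext (suc b) λ n _ → lemma₁ (K 0 b (suc n)) (K 0 b n) x (x ^ n))
         (∑-+ (suc b) (λ n → K 0 b (suc n) * (x * x ^ n)) (λ n → x * (K 0 b n * x ^ n)))) ⟩
  K 0 b 0 * 1ℤ + (∑[ n < suc b ] (K 0 b (suc n) * x ^ suc n) + ∑[ n < suc b ] (x * (K 0 b n * x ^ n)))
    ≡⟨ ℤ.+-assoc (K 0 b 0 * 1ℤ) _ _ ⟨
  K 0 b 0 * 1ℤ + ∑[ n < suc b ] (K 0 b (suc n) * x ^ suc n) + ∑[ n < suc b ] (x * (K 0 b n * x ^ n))
    ≡⟨ cong₂ _+_ (sym (∑-head (suc b) (λ n → K 0 b n * x ^ n))) (sym (*-∑ (suc b) x (λ n → K 0 b n * x ^ n))) ⟩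
  K 0 b (suc b) * x ^ suc b + S + x * S
    ≡⟨ cong (λ k → k * x ^ suc b + S + x * S) (K-degree 0 b (suc b) ℕ.≤-refl) ⟩
  0ℤ * x ^ suc b + S + x * S
    ≡⟨ lemma₂ (x ^ suc b) S x ⟩
  (1ℤ + x) * S
    ≡⟨ cong ((1ℤ + x) *_) (K-value b x) ⟩
  (1ℤ + x) * (1ℤ + x) ^ b ∎
  where
  open ≡-Reasoning
  S = ∑[ n < suc b ] (K 0 b n * x ^ n)
  lemma₁ : ∀ c d x y → (c + d) * (x * y) ≡ c * (x * y) + x * (d * y)
  lemma₁ = solve-∀
  lemma₂ : ∀ y s x → 0ℤ * y + s + x * s ≡ (1ℤ + x) * s
  lemma₂ = solve-∀

K-leading : ∀ b → K 0 b b ≡ 1ℤ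
K-leading zero    = refl
K-leading (suc b) = cong₂ _+_ (K-degree 0 b (suc b) ℕ.≤-refl) (K-leading b)

pos-^ : ∀ a n → ℤ.+ (a ℕ.^ n) ≡ (ℤ.+ a) ^ n
pos-^ a zero    = refl
pos-^ a (suc n) = trans (ℤ.pos-* a (a ℕ.^ n)) (cong (ℤ.+ a *_) (pos-^ a n))

[-1]^double : ∀ n → -1ℤ ^ double n ≡ 1ℤ
[-1]^double zero    = refl
[-1]^double (suc n) = cong (λ z → -1ℤ * (-1ℤ * z)) ([-1]^double n)

-- `q₂` is a quotient by p, so its residue modulo p is read off from congruences modulo p². This
-- lemma and the next pass between the two moduli.
mod²-*-cong : ∀ {p a b} → a ≡ b [mod p ] → ℤ.+ p * a ≡ ℤ.+ p * b [mod p ℕ.* p ]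
mod²-*-cong {p} {a} {b} (congruent (divides q eq)) = congruent (divides q (begin
  ℤ.+ p * a - ℤ.+ p * b    ≡⟨ lemma₁ (ℤ.+ p) a b ⟩
  ℤ.+ p * (a - b)          ≡⟨ cong (ℤ.+ p *_) eq ⟩
  ℤ.+ p * (q * ℤ.+ p)      ≡⟨ lemma₂ (ℤ.+ p) q ⟩
  q * (ℤ.+ p * ℤ.+ p)      ≡⟨ cong (q *_) (ℤ.pos-* p p) ⟨
  q * ℤ.+ (p ℕ.* p)        ∎))
  where
  open ≡-Reasoning
  lemma₁ : ∀ p a b → p * a - p * b ≡ p * (a - b)
  lemma₁ = solve-∀
  lemma₂ : ∀ p q → p * (q * p) ≡ q * (p * p)
  lemma₂ = solve-∀

mod²-*-cancel : ∀ {p a b} .{{_ : ℕ.NonZero p}} → ℤ.+ p * a ≡ ℤ.+ p * b [mod p ℕ.* p ] → a ≡ b [mod p ]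
mod²-*-cancel {p@(suc _)} {a} {b} (congruent (divides q eq)) = congruent (divides q (ℤ.*-cancelˡ-≡ (ℤ.+ p) (a - b) (q * ℤ.+ p) (begin
  ℤ.+ p * (a - b)          ≡⟨ lemma₁ (ℤ.+ p) a b ⟨
  ℤ.+ p * a - ℤ.+ p * b    ≡⟨ eq ⟩
  q * ℤ.+ (p ℕ.* p)        ≡⟨ cong (q *_) (ℤ.pos-* p p) ⟩
  q * (ℤ.+ p * ℤ.+ p)      ≡⟨ lemma₂ (ℤ.+ p) q ⟨
  ℤ.+ p * (q * ℤ.+ p)      ∎)))
  where
  open ≡-Reasoning
  lemma₁ : ∀ p a b → p * a - p * b ≡ p * (a - b)
  lemma₁ = solve-∀
  lemma₂ : ∀ p q → p * (q * p) ≡ q * (p * p)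
  lemma₂ = solve-∀

module FermatQuotient (m : ℕ) (p-prime : Prime (suc (double m))) where
  open Modulo m p-prime
  open DoubleSums m p-prime
  open Identities m p-prime

  ∑-binomials : ∀ x → (1ℤ + x) ^ p ≡ x ^ p + (1ℤ + ∑[ n < double m ] (K 0 p (suc n) * x ^ suc n))
  ∑-binomials x = trans (sym (K-value p x)) (cong₂ _+_
    (trans (cong (_* x ^ p) (K-leading p)) (ℤ.*-identityˡ _))
    (trans (∑-head (double m) (λ n → K 0 p n * x ^ n))
      (cong (λ z → z * 1ℤ + ∑[ n < double m ] (K 0 p (suc n) * x ^ suc n)) (K-0 0 p))))

  frobenius : ∀ x → (1ℤ + x) ^ p ≃ x ^ p + 1ℤ
  frobenius x = begin
    (1ℤ + x) ^ p
      ≡⟨ ∑-binomials x ⟩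
    x ^ p + (1ℤ + ∑[ n < double m ] (K 0 p (suc n) * x ^ suc n))
      ≈⟨ +-congˡ (x ^ p) (+-congˡ 1ℤ (∑-cong (double m) λ n n<p → *-congʳ (x ^ suc n) (K-0p n (s≤s n<p)))) ⟩
    x ^ p + (1ℤ + ∑[ n < double m ] 0ℤ)
      ≡⟨ cong (λ z → x ^ p + (1ℤ + z)) (∑-zero (double m)) ⟩
    x ^ p + 1ℤ ∎

  fermat : ∀ k → (ℤ.+ k) ^ p ≃ ℤ.+ k
  fermat zero    = ≡⇒mod (ℤ.*-zeroˡ (0ℤ ^ double m))
  fermat (suc k) = begin
    (1ℤ + ℤ.+ k) ^ p    ≈⟨ frobenius (ℤ.+ k) ⟩
    (ℤ.+ k) ^ p + 1ℤ    ≈⟨ +-congʳ 1ℤ (fermat k) ⟩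
    ℤ.+ k + 1ℤ          ≡⟨ ℤ.+-comm (ℤ.+ k) 1ℤ ⟩
    ℤ.+ suc k           ∎

  fermat′ : ∀ {k} → 0 ℕ.< k → k ℕ.< p → (ℤ.+ k) ^ double m ≃ 1ℤ
  fermat′ {k} 0<k k<p = cancelˡ k 0<k k<p (mod-trans (fermat k) (≡⇒mod (sym (ℤ.*-identityʳ (ℤ.+ k)))))

  q : ℤ
  q = q₂ P

  -- Fermat's little theorem makes the truncating division in `q₂` exact.
  p*q : ℤ.+ p * q ≡ (ℤ.+ 2) ^ double m - 1ℤ
  p*q = begin-≡
    where
    instance _ = prime⇒nonZero p-prime
    M = 2 ℕ.^ double m
    M∸1 : ℤ.+ (M ∸ 1) ≡ (ℤ.+ 2) ^ double m - 1ℤ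
    M∸1 = trans (lemma M (ℕ.m^n>0 2 (double m))) (cong (_- 1ℤ) (pos-^ 2 (double m)))
      where
      lemma : ∀ n → 0 ℕ.< n → ℤ.+ (n ∸ 1) ≡ ℤ.+ n - 1ℤ
      lemma (suc n) _ = refl
    p∣M∸1 : p ℕ.∣ M ∸ 1
    p∣M∸1 = ∣⇒∣ᵤ (subst (ℤ.+ p ∣_) (sym M∸1)
      (_≡_[mod_].difference (fermat′ (s≤s z≤n) 2<p)))
    begin-≡ : ℤ.+ p * ℤ.+ ((M ∸ 1) / p) ≡ (ℤ.+ 2) ^ double m - 1ℤ
    begin-≡ = trans (sym (ℤ.pos-* p ((M ∸ 1) / p)))
      (trans (cong ℤ.+_ (trans (ℕ.*-comm p ((M ∸ 1) / p)) (m/n*n≡m p∣M∸1))) M∸1)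

  -- By Pascal's rule neighbouring coefficients add up to a coefficient of (1 + y)ᵖ, so they
  -- alternate in sign.
  K-0[p-1] : ∀ n → n ℕ.< p → K 0 (double m) n ≃ -1ℤ ^ n
  K-0[p-1] zero    _   = ≡⇒mod (K-0 0 (double m))
  K-0[p-1] (suc n) n<p = begin
    K 0 (double m) (suc n)                      ≡⟨ lemma (K 0 (double m) (suc n)) (K 0 (double m) n) ⟩
    K 0 p (suc n) - K 0 (double m) n            ≈⟨ mod-+-cong (K-0p n n<p) (mod-neg-cong (K-0[p-1] n (ℕ.<-trans ℕ.≤-refl n<p))) ⟩
    0ℤ - -1ℤ ^ n                                ≡⟨ lemma′ (-1ℤ ^ n) ⟩
    -1ℤ ^ suc n                                 ∎
    where
    lemma : ∀ x y → x ≡ x + y - y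
    lemma = solve-∀
    lemma′ : ∀ x → 0ℤ - x ≡ -1ℤ * x
    lemma′ = solve-∀

  -- The derivative gives the exact equality (n + 1) `c` = (p - 1 choose n) for the integer quotient
  -- `c` by p, and this needs to be known only modulo p.
  K-0p-mod² : ∀ n → suc n ℕ.< p → K 0 p (suc n) ≡ ℤ.+ p * (-1ℤ ^ n * ι (suc n)) [mod p ℕ.* p ]
  K-0p-mod² n n<p = mod-trans (≡⇒mod K≡pc) (mod²-*-cong c≃)
    where
    N = ℤ.+ suc n
    p∣K = _≡_[mod_].difference (K-0p n n<p)
    c = _∣_.quotient p∣K
    lemma₁ : ∀ x → x ≡ x - 0ℤ
    lemma₁ = solve-∀
    lemma₂ : ∀ p n c → p * (n * c) ≡ n * (p * c)
    lemma₂ = solve-∀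
    lemma₃ : ∀ s n i → s * (n * i) ≡ n * (s * i)
    lemma₃ = solve-∀
    K≡pc : K 0 p (suc n) ≡ ℤ.+ p * c
    K≡pc = trans (lemma₁ (K 0 p (suc n))) (trans (_∣_.equality p∣K) (ℤ.*-comm c (ℤ.+ p)))
    Nc : N * c ≡ K 0 (double m) n
    Nc = ℤ.*-cancelˡ-≡ (ℤ.+ p) (N * c) (K 0 (double m) n) (trans (lemma₂ (ℤ.+ p) N c)
      (trans (cong (N *_) (sym K≡pc)) (trans (K-derivative 0 p n) (ℤ.+-identityʳ _))))
    c≃ : c ≃ -1ℤ ^ n * ι (suc n)
    c≃ = cancelˡ (suc n) (s≤s z≤n) n<p (begin
      N * c                           ≡⟨ Nc ⟩
      K 0 (double m) n                ≈⟨ K-0[p-1] n (ℕ.<-trans ℕ.≤-refl n<p) ⟩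
      -1ℤ ^ n                         ≡⟨ ℤ.*-identityʳ (-1ℤ ^ n) ⟨
      -1ℤ ^ n * 1ℤ                    ≈⟨ *-congˡ (-1ℤ ^ n) (ι-inverse (s≤s z≤n) n<p) ⟨
      -1ℤ ^ n * (N * ι (suc n))       ≡⟨ lemma₃ (-1ℤ ^ n) N (ι (suc n)) ⟩
      N * (-1ℤ ^ n * ι (suc n))       ∎)

  -- (2ᵖ - 2) / p is the sum of the binomial coefficients (p choose n) / p ≡ (-1)ⁿ⁻¹ / n with 0 < n < p.
  h⁺≃-q : h Sign.+ ≃ - q
  h⁺≃-q = cancelˡ 2 (s≤s z≤n) 2<p (begin
    ℤ.+ 2 * h⁺               ≡⟨ lemma₁ h⁺ ⟩
    - (-1ℤ * h⁺ + -1ℤ * h⁺)  ≈⟨ mod-neg-cong parity ⟨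
    - S                      ≈⟨ mod-neg-cong 2q≃S ⟨
    - (ℤ.+ 2 * q)            ≡⟨ lemma₂ q ⟩
    ℤ.+ 2 * - q              ∎)
    where
    h⁺ = h Sign.+
    f : ℕ → ℤ
    f n = -1ℤ ^ n * ι (suc n)
    S = ∑ (double m) f
    lemma₁ : ∀ x → ℤ.+ 2 * x ≡ - (-1ℤ * x + -1ℤ * x)
    lemma₁ = solve-∀
    lemma₂ : ∀ x → - (ℤ.+ 2 * x) ≡ ℤ.+ 2 * - x
    lemma₂ = solve-∀
    lemma₃ : ∀ p q → p * (ℤ.+ 2 * q) ≡ ℤ.+ 2 * (p * q)
    lemma₃ = solve-∀
    lemma₄ : ∀ x → ℤ.+ 2 * (x - 1ℤ) ≡ ℤ.+ 2 * x - ℤ.+ 2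
    lemma₄ = solve-∀
    lemma₅ : ∀ x → 1ℤ + (1ℤ + x) - ℤ.+ 2 ≡ x
    lemma₅ = solve-∀
    2q≃S : ℤ.+ 2 * q ≃ S
    2q≃S = mod²-*-cancel (mod-trans (≡⇒mod (trans (lemma₃ (ℤ.+ p) q)
      (trans (cong (ℤ.+ 2 *_) p*q) (trans (lemma₄ ((ℤ.+ 2) ^ double m))
        (trans (cong (_- ℤ.+ 2) (trans (∑-binomials 1ℤ)
            (cong₂ (λ x y → x + (1ℤ + y)) (ℤ.^-zeroˡ p)
              (∑-ext (double m) λ n _ → trans (cong (K 0 p (suc n) *_) (ℤ.^-zeroˡ (suc n))) (ℤ.*-identityʳ _)))))
          (lemma₅ (∑[ n < double m ] K 0 p (suc n))))))))
      (mod-trans (∑-cong (double m) λ n n<p → K-0p-mod² n (s≤s n<p))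
        (≡⇒mod (sym (*-∑ (double m) (ℤ.+ p) f)))))
    -- Odd and even denominators contribute equally, the odd ones by reflection.
    parity : S ≃ -1ℤ * h⁺ + -1ℤ * h⁺
    parity = begin
      S
        ≡⟨ ∑-parity m f ⟩
      ∑ m (f ∘ double) + ∑ m (f ∘ suc ∘ double)
        ≡⟨ cong₂ _+_
             (∑-ext m λ j _ → trans (cong (_* ι (suc (double j))) ([-1]^double j)) (trans (ℤ.*-identityˡ _) (sym (o⁺ j))))
             (trans (∑-ext m λ j _ → cong₂ (λ x y → -1ℤ * x * y) ([-1]^double j) (sym (e⁺ j)))
                    (sym (*-∑ m -1ℤ (e Sign.+)))) ⟩
      ∑ m (o Sign.+) + -1ℤ * h⁺
        ≈⟨ +-congʳ (-1ℤ * h⁺) (mod-trans (∑-o Sign.+) (≡⇒mod (cong (_* h⁺) κ⁺))) ⟩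
      -1ℤ * h⁺ + -1ℤ * h⁺ ∎

-- Residues of the mixed values

module Residues (P : ℙ) where

  private
    p = proj₁ P
    p-prime = proj₂ P

  -- Integrality travels with the residue because `+-mod` and `*-mod` also ask that p not divide the
  -- denominator of the result.
  record IsResidue (r : ℚ) (a : ℤ) : Set where
    constructor isResidue
    field
      integral : ¬ p ℕ.∣ ↧ₙ r
      residue  : r mod P ≡ a [mod p ]

  open IsResidue public

  ∤-* : ∀ {m n} → ¬ p ℕ.∣ m → ¬ p ℕ.∣ n → ¬ p ℕ.∣ m ℕ.* n
  ∤-* {m} {n} p∤m p∤n p∣mn = [ p∤m , p∤n ]′ (euclidsLemma m n p-prime p∣mn)

  ∤1 : ¬ p ℕ.∣ 1
  ∤1 p∣1 = ¬prime[1] (subst Prime (ℕ.∣1⇒≡1 p∣1) p-prime)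

  -- If p divided the reduced denominator, cross-multiplication would make it divide the numerator
  -- too, against coprimality.
  integral-≃ : ∀ r u → toℚᵘ r ℚᵘ.≃ u → ¬ p ℕ.∣ ℚᵘ.↧ₙ u → ¬ p ℕ.∣ ↧ₙ r
  integral-≃ (ℚ.mkℚ n d coprime) u (ℚᵘ.*≡* eq) p∤u p∣d =
    [ p∤n , p∤u ]′ (euclidsLemma ℤ.∣ n ∣ (ℚᵘ.↧ₙ u) p-prime (subst (p ℕ.∣_) ∣eq∣ (ℕ.∣n⇒∣m*n ℤ.∣ ℚᵘ.↥ u ∣ p∣d)))
    where
    ∣eq∣ : ℤ.∣ ℚᵘ.↥ u ∣ ℕ.* suc d ≡ ℤ.∣ n ∣ ℕ.* ℚᵘ.↧ₙ u
    ∣eq∣ = trans (sym (ℤ.abs-* (ℚᵘ.↥ u) (ℤ.+ suc d))) (trans (cong ℤ.∣_∣ (sym eq)) (ℤ.abs-* n (ℚᵘ.↧ u)))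
    p∤n : ¬ p ℕ.∣ ℤ.∣ n ∣
    p∤n p∣n = ∤1 (subst (p ℕ.∣_) (Coprimality.recompute coprime (p∣n , p∣d)) ℕ.∣-refl)

  integral-+ : ∀ r s → ¬ p ℕ.∣ ↧ₙ r → ¬ p ℕ.∣ ↧ₙ s → ¬ p ℕ.∣ ↧ₙ (r ℚ.+ s)
  integral-+ r@record{} s@record{} p∤r p∤s = integral-≃ (r ℚ.+ s) (toℚᵘ r ℚᵘ.+ toℚᵘ s) (ℚ.toℚᵘ-homo-+ r s) (∤-* p∤r p∤s)

  integral-* : ∀ r s → ¬ p ℕ.∣ ↧ₙ r → ¬ p ℕ.∣ ↧ₙ s → ¬ p ℕ.∣ ↧ₙ (r ℚ.* s)
  integral-* r@record{} s@record{} p∤r p∤s = integral-≃ (r ℚ.* s) (toℚᵘ r ℚᵘ.* toℚᵘ s) (ℚ.toℚᵘ-homo-* r s) (∤-* p∤r p∤s)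

  residue-≡ : ∀ {r a b} → IsResidue r a → a ≡ b [mod p ] → IsResidue r b
  residue-≡ (isResidue i h) a≡b = isResidue i (mod-trans h a≡b)

  residue-+ : ∀ {r s a b} → IsResidue r a → IsResidue s b → IsResidue (r ℚ.+ s) (a + b)
  residue-+ {r} {s} (isResidue i h) (isResidue j k) = isResidue (integral-+ r s i j)
    (mod-trans (+-mod P r s i j (integral-+ r s i j)) (mod-+-cong h k))

  residue-* : ∀ {r s a b} → IsResidue r a → IsResidue s b → IsResidue (r ℚ.* s) (a * b)
  residue-* {r} {s} (isResidue i h) (isResidue j k) = isResidue (integral-* r s i j)
    (mod-trans (*-mod P r s i j (integral-* r s i j)) (mod-*-cong h k))

  residue-/ : ∀ n d .{{_ : ℕ.NonZero d}} {a} → ¬ p ℕ.∣ d → ℤ.+ d * a ≡ n [mod p ] → IsResidue (n ℚ./ d) a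
  residue-/ n d {a} p∤d da≡n = isResidue p∤↧ (mod-unique P r p∤↧ (mod-cancelˡ P d p∤d
    (mod-trans (≡⇒mod (lemma (ℤ.+ d) (↧ r) a))
      (mod-trans (mod-*-cong (≡⇒mod {a = ↧ r} refl) da≡n)
        (≡⇒mod (trans (ℤ.*-comm (↧ r) n) (trans (sym ratio) (ℤ.*-comm (↥ r) (ℤ.+ d)))))))))
    where
    r = n ℚ./ d
    g = gcd n (ℤ.+ d)
    lemma : ∀ d e a → d * (e * a) ≡ e * (d * a)
    lemma = solve-∀
    lemma′ : ∀ x y g → x * (y * g) ≡ x * g * y
    lemma′ = solve-∀
    ratio : ↥ r * ℤ.+ d ≡ n * ↧ r
    ratio = trans (cong (↥ r *_) (sym (ℚ.↧-/ n d)))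
      (trans (lemma′ (↥ r) (↧ r) g) (cong (_* ↧ r) (ℚ.↥-/ n d)))
    p∤↧ : ¬ p ℕ.∣ ↧ₙ r
    p∤↧ p∣↧ = p∤d (ℕ.∣-trans p∣↧ (subst (↧ₙ r ℕ.∣_)
      (trans (sym (ℤ.abs-* (↧ r) g)) (cong ℤ.∣_∣ (ℚ.↧-/ n d)))
      (ℕ.∣m⇒∣m*n ℤ.∣ g ∣ ℕ.∣-refl)))

  residue-0 : IsResidue 0ℚ 0ℤ
  residue-0 = isResidue ∤1 (≡⇒mod refl)

  residue-∑ : ∀ n {f g} → (∀ i → i ℕ.< n → IsResidue (f i) (g i)) →
              IsResidue (sumℚ (applyDownFrom f n)) (∑ n g)
  residue-∑ zero    h = residue-0
  residue-∑ (suc n) h = residue-+ (h n ℕ.≤-refl) (residue-∑ n λ i i<n → h i (ℕ.m≤n⇒m≤1+n i<n))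

double≡*2 : ∀ n → double n ≡ n ℕ.* 2
double≡*2 zero    = refl
double≡*2 (suc n) = cong (suc ∘ suc) (double≡*2 n)

2∣double : ∀ n → 2 ℕ.∣ double n
2∣double n = ℕ.divides n (double≡*2 n)

2∤1+double : ∀ n → ¬ 2 ℕ.∣ suc (double n)
2∤1+double zero    2∣1 = contradiction (ℕ.∣1⇒≡1 2∣1) λ ()
2∤1+double (suc n) h   = 2∤1+double n (ℕ.∣m+n∣m⇒∣n h (ℕ.∣-refl {2}))

double/2 : ∀ n → double n / 2 ≡ n
double/2 n = trans (cong (_/ 2) (double≡*2 n)) (m*n/n≡m n 2)

-- index ε j = k - 1 for the j-th number k ≥ 1 of parity ε, counting from j = 0.
index : Sign → ℕ → ℕ
index Sign.+ j = suc (double j)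
index Sign.- j = double j

-- The number of i with index ε′ i < index ε j.
count : Sign → Sign → ℕ → ℕ
count Sign.+ Sign.- j = suc j
count _      _      j = j

parity-downFrom : ∀ ε n →
  filter (λ j → hasParity? ε (suc j)) (downFrom (double n)) ≡ applyDownFrom (index ε) n
parity-downFrom ε      zero    = refl
parity-downFrom Sign.+ (suc n) = trans
  (filter-accept (λ j → hasParity? Sign.+ (suc j)) (2∣double (suc n)))
  (cong (suc (double n) ∷_) (trans
    (filter-reject (λ j → hasParity? Sign.+ (suc j)) (2∤1+double n))
    (parity-downFrom Sign.+ n)))
parity-downFrom Sign.- (suc n) = trans
  (filter-reject (λ j → hasParity? Sign.- (suc j)) (λ h → h (2∣double (suc n))))
  (trans
    (filter-accept (λ j → hasParity? Sign.- (suc j)) (2∤1+double n))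
    (cong (double n ∷_) (parity-downFrom Sign.- n)))

-- `mixedSum (suc j)` runs over `downFrom j`, so this list is the inner range below the outer
-- summation index.
parity-downFrom-index : ∀ ε ε′ n →
  filter (λ j → hasParity? ε′ (suc j)) (downFrom (index ε n)) ≡ applyDownFrom (index ε′) (count ε ε′ n)
parity-downFrom-index Sign.+ Sign.+ n = trans
  (filter-reject (λ j → hasParity? Sign.+ (suc j)) (2∤1+double n)) (parity-downFrom Sign.+ n)
parity-downFrom-index Sign.+ Sign.- n = trans
  (filter-accept (λ j → hasParity? Sign.- (suc j)) (2∤1+double n)) (cong (double n ∷_) (parity-downFrom Sign.- n))
parity-downFrom-index Sign.- Sign.+ n = parity-downFrom Sign.+ n
parity-downFrom-index Sign.- Sign.- n = parity-downFrom Sign.- n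

exponent-index : ∀ ε j → exponent ε (suc (index ε j)) ≡ suc j
exponent-index Sign.+ j = double/2 (suc j)
exponent-index Sign.- j = double/2 (suc j)

count-≤ : ∀ ε ε′ {j m} → j ℕ.< m → count ε ε′ j ℕ.≤ m
count-≤ Sign.+ Sign.+ j<m = ℕ.<⇒≤ j<m
count-≤ Sign.+ Sign.- j<m = j<m
count-≤ Sign.- Sign.+ j<m = ℕ.<⇒≤ j<m
count-≤ Sign.- Sign.- j<m = ℕ.<⇒≤ j<m

module MixedSums (m : ℕ) (p-prime : Prime (suc (double m))) where
  open Modulo m p-prime
  open Residues P

  t : Sign → Sign → ℕ → ℤ
  t Sign.+ = e
  t Sign.- = o

  t-≡ : ∀ ε σ j → t ε σ j ≡ sgn σ ^ suc j * ι (suc (index ε j))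
  t-≡ Sign.+ σ j = refl
  t-≡ Sign.- σ j = refl

  index<p : ∀ ε {j} → j ℕ.< m → suc (index ε j) ℕ.< p
  index<p Sign.+ = even<p
  index<p Sign.- = odd<p

  residue-term : ∀ s ε σ j {a} → j ℕ.< m → ℤ.+ (suc (index ε j) ℕ.^ s) * a ≃ 1ℤ →
                 IsResidue (term s ε σ (suc (index ε j))) (sgn σ ^ suc j * a)
  residue-term s ε σ j {a} j<m h = residue-/ _ (k ℕ.^ s) {{ℕ.m^n≢0 k s}} (∤-^ s) (mod-trans
      (≡⇒mod (lemma (ℤ.+ (k ℕ.^ s)) (sgn σ ^ suc j) a))
      (mod-trans (*-congˡ (sgn σ ^ suc j) h)
        (≡⇒mod (trans (ℤ.*-identityʳ _) (cong (sgn σ ^_) (sym (exponent-index ε j)))))))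
    where
    k = suc (index ε j)
    ∤-^ : ∀ s → ¬ p ℕ.∣ k ℕ.^ s
    ∤-^ zero    = ∤1
    ∤-^ (suc s) = ∤-* (∤-small (s≤s z≤n) (index<p ε j<m)) (∤-^ s)
    lemma : ∀ d x a → d * (x * a) ≡ x * (d * a)
    lemma = solve-∀

  residue-term₁ : ∀ ε σ j → j ℕ.< m → IsResidue (term 1 ε σ (suc (index ε j))) (t ε σ j)
  residue-term₁ ε σ j j<m = residue-≡ (residue-term 1 ε σ j j<m
      (subst (λ n → ℤ.+ n * ι k ≃ 1ℤ) (sym (ℕ.*-identityʳ k)) (ι-inverse (s≤s z≤n) (index<p ε j<m))))
    (≡⇒mod (sym (t-≡ ε σ j)))
    where k = suc (index ε j)

  residue-term₂ : ∀ ε σ j → j ℕ.< m →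
    IsResidue (term 2 ε σ (suc (index ε j))) (t ε σ j * ι (suc (index ε j)))
  residue-term₂ ε σ j j<m = residue-≡ (residue-term 2 ε σ j j<m (begin
      ℤ.+ (k ℕ.* (k ℕ.* 1)) * (ι k * ι k)      ≡⟨ cong (λ n → ℤ.+ (k ℕ.* n) * (ι k * ι k)) (ℕ.*-identityʳ k) ⟩
      ℤ.+ (k ℕ.* k) * (ι k * ι k)              ≡⟨ cong (_* (ι k * ι k)) (ℤ.pos-* k k) ⟩
      ℤ.+ k * ℤ.+ k * (ι k * ι k)              ≡⟨ lemma (ℤ.+ k) (ι k) ⟩
      ℤ.+ k * ι k * (ℤ.+ k * ι k)              ≈⟨ mod-*-cong kι kι ⟩
      1ℤ                                       ∎))
    (≡⇒mod (trans (sym (ℤ.*-assoc (sgn σ ^ suc j) (ι k) (ι k))) (cong (_* ι k) (sym (t-≡ ε σ j)))))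
    where
    k = suc (index ε j)
    kι = ι-inverse (s≤s z≤n) (index<p ε j<m)
    lemma : ∀ k x → k * k * (x * x) ≡ k * x * (k * x)
    lemma = solve-∀

  residue-parity : ∀ ε n xs {f g} → xs ≡ applyDownFrom (index ε) n →
    (∀ j → j ℕ.< n → IsResidue (f (index ε j)) (g j)) → IsResidue (sumℚ (map f xs)) (∑ n g)
  residue-parity ε n xs {f} {g} eq h = subst (λ ys → IsResidue (sumℚ ys) (∑ n g))
    (sym (trans (cong (map f) eq) (map-applyDownFrom (index ε) f n))) (residue-∑ n h)

  depth₁ : ∀ ε σ → IsResidue (mixedSum p (2 ∷ []) (ε ∷ []) (σ ∷ []))
                             (∑[ j < m ] (t ε σ j * ι (suc (index ε j))))
  depth₁ ε σ = residue-parity ε m _ (parity-downFrom ε m) λ j j<m →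
    subst (λ r → IsResidue r (t ε σ j * ι (suc (index ε j)))) (sym (ℚ.*-identityʳ _)) (residue-term₂ ε σ j j<m)

  depth₂ : ∀ ε ε′ σ σ′ → IsResidue (mixedSum p (1 ∷ 1 ∷ []) (ε ∷ ε′ ∷ []) (σ ∷ σ′ ∷ []))
                                   (∑[ j < m ] (t ε σ j * ∑ (count ε ε′ j) (t ε′ σ′)))
  depth₂ ε ε′ σ σ′ = residue-parity ε m _ (parity-downFrom ε m) λ j j<m →
    residue-* (residue-term₁ ε σ j j<m)
      (residue-parity ε′ (count ε ε′ j) _ (parity-downFrom-index ε ε′ j) λ i i<n →
        subst (λ r → IsResidue r (t ε′ σ′ i)) (sym (ℚ.*-identityʳ _))
          (residue-term₁ ε′ σ′ i (ℕ.<-≤-trans i<n (count-≤ ε ε′ j<m))))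

-- Euler numbers modulo p

infixl 7 _⊛_
_⊛_ : (ℕ → ℤ) → (ℕ → ℤ) → ℕ → ℤ
(f ⊛ g) n = ∑[ k < suc n ] (f k * g (n ∸ k))

module EulerNumbers (m : ℕ) (p-prime : Prime (suc (double m))) where
  open Modulo m p-prime
  open DoubleSums m p-prime
  open Identities m p-prime
  open FermatQuotient m p-prime
  open Residues P

  ^-cong : ∀ {x y} n → x ≃ y → x ^ n ≃ y ^ n
  ^-cong zero    h = ≡⇒mod refl
  ^-cong (suc n) h = mod-*-cong h (^-cong n h)

  φ : ℕ → ℤ
  φ n = ι (n !)

  ∤! : ∀ n → n ℕ.< p → ¬ p ℕ.∣ n !
  ∤! zero    _   = ∤1
  ∤! (suc n) n<p = ∤-* (∤-small (s≤s z≤n) n<p) (∤! n (ℕ.<-trans ℕ.≤-refl n<p))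

  !-φ : ∀ n → n ℕ.< p → ℤ.+ (n !) * φ n ≃ 1ℤ
  !-φ n n<p = inverse-correct (n !) P (∤! n n<p)

  φ-suc : ∀ n → suc n ℕ.< p → ℤ.+ suc n * φ (suc n) ≃ φ n
  φ-suc n n<p = mod-cancelˡ P (n !) (∤! n n′<p) (begin
    ℤ.+ (n !) * (ℤ.+ suc n * φ (suc n))      ≡⟨ lemma (ℤ.+ (n !)) (ℤ.+ suc n) (φ (suc n)) ⟩
    ℤ.+ suc n * ℤ.+ (n !) * φ (suc n)        ≡⟨ cong (_* φ (suc n)) (ℤ.pos-* (suc n) (n !)) ⟨
    ℤ.+ (suc n !) * φ (suc n)                ≈⟨ !-φ (suc n) n<p ⟩
    1ℤ                                       ≈⟨ !-φ n n′<p ⟨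
    ℤ.+ (n !) * φ n                          ∎)
    where
    n′<p = ℕ.<-trans ℕ.≤-refl n<p
    lemma : ∀ a b c → a * (b * c) ≡ b * a * c
    lemma = solve-∀

  -- The coefficients of e^{x t}
  ε : ℤ → ℕ → ℤ
  ε x n = x ^ n * φ n

  ε-suc : ∀ x n → suc n ℕ.< p → ℤ.+ suc n * ε x (suc n) ≃ x * ε x n
  ε-suc x n n<p = begin
    ℤ.+ suc n * (x * x ^ n * φ (suc n))      ≡⟨ lemma (ℤ.+ suc n) x (x ^ n) (φ (suc n)) ⟩
    x * (x ^ n * (ℤ.+ suc n * φ (suc n)))    ≈⟨ *-congˡ x (*-congˡ (x ^ n) (φ-suc n n<p)) ⟩
    x * ε x n                                ∎
    where
    lemma : ∀ n x y z → n * (x * y * z) ≡ x * (y * (n * z))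
    lemma = solve-∀

  -- Both sides satisfy the recurrence (n + 1) cₙ₊₁ = (x + y) cₙ.
  ε-+ : ∀ x y n → n ℕ.< p → (ε x ⊛ ε y) n ≃ ε (x + y) n
  ε-+ x y zero    _   = begin
    1ℤ * φ 0 * (1ℤ * φ 0) + 0ℤ    ≡⟨ lemma (φ 0) ⟩
    1ℤ * φ 0 * φ 0                ≈⟨ *-congʳ (φ 0) (!-φ 0 (s≤s z≤n)) ⟩
    1ℤ * φ 0                      ∎
    where
    lemma : ∀ a → 1ℤ * a * (1ℤ * a) + 0ℤ ≡ 1ℤ * a * a
    lemma = solve-∀
  ε-+ x y (suc n) n<p = cancelˡ (suc n) (s≤s z≤n) n<p (begin
    N * (ε x ⊛ ε y) (suc n)
      ≡⟨ *-∑ (suc (suc n)) N (λ k → ε x k * ε y (suc n ∸ k)) ⟩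
    ∑[ k < suc (suc n) ] (N * (ε x k * ε y (suc n ∸ k)))
      ≡⟨ ∑-ext (suc (suc n)) (λ k k≤n → trans
           (cong (_* (ε x k * ε y (suc n ∸ k))) (trans (cong ℤ.+_ (sym (ℕ.m+[n∸m]≡n (ℕ.≤-pred k≤n)))) (ℤ.pos-+ k (suc n ∸ k))))
           (lemma₁ (ℤ.+ k) (ℤ.+ (suc n ∸ k)) (ε x k) (ε y (suc n ∸ k)))) ⟩
    ∑[ k < suc (suc n) ] (ℤ.+ k * ε x k * ε y (suc n ∸ k) + ε x k * (ℤ.+ (suc n ∸ k) * ε y (suc n ∸ k)))
      ≡⟨ ∑-+ (suc (suc n)) (λ k → ℤ.+ k * ε x k * ε y (suc n ∸ k)) _ ⟩
    ∑[ k < suc (suc n) ] (ℤ.+ k * ε x k * ε y (suc n ∸ k)) + ∑[ k < suc (suc n) ] (ε x k * (ℤ.+ (suc n ∸ k) * ε y (suc n ∸ k)))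
      ≈⟨ mod-+-cong left right ⟩
    x * (ε x ⊛ ε y) n + y * (ε x ⊛ ε y) n
      ≡⟨ ℤ.*-distribʳ-+ ((ε x ⊛ ε y) n) x y ⟨
    (x + y) * (ε x ⊛ ε y) n
      ≈⟨ *-congˡ (x + y) (ε-+ x y n (ℕ.<-trans ℕ.≤-refl n<p)) ⟩
    (x + y) * ε (x + y) n
      ≈⟨ ε-suc (x + y) n n<p ⟨
    N * ε (x + y) (suc n) ∎)
    where
    N = ℤ.+ suc n
    lemma₁ : ∀ a b c d → (a + b) * (c * d) ≡ a * c * d + c * (b * d)
    lemma₁ = solve-∀
    lemma₂ : ∀ a b c → a * (b * c) ≡ b * (a * c)
    lemma₂ = solve-∀
    left : ∑[ k < suc (suc n) ] (ℤ.+ k * ε x k * ε y (suc n ∸ k)) ≃ x * (ε x ⊛ ε y) n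
    left = begin
      ∑[ k < suc (suc n) ] (ℤ.+ k * ε x k * ε y (suc n ∸ k))
        ≡⟨ ∑-head (suc n) (λ k → ℤ.+ k * ε x k * ε y (suc n ∸ k)) ⟩
      0ℤ * ε x 0 * ε y (suc n) + ∑[ k < suc n ] (ℤ.+ suc k * ε x (suc k) * ε y (n ∸ k))
        ≡⟨ ℤ.+-identityˡ _ ⟩
      ∑[ k < suc n ] (ℤ.+ suc k * ε x (suc k) * ε y (n ∸ k))
        ≈⟨ ∑-cong (suc n) (λ k k≤n → *-congʳ (ε y (n ∸ k)) (ε-suc x k (ℕ.≤-<-trans k≤n n<p))) ⟩
      ∑[ k < suc n ] (x * ε x k * ε y (n ∸ k))
        ≡⟨ ∑-ext (suc n) (λ k _ → ℤ.*-assoc x (ε x k) (ε y (n ∸ k))) ⟩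
      ∑[ k < suc n ] (x * (ε x k * ε y (n ∸ k)))
        ≡⟨ *-∑ (suc n) x (λ k → ε x k * ε y (n ∸ k)) ⟨
      x * (ε x ⊛ ε y) n ∎
    right : ∑[ k < suc (suc n) ] (ε x k * (ℤ.+ (suc n ∸ k) * ε y (suc n ∸ k))) ≃ y * (ε x ⊛ ε y) n
    right = begin
      ε x (suc n) * (ℤ.+ (n ∸ n) * ε y (n ∸ n)) + ∑[ k < suc n ] (ε x k * (ℤ.+ (suc n ∸ k) * ε y (suc n ∸ k)))
        ≡⟨ cong (λ d → ε x (suc n) * (ℤ.+ d * ε y d) + ∑[ k < suc n ] (ε x k * (ℤ.+ (suc n ∸ k) * ε y (suc n ∸ k)))) (ℕ.n∸n≡0 n) ⟩
      ε x (suc n) * 0ℤ + ∑[ k < suc n ] (ε x k * (ℤ.+ (suc n ∸ k) * ε y (suc n ∸ k)))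
        ≡⟨ cong (_+ ∑[ k < suc n ] (ε x k * (ℤ.+ (suc n ∸ k) * ε y (suc n ∸ k)))) (ℤ.*-zeroʳ (ε x (suc n))) ⟩
      0ℤ + ∑[ k < suc n ] (ε x k * (ℤ.+ (suc n ∸ k) * ε y (suc n ∸ k)))
        ≡⟨ ℤ.+-identityˡ _ ⟩
      ∑[ k < suc n ] (ε x k * (ℤ.+ (suc n ∸ k) * ε y (suc n ∸ k)))
        ≡⟨ ∑-ext (suc n) (λ k k≤n → cong (λ d → ε x k * (ℤ.+ d * ε y d)) (ℕ.+-∸-assoc 1 (ℕ.≤-pred k≤n))) ⟩
      ∑[ k < suc n ] (ε x k * (ℤ.+ suc (n ∸ k) * ε y (suc (n ∸ k))))
        ≈⟨ ∑-cong (suc n) (λ k _ → *-congˡ (ε x k) (ε-suc y (n ∸ k) (ℕ.≤-<-trans (s≤s (ℕ.m∸n≤m n k)) n<p))) ⟩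
      ∑[ k < suc n ] (ε x k * (y * ε y (n ∸ k)))
        ≡⟨ ∑-ext (suc n) (λ k _ → lemma₂ (ε x k) y (ε y (n ∸ k))) ⟩
      ∑[ k < suc n ] (y * (ε x k * ε y (n ∸ k)))
        ≡⟨ *-∑ (suc n) y (λ k → ε x k * ε y (n ∸ k)) ⟨
      y * (ε x ⊛ ε y) n ∎

  -- ∑ (-1)ʲ e^{(2j+1)t}, which is 2 / (e^t + e^{-t}) modulo p because
  -- (e^t + e^{-t}) ∑ (-1)ʲ e^{(2j+1)t} = 1 + e^{2pt} ≡ 2.
  β γ δ : ℕ → ℤ
  β n = ∑[ j < p ] (-1ℤ ^ j * ε (ℤ.+ suc (double j)) n)
  γ n = ε 1ℤ n + ε -1ℤ n
  δ zero    = ℤ.+ 2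
  δ (suc n) = 0ℤ

  β⊛γ : ∀ n → n ℕ.< p → (β ⊛ γ) n ≃ δ n
  β⊛γ n n<p = begin
    (β ⊛ γ) n
      ≡⟨ ∑-ext (suc n) (λ k _ → ℤ.*-comm (β k) (γ (n ∸ k))) ⟩
    ∑[ k < suc n ] (γ (n ∸ k) * β k)
      ≡⟨ ∑-linear (suc n) p (-1ℤ ^_) (λ k → γ (n ∸ k)) (λ j k → ε (l j) k) ⟩
    ∑[ j < p ] (-1ℤ ^ j * ∑[ k < suc n ] (γ (n ∸ k) * ε (l j) k))
      ≈⟨ ∑-cong p (λ j _ → *-congˡ (-1ℤ ^ j) (shifts j)) ⟩
    ∑[ j < p ] (-1ℤ ^ j * (ε (ℤ.+ double (suc j)) n + ε (ℤ.+ double j) n))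
      ≡⟨ ∑-ext p (λ j _ → lemma₁ (-1ℤ ^ j) (ε (ℤ.+ double (suc j)) n) (ε (ℤ.+ double j) n)) ⟩
    ∑[ j < p ] (v j - v (suc j))
      ≡⟨ ∑-telescope p v ⟩
    1ℤ * ε 0ℤ n - -1ℤ * -1ℤ ^ double m * ε (ℤ.+ double p) n
      ≡⟨ cong (λ z → 1ℤ * ε 0ℤ n - -1ℤ * z * ε (ℤ.+ double p) n) ([-1]^double m) ⟩
    1ℤ * ε 0ℤ n - -1ℤ * 1ℤ * ε (ℤ.+ double p) n
      ≡⟨ lemma₂ (0ℤ ^ n) ((ℤ.+ double p) ^ n) (φ n) ⟩
    (0ℤ ^ n + (ℤ.+ double p) ^ n) * φ n
      ≈⟨ *-congʳ (φ n) (+-congˡ (0ℤ ^ n) (^-cong n 2p≃0)) ⟩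
    (0ℤ ^ n + 0ℤ ^ n) * φ n
      ≈⟨ value n ⟩
    δ n ∎
    where
    l : ℕ → ℤ
    l j = ℤ.+ suc (double j)
    v : ℕ → ℤ
    v j = -1ℤ ^ j * ε (ℤ.+ double j) n
    lemma₁ : ∀ s x y → s * (x + y) ≡ s * y - -1ℤ * s * x
    lemma₁ = solve-∀
    lemma₂ : ∀ x y f → 1ℤ * (x * f) - -1ℤ * 1ℤ * (y * f) ≡ (x + y) * f
    lemma₂ = solve-∀
    lemma₃ : ∀ a b c → (a + b) * c ≡ c * a + c * b
    lemma₃ = solve-∀
    2p≃0 : ℤ.+ double p ≃ 0ℤ
    2p≃0 = mod-trans (≡⇒mod (pos-double p)) (*-congˡ (ℤ.+ 2) p≃0)
    value : ∀ n → (0ℤ ^ n + 0ℤ ^ n) * φ n ≃ δ n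
    value zero    = begin
      ℤ.+ 2 * φ 0               ≡⟨ cong (ℤ.+ 2 *_) (ℤ.*-identityˡ (φ 0)) ⟨
      ℤ.+ 2 * (1ℤ * φ 0)        ≈⟨ *-congˡ (ℤ.+ 2) (!-φ 0 (s≤s z≤n)) ⟩
      ℤ.+ 2                     ∎
    value (suc n) = ≡⇒mod refl
    shifts : ∀ j → ∑[ k < suc n ] (γ (n ∸ k) * ε (l j) k) ≃ ε (ℤ.+ double (suc j)) n + ε (ℤ.+ double j) n
    shifts j = begin
      ∑[ k < suc n ] (γ (n ∸ k) * ε (l j) k)
        ≡⟨ ∑-ext (suc n) (λ k _ → lemma₃ (ε 1ℤ (n ∸ k)) (ε -1ℤ (n ∸ k)) (ε (l j) k)) ⟩
      ∑[ k < suc n ] (ε (l j) k * ε 1ℤ (n ∸ k) + ε (l j) k * ε -1ℤ (n ∸ k))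
        ≡⟨ ∑-+ (suc n) (λ k → ε (l j) k * ε 1ℤ (n ∸ k)) (λ k → ε (l j) k * ε -1ℤ (n ∸ k)) ⟩
      (ε (l j) ⊛ ε 1ℤ) n + (ε (l j) ⊛ ε -1ℤ) n
        ≈⟨ mod-+-cong (ε-+ (l j) 1ℤ n n<p) (ε-+ (l j) -1ℤ n n<p) ⟩
      ε (l j + 1ℤ) n + ε (ℤ.+ double j) n
        ≡⟨ cong (λ x → ε x n + ε (ℤ.+ double j) n) (ℤ.+-comm (l j) 1ℤ) ⟩
      ε (ℤ.+ double (suc j)) n + ε (ℤ.+ double j) n ∎

  residue-½ : IsResidue ½ (ι 2)
  residue-½ = residue-/ 1ℤ 2 (∤-small (s≤s z≤n) 2<p) (ι-inverse (s≤s z≤n) 2<p)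

  residue-neg : ∀ {r x} → IsResidue r x → IsResidue (ℚ.- r) (-1ℤ * x)
  residue-neg {r} {x} h = subst (λ s → IsResidue s (-1ℤ * x))
    (trans (sym (ℚ.neg-distribˡ-* 1ℚ r)) (cong ℚ.-_ (ℚ.*-identityˡ r)))
    (residue-* (residue-/ -1ℤ 1 { -1ℤ } ∤1 (≡⇒mod refl)) h)

  residue-exp+exp⁻ : ∀ n → n ℕ.< p → IsResidue (exp+exp⁻ n) (γ n)
  residue-exp+exp⁻ n n<p = residue-+ (residue-exp 1ℤ) (residue-exp -1ℤ)
    where
    lemma : ∀ a b c → a * (b * c) ≡ b * (a * c)
    lemma = solve-∀
    residue-exp : ∀ x → IsResidue (exp x n) (ε x n)
    residue-exp x = residue-/ (x ^ n) (n !) {{n ℕ.!≢0}} (∤! n n<p) (begin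
      ℤ.+ (n !) * (x ^ n * φ n)      ≡⟨ lemma (ℤ.+ (n !)) (x ^ n) (φ n) ⟩
      x ^ n * (ℤ.+ (n !) * φ n)      ≈⟨ *-congˡ (x ^ n) (!-φ n n<p) ⟩
      x ^ n * 1ℤ                     ≡⟨ ℤ.*-identityʳ (x ^ n) ⟩
      x ^ n                          ∎)

  sech : PowerSeries
  sech = quotient (constant (ℤ.+ 2 ℚ./ 1)) exp+exp⁻

  -- Both sequences satisfy the same recurrence with the leading coefficient 2, which is invertible.
  -- Every earlier term enters it, so `below` carries a bound for strong induction.
  residue-sech : ∀ n → n ℕ.< p → IsResidue (sech n) (β n)
  residue-sech n n<p = below (suc n) n ℕ.≤-refl n<p
    where
    residue-constant : ∀ n → IsResidue (constant (ℤ.+ 2 ℚ./ 1) n) (δ n)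
    residue-constant zero    = residue-/ (ℤ.+ 2) 1 {ℤ.+ 2} ∤1 (≡⇒mod refl)
    residue-constant (suc n) = residue-0
    γ-0 : γ 0 ≃ ℤ.+ 2
    γ-0 = mod-+-cong (!-φ 0 (s≤s z≤n)) (!-φ 0 (s≤s z≤n))
    lemma₁ : ∀ x i → x * (i * ℤ.+ 2) ≡ x * (ℤ.+ 2 * i)
    lemma₁ = solve-∀
    lemma₂ : ∀ b g t i → (b * g + t + -1ℤ * t) * i ≡ b * g * i
    lemma₂ = solve-∀
    lemma₃ : ∀ b i → b * ℤ.+ 2 * i ≡ b * (ℤ.+ 2 * i)
    lemma₃ = solve-∀
    solve-for : ∀ {x t c} → x ℚ.* (ℤ.+ 2 ℚ./ 1) ℚ.+ t ≡ c → (c ℚ.+ ℚ.- t) ℚ.* ½ ≡ x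
    solve-for {x} {t} refl = trans
      (cong (ℚ._* ½) (trans (ℚ.+-assoc (x ℚ.* (ℤ.+ 2 ℚ./ 1)) t (ℚ.- t))
        (trans (cong (x ℚ.* (ℤ.+ 2 ℚ./ 1) ℚ.+_) (ℚ.+-inverseʳ t)) (ℚ.+-identityʳ (x ℚ.* (ℤ.+ 2 ℚ./ 1))))))
      (trans (ℚ.*-assoc x (ℤ.+ 2 ℚ./ 1) ½) (ℚ.*-identityʳ x))
    below : ∀ N n → n ℕ.< N → n ℕ.< p → IsResidue (sech n) (β n)
    below (suc N) n (s≤s n≤N) n<p = residue-≡
      (subst (λ r → IsResidue r ((δ n + -1ℤ * T′) * ι 2)) (solve-for recurrence)
        (residue-* (residue-+ (residue-constant n) (residue-neg residue-T)) residue-½))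
      (begin
        (δ n + -1ℤ * T′) * ι 2
          ≈⟨ *-congʳ (ι 2) (+-congʳ (-1ℤ * T′) (β⊛γ n n<p)) ⟨
        (β n * γ (n ∸ n) + T′ + -1ℤ * T′) * ι 2
          ≡⟨ lemma₂ (β n) (γ (n ∸ n)) T′ (ι 2) ⟩
        β n * γ (n ∸ n) * ι 2
          ≡⟨ cong (λ d → β n * γ d * ι 2) (ℕ.n∸n≡0 n) ⟩
        β n * γ 0 * ι 2
          ≈⟨ *-congʳ (ι 2) (*-congˡ (β n) γ-0) ⟩
        β n * ℤ.+ 2 * ι 2
          ≡⟨ lemma₃ (β n) (ι 2) ⟩
        β n * (ℤ.+ 2 * ι 2)
          ≈⟨ *-congˡ (β n) (ι-inverse (s≤s z≤n) 2<p) ⟩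
        β n * 1ℤ
          ≡⟨ ℤ.*-identityʳ (β n) ⟩
        β n ∎)
      where
      T = sumℚ (applyDownFrom (λ k → sech k ℚ.* exp+exp⁻ (n ∸ k)) n)
      T′ = ∑[ k < n ] (β k * γ (n ∸ k))
      residue-T : IsResidue T T′
      residue-T = residue-∑ n λ k k<n → residue-*
        (below N k (ℕ.<-≤-trans k<n n≤N) (ℕ.<-trans k<n n<p))
        (residue-exp+exp⁻ (n ∸ k) (ℕ.≤-<-trans (ℕ.m∸n≤m n k) n<p))
      -- `exp+exp⁻ 0` evaluates to 2, so the equation can be solved for `sech n` by multiplying with
      -- `½`.
      recurrence : sech n ℚ.* (ℤ.+ 2 ℚ./ 1) ℚ.+ T ≡ constant (ℤ.+ 2 ℚ./ 1) n
      recurrence = trans (cong (λ d → sech n ℚ.* exp+exp⁻ d ℚ.+ T) (sym (ℕ.n∸n≡0 n)))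
        (quotient-correct (constant (ℤ.+ 2 ℚ./ 1)) exp+exp⁻ n)

  eulerMoment : ℕ → ℤ
  eulerMoment n = ∑[ j < p ] (-1ℤ ^ j * (ℤ.+ suc (double j)) ^ n)

  residue-E : ∀ n → n ℕ.< p → IsResidue (E n) (eulerMoment n)
  residue-E n n<p = residue-≡
    (residue-* (residue-/ (ℤ.+ (n !)) 1 {ℤ.+ (n !)} ∤1 (≡⇒mod (ℤ.*-identityˡ (ℤ.+ (n !))))) (residue-sech n n<p))
    (begin
      ℤ.+ (n !) * β n
        ≡⟨ *-∑ p (ℤ.+ (n !)) (λ j → -1ℤ ^ j * ε (ℤ.+ suc (double j)) n) ⟩
      ∑[ j < p ] (ℤ.+ (n !) * (-1ℤ ^ j * ε (ℤ.+ suc (double j)) n))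
        ≡⟨ ∑-ext p (λ j _ → lemma (ℤ.+ (n !)) (-1ℤ ^ j) ((ℤ.+ suc (double j)) ^ n) (φ n)) ⟩
      ∑[ j < p ] (-1ℤ ^ j * (ℤ.+ suc (double j)) ^ n * (ℤ.+ (n !) * φ n))
        ≈⟨ ∑-cong p (λ j _ → *-congˡ (-1ℤ ^ j * (ℤ.+ suc (double j)) ^ n) (!-φ n n<p)) ⟩
      ∑[ j < p ] (-1ℤ ^ j * (ℤ.+ suc (double j)) ^ n * 1ℤ)
        ≡⟨ ∑-ext p (λ j _ → ℤ.*-identityʳ (-1ℤ ^ j * (ℤ.+ suc (double j)) ^ n)) ⟩
      eulerMoment n ∎)
    where
    lemma : ∀ a s x f → a * (s * (x * f)) ≡ s * x * (a * f)
    lemma = solve-∀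

  χ : ℤ
  χ = -1ℤ ^ m

  χ*χ : χ * χ ≡ 1ℤ
  χ*χ = sgn-^-square Sign.- m

  inverse-square : ∀ {n k} → suc (suc n) ≡ double m → 0 ℕ.< k → k ℕ.< p → (ℤ.+ k) ^ n ≃ ι k * ι k
  inverse-square {n} {k} n+2≡p-1 0<k k<p = cancelˡ k 0<k k<p (cancelˡ k 0<k k<p (begin
    (ℤ.+ k) ^ suc (suc n)                ≡⟨ cong ((ℤ.+ k) ^_) n+2≡p-1 ⟩
    (ℤ.+ k) ^ double m                   ≈⟨ fermat′ 0<k k<p ⟩
    1ℤ * 1ℤ                              ≈⟨ mod-*-cong (ι-inverse 0<k k<p) (ι-inverse 0<k k<p) ⟨
    ℤ.+ k * ι k * (ℤ.+ k * ι k)          ≡⟨ lemma (ℤ.+ k) (ι k) ⟩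
    ℤ.+ k * (ℤ.+ k * (ι k * ι k))        ∎))
    where
    lemma : ∀ k x → k * x * (k * x) ≡ k * (k * (x * x))
    lemma = solve-∀

  -- By Fermat the power p - 3 is an inverse square. The odd numbers up to 2p - 1 are cut at p:
  -- those below are odd denominators, those above reduce to even ones, and each half gives χτ. The
  -- term 2j + 1 = p vanishes because the exponent is positive.
  eulerMoment-[p-3] : ∀ n → suc (suc (suc n)) ≡ double m → eulerMoment (suc n) ≃ ℤ.+ 2 * (χ * τ)
  eulerMoment-[p-3] n′ n+2≡p-1 = begin
    ∑ (suc (double m)) f
      ≡⟨ cong (λ k → ∑ k f) (trans (cong suc (double≡+ m)) (sym (ℕ.+-suc m m))) ⟩
    ∑ (m ℕ.+ suc m) f
      ≡⟨ ∑-split m (suc m) f ⟩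
    ∑ m f + ∑[ i < suc m ] f (m ℕ.+ i)
      ≡⟨ cong (∑ m f +_) (∑-head m (λ i → f (m ℕ.+ i))) ⟩
    ∑ m f + (f (m ℕ.+ 0) + ∑[ i < m ] f (m ℕ.+ suc i))
      ≈⟨ mod-+-cong lower (mod-+-cong middle upper) ⟩
    χ * τ + (0ℤ + χ * τ)
      ≡⟨ lemma₁ (χ * τ) ⟩
    ℤ.+ 2 * (χ * τ) ∎
    where
    n = suc n′
    f : ℕ → ℤ
    f j = -1ℤ ^ j * (ℤ.+ suc (double j)) ^ n
    lemma₁ : ∀ x → x + (0ℤ + x) ≡ ℤ.+ 2 * x
    lemma₁ = solve-∀
    lemma₂ : ∀ s x → s * (x * x) ≡ -1ℤ * (-1ℤ * s * x * x)
    lemma₂ = solve-∀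
    lemma₃ : ∀ c t → -1ℤ * (c * -1ℤ * t) ≡ c * t
    lemma₃ = solve-∀
    lemma₄ : ∀ c s x → c * s * (x * x) ≡ c * (s * x * x)
    lemma₄ = solve-∀
    lower : ∑ m f ≃ χ * τ
    lower = begin
      ∑ m f
        ≈⟨ ∑-cong m (λ j j<m → *-congˡ (-1ℤ ^ j) (inverse-square n+2≡p-1 (s≤s z≤n) (odd<p j<m))) ⟩
      ∑[ j < m ] (-1ℤ ^ j * (ι (suc (double j)) * ι (suc (double j))))
        ≡⟨ ∑-ext m (λ j _ → trans (lemma₂ (-1ℤ ^ j) (ι (suc (double j)))) (cong (λ z → -1ℤ * (o Sign.- j * z)) (sym (o⁺ j)))) ⟩
      ∑[ j < m ] (-1ℤ * (o Sign.- j * o Sign.+ j))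
        ≡⟨ *-∑ m -1ℤ (λ j → o Sign.- j * o Sign.+ j) ⟨
      -1ℤ * ∑[ j < m ] (o Sign.- j * o Sign.+ j)
        ≈⟨ *-congˡ -1ℤ (∑-oo Sign.- Sign.+) ⟩
      -1ℤ * (κ Sign.- * κ Sign.+ * τ)
        ≡⟨ cong₂ (λ x y → -1ℤ * (x * y * τ)) κ⁻ κ⁺ ⟩
      -1ℤ * (χ * -1ℤ * τ)
        ≡⟨ lemma₃ χ τ ⟩
      χ * τ ∎
    middle : f (m ℕ.+ 0) ≃ 0ℤ
    middle = begin
      -1ℤ ^ (m ℕ.+ 0) * (ℤ.+ suc (double (m ℕ.+ 0))) ^ n    ≡⟨ cong f (ℕ.+-identityʳ m) ⟩
      χ * (ℤ.+ p) ^ n                                       ≈⟨ *-congˡ χ (^-cong n p≃0) ⟩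
      χ * 0ℤ ^ n                                            ≡⟨ ℤ.*-zeroʳ χ ⟩
      0ℤ                                                    ∎
    upper : ∑[ i < m ] f (m ℕ.+ suc i) ≃ χ * τ
    upper = begin
      ∑[ i < m ] f (m ℕ.+ suc i)
        ≈⟨ ∑-cong m (λ i i<m → mod-*-cong (≡⇒mod {a = -1ℤ ^ (m ℕ.+ suc i)} refl)
             (mod-trans (^-cong n (shift i)) (inverse-square n+2≡p-1 (s≤s z≤n) (even<p i<m)))) ⟩
      ∑[ i < m ] (-1ℤ ^ (m ℕ.+ suc i) * (ι (double (suc i)) * ι (double (suc i))))
        ≡⟨ ∑-ext m (λ i _ → trans
             (cong (_* (ι (double (suc i)) * ι (double (suc i)))) (ℤ.^-distribˡ-+-* -1ℤ m (suc i)))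
             (trans (lemma₄ χ (-1ℤ ^ suc i) (ι (double (suc i)))) (cong (λ z → χ * (e Sign.- i * z)) (sym (e⁺ i))))) ⟩
      ∑[ i < m ] (χ * (e Sign.- i * e Sign.+ i))
        ≡⟨ *-∑ m χ (λ i → e Sign.- i * e Sign.+ i) ⟨
      χ * τ ∎
      where
      shift : ∀ i → ℤ.+ suc (double (m ℕ.+ suc i)) ≃ ℤ.+ double (suc i)
      shift i = mod-trans
        (≡⇒mod (trans (cong (ℤ.+_ ∘ suc) (double-+ m (suc i))) (ℤ.pos-+ p (double (suc i)))))
        (mod-trans (+-congʳ (ℤ.+ double (suc i)) p≃0) (≡⇒mod (ℤ.+-identityˡ _)))

  G≃χτ : 3 ℕ.< p → G𝒜 P ≃ χ * τ
  G≃χτ 3<p = begin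
    G𝒜 P
      ≈⟨ residue (residue-* (residue-E (p ∸ 3) (s≤s (ℕ.m∸n≤m (double m) 2))) residue-½) ⟩
    eulerMoment (p ∸ 3) * ι 2
      ≡⟨ cong (λ k → eulerMoment k * ι 2) p-3≡1+n ⟩
    eulerMoment (suc n) * ι 2
      ≈⟨ *-congʳ (ι 2) (eulerMoment-[p-3] n 3+n≡p-1) ⟩
    ℤ.+ 2 * (χ * τ) * ι 2
      ≡⟨ lemma (χ * τ) (ι 2) ⟩
    χ * τ * (ℤ.+ 2 * ι 2)
      ≈⟨ *-congˡ (χ * τ) (ι-inverse (s≤s z≤n) 2<p) ⟩
    χ * τ * 1ℤ
      ≡⟨ ℤ.*-identityʳ (χ * τ) ⟩
    χ * τ ∎
    where
    n = double m ∸ 3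
    3+n≡p-1 : suc (suc (suc n)) ≡ double m
    3+n≡p-1 = ℕ.m+[n∸m]≡n (ℕ.≤-pred 3<p)
    p-3≡1+n : p ∸ 3 ≡ suc n
    p-3≡1+n = cong (_∸ 2) (sym 3+n≡p-1)
    lemma : ∀ x i → ℤ.+ 2 * x * i ≡ x * (ℤ.+ 2 * i)
    lemma = solve-∀

-- Linear combinations in 𝒜

module _ {r ℓr m ℓm} {R : Ring r ℓr} (M : LeftModule R m ℓm) where
  open LeftModule M
  private module R = Ring R

  linearCombination-++ : ∀ {i} {I : Set i} (v : I → Carrierᴹ) xs ys →
    linearCombination M v (xs ++ ys) ≈ᴹ linearCombination M v xs +ᴹ linearCombination M v ys
  linearCombination-++ v []             ys = ≈ᴹ-sym (+ᴹ-identityˡ _)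
  linearCombination-++ v ((c , i) ∷ xs) ys =
    ≈ᴹ-trans (+ᴹ-congˡ (linearCombination-++ v xs ys)) (≈ᴹ-sym (+ᴹ-assoc _ _ _))

  scale : ∀ {i} {I : Set i} → R.Carrier → List (R.Carrier × I) → List (R.Carrier × I)
  scale c []             = []
  scale c ((d , i) ∷ xs) = (c R.* d , i) ∷ scale c xs

  linearCombination-scale : ∀ {i} {I : Set i} (v : I → Carrierᴹ) c xs →
    linearCombination M v (scale c xs) ≈ᴹ c *ₗ linearCombination M v xs
  linearCombination-scale v c []             = ≈ᴹ-sym (*ₗ-zeroʳ c)
  linearCombination-scale v c ((d , i) ∷ xs) =
    ≈ᴹ-trans (+ᴹ-cong (*ₗ-assoc c d (v i)) (linearCombination-scale v c xs)) (≈ᴹ-sym (*ₗ-distribˡ c _ _))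

  Span-⊆ : ∀ {i j} {I : Set i} {J : Set j} {v : I → Carrierᴹ} {w : J → Carrierᴹ} →
           (∀ i → Span M w (v i)) → Span M v ⊆ Span M w
  Span-⊆ {v = v} {w} h (cs , x≈) =
    let (ds , eq) = substitute cs in ds , ≈ᴹ-trans x≈ eq
    where
    substitute : ∀ cs → ∃ λ ds → linearCombination M v cs ≈ᴹ linearCombination M w ds
    substitute []             = [] , ≈ᴹ-refl
    substitute ((c , i) ∷ cs) =
      let (ds , eq) = substitute cs
          (es , vi≈) = h i
      in scale c es ++ ds ,
         ≈ᴹ-trans (+ᴹ-cong (≈ᴹ-trans (*ₗ-congˡ vi≈) (≈ᴹ-sym (linearCombination-scale w c es))) eq)
                  (≈ᴹ-sym (linearCombination-++ w (scale c es) ds))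

integerCombination : {I : Set} → (I → 𝒜) → List (ℤ × I) → 𝒜
integerCombination v []             P = 0ℤ
integerCombination v ((c , i) ∷ cs) P = c * v i P + integerCombination v cs P

-- One common denominator d is cleared, so that only integer relations have to be verified prime by
-- prime. A prime above N + d satisfies the relation and does not divide d.
integerRelation⇒Span : {I : Set} (v : I → 𝒜) (x : 𝒜) (d : ℕ) .{{_ : ℕ.NonZero d}} (N : ℕ) (cs : List (ℤ × I)) →
  (∀ P → N ℕ.< proj₁ P → ℤ.+ d * x P ≡ integerCombination v cs P [mod proj₁ P ]) →
  Span 𝒜-vectorSpace v x
integerRelation⇒Span {I} v x d N cs h = fractions cs , N ℕ.+ d , λ P N+d<p →
  let p∤d : ¬ proj₁ P ℕ.∣ d
      p∤d p∣d = ℕ.<⇒≱ (ℕ.≤-<-trans (ℕ.m≤n+m d N) N+d<p) (ℕ.∣⇒≤ p∣d)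
  in mod-cancelˡ P d p∤d (mod-trans (h P (ℕ.≤-<-trans (ℕ.m≤m+n N d) N+d<p)) (mod-sym (cleared P p∤d cs)))
  where
  fractions : List (ℤ × I) → List (ℚ × I)
  fractions []             = []
  fractions ((c , i) ∷ cs) = (c ℚ./ d , i) ∷ fractions cs
  lemma : ∀ d r y z → d * (r * y + z) ≡ d * r * y + d * z
  lemma = solve-∀
  cleared : ∀ P → ¬ proj₁ P ℕ.∣ d → ∀ cs →
    ℤ.+ d * linearCombination 𝒜-vectorSpace v (fractions cs) P ≡ integerCombination v cs P [mod proj₁ P ]
  cleared P p∤d []             = ≡⇒mod (ℤ.*-zeroʳ (ℤ.+ d))
  cleared P@(p , _) p∤d ((c , i) ∷ cs) = mod-trans
    (≡⇒mod (lemma (ℤ.+ d) ((c ℚ./ d) mod P) (v i P) (linearCombination 𝒜-vectorSpace v (fractions cs) P)))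
    (mod-+-cong (mod-*-cong numerator (≡⇒mod {a = v i P} refl)) (cleared P p∤d cs))
    where
    open Residues P
    lemma′ : ∀ d c i → d * (c * i) ≡ c * (d * i)
    lemma′ = solve-∀
    c≡ : ℤ.+ d * (c * inverse d p) ≡ c [mod p ]
    c≡ = mod-trans (≡⇒mod (lemma′ (ℤ.+ d) c (inverse d p)))
      (mod-trans (mod-*-cong (≡⇒mod {a = c} refl) (inverse-correct d P p∤d)) (≡⇒mod (ℤ.*-identityʳ c)))
    numerator : ℤ.+ d * ((c ℚ./ d) mod P) ≡ c [mod p ]
    numerator = mod-trans (mod-*-cong (≡⇒mod {a = ℤ.+ d} refl) (residue (residue-/ c d p∤d c≡))) c≡

halve : ∀ n → ∃ λ m → n ≡ double m ⊎ n ≡ suc (double m)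
halve zero = 0 , inj₁ refl
halve (suc n) with halve n
... | m , inj₁ refl = m , inj₂ refl
... | m , inj₂ refl = suc m , inj₁ refl

-- Lets p be literally `suc (double m)` with m a variable, the form on which all the sums compute.
onOddPrimes : (A : ℙ → Set) → (∀ m p-prime → 3 ℕ.< suc (double m) → A (suc (double m) , p-prime)) →
              ∀ P → 3 ℕ.< proj₁ P → A P
onOddPrimes A h (p , p-prime) 3<p with halve p
... | m , inj₂ refl = h m p-prime 3<p
... | m , inj₁ refl with prime⇒irreducible p-prime (2∣double m)
...   | inj₂ 2≡p = contradiction (subst (3 ℕ.<_) (sym 2≡p) 3<p) λ { (s≤s (s≤s ())) }

-- Coordinates with respect to the four generators

basis : Fin 4 → 𝒜
basis = lookup ((q₂ ⊗ q₂) ∷ G𝒜 ∷ ([-1]^p′ ⊗ (q₂ ⊗ q₂)) ∷ ([-1]^p′ ⊗ G𝒜) ∷ [])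

Coordinates : Set
Coordinates = ℤ × ℤ × ℤ × ℤ

terms : Coordinates → List (ℤ × Fin 4)
terms (c₀ , c₁ , c₂ , c₃) = (c₀ , 0F) ∷ (c₁ , 1F) ∷ (c₂ , 2F) ∷ (c₃ , 3F) ∷ []

-- All values are tabulated with a factor 8; c stands for the sums over i + j ≥ m - 1.
a-coordinates b-coordinates c-coordinates : Sign → Sign → Coordinates
a-coordinates Sign.+ Sign.+ = ℤ.+ 4 , 0ℤ , 0ℤ , 0ℤ
a-coordinates Sign.+ Sign.- = ℤ.+ 3 , 0ℤ , 0ℤ , ℤ.- ℤ.+ 4
a-coordinates Sign.- Sign.+ = 1ℤ    , 0ℤ , 0ℤ , ℤ.- ℤ.+ 4
a-coordinates Sign.- Sign.- = 1ℤ    , 0ℤ , 0ℤ , 0ℤ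
b-coordinates Sign.+ Sign.+ = ℤ.+ 8 , 0ℤ , 0ℤ , 0ℤ
b-coordinates Sign.+ Sign.- = ℤ.+ 4 , 0ℤ , 0ℤ , ℤ.- ℤ.+ 4
b-coordinates Sign.- Sign.+ = ℤ.+ 4 , 0ℤ , 0ℤ , ℤ.- ℤ.+ 4
b-coordinates Sign.- Sign.- = ℤ.+ 2 , 0ℤ , 0ℤ , ℤ.- ℤ.+ 8
c-coordinates Sign.+ Sign.+ = 0ℤ    , 0ℤ , 0ℤ , 0ℤ
c-coordinates Sign.+ Sign.- = 0ℤ    , 0ℤ , 0ℤ , ℤ.+ 4
c-coordinates Sign.- Sign.+ = 0ℤ    , 0ℤ , 0ℤ , ℤ.+ 4
c-coordinates Sign.- Sign.- = 0ℤ    , 0ℤ , 0ℤ , ℤ.+ 8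

-- Multiplication by κ s; since κ Sign.- = χ and χ² = 1, the negative sign swaps coordinates.
infixr 8 _·κ_
_·κ_ : Sign → Coordinates → Coordinates
Sign.+ ·κ (c₀ , c₁ , c₂ , c₃) = - c₀ , - c₁ , - c₂ , - c₃
Sign.- ·κ (c₀ , c₁ , c₂ , c₃) = c₂ , c₃ , c₀ , c₁

coordinates₁ : Sign → Sign → Coordinates
coordinates₁ ε      Sign.+ = 0ℤ , 0ℤ , 0ℤ , 0ℤ
coordinates₁ Sign.+ Sign.- = 0ℤ , 0ℤ , 0ℤ , ℤ.+ 8
coordinates₁ Sign.- Sign.- = 0ℤ , ℤ.- ℤ.+ 8 , 0ℤ , 0ℤ

-- The clauses follow the definition of `a` and then `△-oo`, `△-eo` and `△-oe`.
coordinates₂ : Sign → Sign → Sign → Sign → Coordinates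
coordinates₂ Sign.+ Sign.+ σ σ′ = a-coordinates σ σ′
coordinates₂ Sign.- Sign.- σ σ′ = σ ·κ σ′ ·κ a-coordinates σ′ σ
coordinates₂ Sign.+ Sign.- σ σ′ = σ′ ·κ c-coordinates σ σ′
coordinates₂ Sign.- Sign.+ σ σ′ = σ ·κ b-coordinates σ σ′

-- Evaluation of the mixed values of weight 2

module Values (m : ℕ) (p-prime : Prime (suc (double m))) (3<p : 3 ℕ.< suc (double m)) where
  open Modulo m p-prime
  open DoubleSums m p-prime
  open Identities m p-prime
  open FermatQuotient m p-prime
  open Residues P
  open MixedSums m p-prime
  open EulerNumbers m p-prime

  Q g : ℤ
  Q = q * q
  g = G𝒜 P

  -- Nested like `integerCombination`, final `0ℤ` included, so that the two agree by computation
  -- once `(p ∸ 1) / 2` is replaced by m.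
  eval : Coordinates → ℤ
  eval (c₀ , c₁ , c₂ , c₃) = c₀ * Q + (c₁ * g + (c₂ * (χ * Q) + (c₃ * (χ * g) + 0ℤ)))

  eval-terms : ∀ c → eval c ≡ integerCombination basis (terms c) P
  eval-terms (c₀ , c₁ , c₂ , c₃) = cong (λ x → c₀ * Q + (c₁ * g + (c₂ * (x * Q) + (c₃ * (x * g) + 0ℤ))))
    (cong (-1ℤ ^_) (sym (double/2 m)))

  eval-κ : ∀ s c → κ s * eval c ≡ eval (s ·κ c)
  eval-κ Sign.+ (c₀ , c₁ , c₂ , c₃) = trans (cong (_* eval (c₀ , c₁ , c₂ , c₃)) κ⁺) (lemma χ Q g c₀ c₁ c₂ c₃)
    where
    lemma : ∀ x q g a b c d → -1ℤ * (a * q + (b * g + (c * (x * q) + (d * (x * g) + 0ℤ)))) ≡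
                              - a * q + (- b * g + (- c * (x * q) + (- d * (x * g) + 0ℤ)))
    lemma = solve-∀
  eval-κ Sign.- (c₀ , c₁ , c₂ , c₃) = trans (cong (_* eval (c₀ , c₁ , c₂ , c₃)) κ⁻)
    (trans (lemma χ Q g c₀ c₁ c₂ c₃)
      (trans (cong (λ z → c₂ * (z * Q) + (c₃ * (z * g) + (c₀ * (χ * Q) + (c₁ * (χ * g) + 0ℤ)))) χ*χ)
        (cong₂ (λ x y → c₂ * x + (c₃ * y + (c₀ * (χ * Q) + (c₁ * (χ * g) + 0ℤ)))) (ℤ.*-identityˡ Q) (ℤ.*-identityˡ g))))
    where
    lemma : ∀ x q g a b c d → x * (a * q + (b * g + (c * (x * q) + (d * (x * g) + 0ℤ)))) ≡
                              c * (x * x * q) + (d * (x * x * g) + (a * (x * q) + (b * (x * g) + 0ℤ)))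
    lemma = solve-∀

  eval-Q,χg : ∀ x y → x * Q + y * (χ * g) ≡ eval (x , 0ℤ , 0ℤ , y)
  eval-Q,χg x y = lemma x y Q g χ
    where
    lemma : ∀ x y q g c → x * q + y * (c * g) ≡ x * q + (0ℤ * g + (0ℤ * (c * q) + (y * (c * g) + 0ℤ)))
    lemma = solve-∀

  h⁺ h⁻ : ℤ
  h⁺ = h Sign.+
  h⁻ = h Sign.-

  τ≃χg : τ ≃ χ * g
  τ≃χg = begin
    τ                ≡⟨ ℤ.*-identityˡ τ ⟨
    1ℤ * τ           ≡⟨ cong (_* τ) χ*χ ⟨
    χ * χ * τ        ≡⟨ ℤ.*-assoc χ χ τ ⟩
    χ * (χ * τ)      ≈⟨ *-congˡ χ (G≃χτ 3<p) ⟨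
    χ * g            ∎

  h⁺h⁺ : h⁺ * h⁺ ≃ Q
  h⁺h⁺ = mod-trans (mod-*-cong h⁺≃-q h⁺≃-q) (≡⇒mod (lemma q))
    where
    lemma : ∀ x → - x * - x ≡ x * x
    lemma = solve-∀

  2h⁻h⁺ : ℤ.+ 2 * (h⁻ * h⁺) ≃ Q
  2h⁻h⁺ = mod-trans (≡⇒mod (sym (ℤ.*-assoc (ℤ.+ 2) h⁻ h⁺))) (mod-trans (*-congʳ h⁺ 2h⁻≃h⁺) h⁺h⁺)

  4h⁻h⁻ : ℤ.+ 4 * (h⁻ * h⁻) ≃ Q
  4h⁻h⁻ = mod-trans (≡⇒mod (lemma h⁻)) (mod-trans (mod-*-cong 2h⁻≃h⁺ 2h⁻≃h⁺) h⁺h⁺)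
    where
    lemma : ∀ x → ℤ.+ 4 * (x * x) ≡ ℤ.+ 2 * x * (ℤ.+ 2 * x)
    lemma = solve-∀

  ∑-e⁻² : ∑[ j < m ] (e Sign.- j * e Sign.- j) ≃ 0ℤ
  ∑-e⁻² = mod-trans (≡⇒mod (∑-ext m λ j _ → trans
      (lemma (-1ℤ ^ suc j) (ι (double (suc j))))
      (trans (cong (_* (ι (double (suc j)) * ι (double (suc j)))) (sgn-^-square Sign.- (suc j)))
        (trans (ℤ.*-identityˡ _) (sym (cong₂ _*_ (e⁺ j) (e⁺ j)))))))
    (∑-e⁺² 3<p)
    where
    lemma : ∀ s x → s * x * (s * x) ≡ s * s * (x * x)
    lemma = solve-∀

  a⁺⁺ : ℤ.+ 8 * a Sign.+ Sign.+ ≃ ℤ.+ 4 * Q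
  a⁺⁺ = begin
    ℤ.+ 8 * A                           ≡⟨ lemma S A ⟩
    ℤ.+ 4 * (S + A + A) - ℤ.+ 4 * S     ≡⟨ cong (λ z → ℤ.+ 4 * z - ℤ.+ 4 * S) (h*h Sign.+ Sign.+) ⟨
    ℤ.+ 4 * (h⁺ * h⁺) - ℤ.+ 4 * S       ≈⟨ mod-+-cong (*-congˡ (ℤ.+ 4) h⁺h⁺) (mod-neg-cong (*-congˡ (ℤ.+ 4) (∑-e⁺² 3<p))) ⟩
    ℤ.+ 4 * Q + 0ℤ                      ≡⟨ ℤ.+-identityʳ _ ⟩
    ℤ.+ 4 * Q                           ∎
    where
    A = a Sign.+ Sign.+
    S = ∑[ j < m ] (e Sign.+ j * e Sign.+ j)
    lemma : ∀ s a → ℤ.+ 8 * a ≡ ℤ.+ 4 * (s + a + a) - ℤ.+ 4 * s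
    lemma = solve-∀

  -- The diagonal of h⁻h⁻ vanishes, so this sum is half of Q/4; here the common denominator 8
  -- originates.
  a⁻⁻ : ℤ.+ 8 * a Sign.- Sign.- ≃ Q
  a⁻⁻ = begin
    ℤ.+ 8 * A                           ≡⟨ lemma S A ⟩
    ℤ.+ 4 * (S + A + A) - ℤ.+ 4 * S     ≡⟨ cong (λ z → ℤ.+ 4 * z - ℤ.+ 4 * S) (h*h Sign.- Sign.-) ⟨
    ℤ.+ 4 * (h⁻ * h⁻) - ℤ.+ 4 * S       ≈⟨ mod-+-cong 4h⁻h⁻ (mod-neg-cong (*-congˡ (ℤ.+ 4) ∑-e⁻²)) ⟩
    Q + 0ℤ                              ≡⟨ ℤ.+-identityʳ _ ⟩
    Q                                   ∎
    where
    A = a Sign.- Sign.-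
    S = ∑[ j < m ] (e Sign.- j * e Sign.- j)
    lemma : ∀ s a → ℤ.+ 8 * a ≡ ℤ.+ 4 * (s + a + a) - ℤ.+ 4 * s
    lemma = solve-∀

  -- The second polynomial identity enters here: by `△-eo` the sum in `△-e⁻o⁺` is b⁺⁻ - h⁻h⁺.
  b⁺⁻ : ℤ.+ 8 * b Sign.+ Sign.- ≃ ℤ.+ 4 * Q + ℤ.- ℤ.+ 4 * (χ * g)
  b⁺⁻ = begin
    ℤ.+ 8 * B
      ≡⟨ lemma (h⁻ * h⁺) B ⟩
    ℤ.+ 4 * (ℤ.+ 2 * (h⁻ * h⁺)) + ℤ.+ 4 * (ℤ.+ 2 * (-1ℤ * (h⁻ * h⁺ - B)))
      ≈⟨ mod-+-cong (*-congˡ (ℤ.+ 4) 2h⁻h⁺) (*-congˡ (ℤ.+ 4) 2c≃-τ) ⟩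
    ℤ.+ 4 * Q + ℤ.+ 4 * - τ
      ≡⟨ cong (λ z → ℤ.+ 4 * Q + z) (lemma′ τ) ⟩
    ℤ.+ 4 * Q + ℤ.- ℤ.+ 4 * τ
      ≈⟨ +-congˡ (ℤ.+ 4 * Q) (*-congˡ (ℤ.- ℤ.+ 4) τ≃χg) ⟩
    ℤ.+ 4 * Q + ℤ.- ℤ.+ 4 * (χ * g) ∎
    where
    B = b Sign.+ Sign.-
    lemma : ∀ x b → ℤ.+ 8 * b ≡ ℤ.+ 4 * (ℤ.+ 2 * x) + ℤ.+ 4 * (ℤ.+ 2 * (-1ℤ * (x - b)))
    lemma = solve-∀
    lemma′ : ∀ t → ℤ.+ 4 * - t ≡ ℤ.- ℤ.+ 4 * t
    lemma′ = solve-∀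
    2c≃-τ : ℤ.+ 2 * (-1ℤ * (h⁻ * h⁺ - B)) ≃ - τ
    2c≃-τ = mod-trans
      (*-congˡ (ℤ.+ 2) (mod-sym (mod-trans (△-eo Sign.- Sign.+) (≡⇒mod (cong (_* (h⁻ * h⁺ - B)) κ⁺)))))
      (△-e⁻o⁺ 3<p)

  -- Partial fractions read b⁺⁻ = a⁻⁻ + a⁺⁻, with two of the three already known.
  a⁺⁻ : ℤ.+ 8 * a Sign.+ Sign.- ≃ ℤ.+ 3 * Q + ℤ.- ℤ.+ 4 * (χ * g)
  a⁺⁻ = begin
    ℤ.+ 8 * A
      ≡⟨ lemma A A⁻⁻ ⟩
    ℤ.+ 8 * (A⁻⁻ + A) - ℤ.+ 8 * A⁻⁻
      ≈⟨ mod-+-cong (mod-trans (*-congˡ (ℤ.+ 8) (mod-sym (b-partialFractions Sign.+ Sign.-))) b⁺⁻) (mod-neg-cong a⁻⁻) ⟩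
    ℤ.+ 4 * Q + ℤ.- ℤ.+ 4 * (χ * g) - Q
      ≡⟨ lemma′ Q (χ * g) ⟩
    ℤ.+ 3 * Q + ℤ.- ℤ.+ 4 * (χ * g) ∎
    where
    A = a Sign.+ Sign.-
    A⁻⁻ = a Sign.- Sign.-
    lemma : ∀ a b → ℤ.+ 8 * a ≡ ℤ.+ 8 * (b + a) - ℤ.+ 8 * b
    lemma = solve-∀
    lemma′ : ∀ q x → ℤ.+ 4 * q + ℤ.- ℤ.+ 4 * x - q ≡ ℤ.+ 3 * q + ℤ.- ℤ.+ 4 * x
    lemma′ = solve-∀

  -- The shuffle product h⁻h⁺ = τ + a⁻⁺ + a⁺⁻ leaves only this term unknown.
  a⁻⁺ : ℤ.+ 8 * a Sign.- Sign.+ ≃ 1ℤ * Q + ℤ.- ℤ.+ 4 * (χ * g)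
  a⁻⁺ = begin
    ℤ.+ 8 * A
      ≡⟨ lemma A A⁺⁻ τ ⟩
    ℤ.+ 8 * (τ + A + A⁺⁻) - ℤ.+ 8 * τ - ℤ.+ 8 * A⁺⁻
      ≡⟨ cong (λ z → ℤ.+ 8 * z - ℤ.+ 8 * τ - ℤ.+ 8 * A⁺⁻) (h*h Sign.- Sign.+) ⟨
    ℤ.+ 8 * (h⁻ * h⁺) - ℤ.+ 8 * τ - ℤ.+ 8 * A⁺⁻
      ≡⟨ cong (λ z → z - ℤ.+ 8 * τ - ℤ.+ 8 * A⁺⁻) (lemma″ (h⁻ * h⁺)) ⟩
    ℤ.+ 4 * (ℤ.+ 2 * (h⁻ * h⁺)) - ℤ.+ 8 * τ - ℤ.+ 8 * A⁺⁻
      ≈⟨ mod-+-cong (mod-+-cong (*-congˡ (ℤ.+ 4) 2h⁻h⁺) (mod-neg-cong (*-congˡ (ℤ.+ 8) τ≃χg))) (mod-neg-cong a⁺⁻) ⟩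
    ℤ.+ 4 * Q - ℤ.+ 8 * (χ * g) - (ℤ.+ 3 * Q + ℤ.- ℤ.+ 4 * (χ * g))
      ≡⟨ lemma′ Q (χ * g) ⟩
    1ℤ * Q + ℤ.- ℤ.+ 4 * (χ * g) ∎
    where
    A = a Sign.- Sign.+
    A⁺⁻ = a Sign.+ Sign.-
    lemma : ∀ a b t → ℤ.+ 8 * a ≡ ℤ.+ 8 * (t + a + b) - ℤ.+ 8 * t - ℤ.+ 8 * b
    lemma = solve-∀
    lemma′ : ∀ q x → ℤ.+ 4 * q - ℤ.+ 8 * x - (ℤ.+ 3 * q + ℤ.- ℤ.+ 4 * x) ≡ 1ℤ * q + ℤ.- ℤ.+ 4 * x
    lemma′ = solve-∀
    lemma″ : ∀ x → ℤ.+ 8 * x ≡ ℤ.+ 4 * (ℤ.+ 2 * x)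
    lemma″ = solve-∀

  a-value : ∀ s t → ℤ.+ 8 * a s t ≃ eval (a-coordinates s t)
  a-value Sign.+ Sign.+ = mod-trans a⁺⁺ (≡⇒mod (trans (sym (ℤ.+-identityʳ _)) (eval-Q,χg (ℤ.+ 4) 0ℤ)))
  a-value Sign.+ Sign.- = mod-trans a⁺⁻ (≡⇒mod (eval-Q,χg (ℤ.+ 3) (ℤ.- ℤ.+ 4)))
  a-value Sign.- Sign.+ = mod-trans a⁻⁺ (≡⇒mod (eval-Q,χg 1ℤ (ℤ.- ℤ.+ 4)))
  a-value Sign.- Sign.- = mod-trans a⁻⁻ (≡⇒mod (trans (lemma Q) (eval-Q,χg 1ℤ 0ℤ)))
    where
    lemma : ∀ x → x ≡ 1ℤ * x + 0ℤ
    lemma = solve-∀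

  eval-+ : ∀ s t {x y : ℤ} → ℤ.+ 8 * x ≃ eval s → ℤ.+ 8 * y ≃ eval t → ℤ.+ 8 * (x + y) ≃ eval s + eval t
  eval-+ s t {x} {y} hx hy = mod-trans (≡⇒mod (ℤ.*-distribˡ-+ (ℤ.+ 8) x y)) (mod-+-cong hx hy)

  b-value : ∀ s t → ℤ.+ 8 * b s t ≃ eval (b-coordinates s t)
  b-value s t = mod-trans (*-congˡ (ℤ.+ 8) (b-partialFractions s t))
    (mod-trans (eval-+ (a-coordinates t (s Sign.* t)) (a-coordinates s (s Sign.* t)) (a-value t (s Sign.* t)) (a-value s (s Sign.* t)))
      (≡⇒mod (addition s t)))
    where
    add : ∀ x y z w → eval (x , 0ℤ , 0ℤ , y) + eval (z , 0ℤ , 0ℤ , w) ≡ eval (x + z , 0ℤ , 0ℤ , y + w)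
    add x y z w = trans (cong₂ _+_ (sym (eval-Q,χg x y)) (sym (eval-Q,χg z w)))
      (trans (lemma x y z w Q (χ * g)) (eval-Q,χg (x + z) (y + w)))
      where
      lemma : ∀ x y z w q g → x * q + y * g + (z * q + w * g) ≡ (x + z) * q + (y + w) * g
      lemma = solve-∀
    addition : ∀ s t → eval (a-coordinates t (s Sign.* t)) + eval (a-coordinates s (s Sign.* t)) ≡ eval (b-coordinates s t)
    addition Sign.+ Sign.+ = add (ℤ.+ 4) 0ℤ (ℤ.+ 4) 0ℤ
    addition Sign.+ Sign.- = add 1ℤ 0ℤ (ℤ.+ 3) (ℤ.- ℤ.+ 4)
    addition Sign.- Sign.+ = add (ℤ.+ 3) (ℤ.- ℤ.+ 4) 1ℤ 0ℤ
    addition Sign.- Sign.- = add 1ℤ (ℤ.- ℤ.+ 4) 1ℤ (ℤ.- ℤ.+ 4)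

  c-value : ∀ s t → ℤ.+ 8 * (h s * h t - b t s) ≃ eval (c-coordinates s t)
  c-value s t = begin
    ℤ.+ 8 * (h s * h t - b t s)                          ≡⟨ lemma (h s * h t) (b t s) ⟩
    ℤ.+ 8 * (h s * h t) - ℤ.+ 8 * b t s                  ≈⟨ mod-+-cong (product s t) (mod-neg-cong (b-value t s)) ⟩
    hh s t * Q - eval (b-coordinates t s)                ≡⟨ subtraction s t ⟩
    eval (c-coordinates s t)                             ∎
    where
    lemma : ∀ x y → ℤ.+ 8 * (x - y) ≡ ℤ.+ 8 * x - ℤ.+ 8 * y
    lemma = solve-∀
    lemma₁ : ∀ x → ℤ.+ 8 * x ≡ ℤ.+ 4 * (ℤ.+ 2 * x)
    lemma₁ = solve-∀
    lemma₂ : ∀ x → ℤ.+ 8 * x ≡ ℤ.+ 2 * (ℤ.+ 4 * x)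
    lemma₂ = solve-∀
    hh : Sign → Sign → ℤ
    hh Sign.+ Sign.+ = ℤ.+ 8
    hh Sign.+ Sign.- = ℤ.+ 4
    hh Sign.- Sign.+ = ℤ.+ 4
    hh Sign.- Sign.- = ℤ.+ 2
    product : ∀ s t → ℤ.+ 8 * (h s * h t) ≃ hh s t * Q
    product Sign.+ Sign.+ = *-congˡ (ℤ.+ 8) h⁺h⁺
    product Sign.+ Sign.- = mod-trans (≡⇒mod (trans (cong (ℤ.+ 8 *_) (ℤ.*-comm h⁺ h⁻)) (lemma₁ (h⁻ * h⁺)))) (*-congˡ (ℤ.+ 4) 2h⁻h⁺)
    product Sign.- Sign.+ = mod-trans (≡⇒mod (lemma₁ (h⁻ * h⁺))) (*-congˡ (ℤ.+ 4) 2h⁻h⁺)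
    product Sign.- Sign.- = mod-trans (≡⇒mod (lemma₂ (h⁻ * h⁻))) (*-congˡ (ℤ.+ 2) 4h⁻h⁻)
    sub : ∀ x y z → z * Q - eval (x , 0ℤ , 0ℤ , y) ≡ eval (z - x , 0ℤ , 0ℤ , - y)
    sub x y z = trans (cong (λ w → z * Q - w) (sym (eval-Q,χg x y)))
      (trans (lemma₃ x y z Q (χ * g)) (eval-Q,χg (z - x) (- y)))
      where
      lemma₃ : ∀ x y z q g → z * q - (x * q + y * g) ≡ (z - x) * q + - y * g
      lemma₃ = solve-∀
    subtraction : ∀ s t → hh s t * Q - eval (b-coordinates t s) ≡ eval (c-coordinates s t)
    subtraction Sign.+ Sign.+ = sub (ℤ.+ 8) 0ℤ (ℤ.+ 8)
    subtraction Sign.+ Sign.- = sub (ℤ.+ 4) (ℤ.- ℤ.+ 4) (ℤ.+ 4)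
    subtraction Sign.- Sign.+ = sub (ℤ.+ 4) (ℤ.- ℤ.+ 4) (ℤ.+ 4)
    subtraction Sign.- Sign.- = sub (ℤ.+ 2) (ℤ.- ℤ.+ 8) (ℤ.+ 2)

  times-κ : ∀ s c {x} → ℤ.+ 8 * x ≃ eval c → ℤ.+ 8 * (κ s * x) ≃ eval (s ·κ c)
  times-κ s c {x} hx = mod-trans (≡⇒mod (lemma (κ s) x)) (mod-trans (*-congˡ (κ s) hx) (≡⇒mod (eval-κ s c)))
    where
    lemma : ∀ k x → ℤ.+ 8 * (k * x) ≡ k * (ℤ.+ 8 * x)
    lemma = solve-∀

  value₂ : ∀ ε ε′ σ σ′ → ℤ.+ 8 * M𝒜 (1 ∷ 1 ∷ []) (ε ∷ ε′ ∷ []) (σ ∷ σ′ ∷ []) P ≃ eval (coordinates₂ ε ε′ σ σ′)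
  value₂ ε ε′ σ σ′ = mod-trans (*-congˡ (ℤ.+ 8) (residue (depth₂ ε ε′ σ σ′))) (sums ε ε′ σ σ′)
    where
    sums : ∀ ε ε′ σ σ′ → ℤ.+ 8 * ∑[ j < m ] (t ε σ j * ∑ (count ε ε′ j) (t ε′ σ′)) ≃ eval (coordinates₂ ε ε′ σ σ′)
    sums Sign.+ Sign.+ σ σ′ = a-value σ σ′
    sums Sign.- Sign.- σ σ′ = mod-trans
      (*-congˡ (ℤ.+ 8) (mod-trans (△-oo σ σ′) (≡⇒mod (ℤ.*-assoc (κ σ) (κ σ′) (a σ′ σ)))))
      (times-κ σ (σ′ ·κ a-coordinates σ′ σ) (times-κ σ′ (a-coordinates σ′ σ) (a-value σ′ σ)))
    sums Sign.+ Sign.- σ σ′ = mod-trans (*-congˡ (ℤ.+ 8) (△-eo σ σ′)) (times-κ σ′ (c-coordinates σ σ′) (c-value σ σ′))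
    sums Sign.- Sign.+ σ σ′ = mod-trans (*-congˡ (ℤ.+ 8) (△-oe σ σ′)) (times-κ σ (b-coordinates σ σ′) (b-value σ σ′))

  value₁ : ∀ ε σ → ℤ.+ 8 * M𝒜 (2 ∷ []) (ε ∷ []) (σ ∷ []) P ≃ eval (coordinates₁ ε σ)
  value₁ ε σ = mod-trans (*-congˡ (ℤ.+ 8) (residue (depth₁ ε σ))) (sums ε σ)
    where
    ∑-ee : ∀ σ → ∑[ j < m ] (e σ j * ι (double (suc j))) ≡ ∑[ j < m ] (e σ j * e Sign.+ j)
    ∑-ee σ = ∑-ext m λ j _ → cong (e σ j *_) (sym (e⁺ j))
    ∑-oe : ∀ σ → ∑[ j < m ] (o σ j * ι (suc (double j))) ≃ κ σ * (κ Sign.+ * ∑[ j < m ] (e σ j * e Sign.+ j))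
    ∑-oe σ = mod-trans (≡⇒mod (∑-ext m λ j _ → cong (o σ j *_) (sym (o⁺ j))))
      (mod-trans (∑-oo σ Sign.+) (≡⇒mod (ℤ.*-assoc (κ σ) (κ Sign.+) _)))
    zeros : ℤ.+ 8 * ∑[ j < m ] (e Sign.+ j * e Sign.+ j) ≃ eval (0ℤ , 0ℤ , 0ℤ , 0ℤ)
    zeros = *-congˡ (ℤ.+ 8) (∑-e⁺² 3<p)
    8τ : ℤ.+ 8 * τ ≃ eval (0ℤ , 0ℤ , 0ℤ , ℤ.+ 8)
    8τ = mod-trans (*-congˡ (ℤ.+ 8) τ≃χg) (≡⇒mod (trans (sym (ℤ.+-identityˡ _)) (eval-Q,χg 0ℤ (ℤ.+ 8))))
    sums : ∀ ε σ → ℤ.+ 8 * ∑[ j < m ] (t ε σ j * ι (suc (index ε j))) ≃ eval (coordinates₁ ε σ)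
    sums Sign.+ Sign.+ = mod-trans (≡⇒mod (cong (ℤ.+ 8 *_) (∑-ee Sign.+))) zeros
    sums Sign.+ Sign.- = mod-trans (≡⇒mod (cong (ℤ.+ 8 *_) (∑-ee Sign.-))) 8τ
    sums Sign.- Sign.+ = mod-trans (*-congˡ (ℤ.+ 8) (∑-oe Sign.+))
      (times-κ Sign.+ (0ℤ , 0ℤ , 0ℤ , 0ℤ) (times-κ Sign.+ (0ℤ , 0ℤ , 0ℤ , 0ℤ) zeros))
    sums Sign.- Sign.- = mod-trans (*-congˡ (ℤ.+ 8) (∑-oe Sign.-))
      (times-κ Sign.- (0ℤ , 0ℤ , 0ℤ , ℤ.- ℤ.+ 8) (times-κ Sign.+ (0ℤ , 0ℤ , 0ℤ , ℤ.+ 8) 8τ))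

relation₁ : ∀ ε σ P → 3 ℕ.< proj₁ P →
  ℤ.+ 8 * M𝒜 (2 ∷ []) (ε ∷ []) (σ ∷ []) P ≡ integerCombination basis (terms (coordinates₁ ε σ)) P [mod proj₁ P ]
relation₁ ε σ = onOddPrimes _ λ m p-prime 3<p → let open Values m p-prime 3<p in
  mod-trans (value₁ ε σ) (≡⇒mod (eval-terms (coordinates₁ ε σ)))

relation₂ : ∀ ε ε′ σ σ′ P → 3 ℕ.< proj₁ P →
  ℤ.+ 8 * M𝒜 (1 ∷ 1 ∷ []) (ε ∷ ε′ ∷ []) (σ ∷ σ′ ∷ []) P ≡
  integerCombination basis (terms (coordinates₂ ε ε′ σ σ′)) P [mod proj₁ P ]
relation₂ ε ε′ σ σ′ = onOddPrimes _ λ m p-prime 3<p → let open Values m p-prime 3<p in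
  mod-trans (value₂ ε ε′ σ σ′) (≡⇒mod (eval-terms (coordinates₂ ε ε′ σ σ′)))

-- The two inclusions of spans

index₁ : Sign → Sign → MixedIndex 2
index₁ ε σ = record { 𝐬 = 2 ∷ [] ; 𝛆 = ε ∷ [] ; 𝛔 = σ ∷ [] ; positive = _ ∷ [] ; weight = refl }

index₂ : Sign → Sign → Sign → Sign → MixedIndex 2
index₂ ε ε′ σ σ′ = record
  { 𝐬 = 1 ∷ 1 ∷ [] ; 𝛆 = ε ∷ ε′ ∷ [] ; 𝛔 = σ ∷ σ′ ∷ [] ; positive = _ ∷ _ ∷ [] ; weight = refl }

mixedValue : MixedIndex 2 → 𝒜
mixedValue i = M𝒜 𝐬 𝛆 𝛔
  where open MixedIndex i

-- The compositions of 2 into positive parts are (2) and (1, 1). The predicate concerns values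
-- rather than indices, so the proof fields of two indices never have to be identified.
MixedIndex-view : (A : 𝒜 → Set) → (∀ ε σ → A (mixedValue (index₁ ε σ))) →
                  (∀ ε ε′ σ σ′ → A (mixedValue (index₂ ε ε′ σ σ′))) → ∀ i → A (mixedValue i)
MixedIndex-view A f g record { 𝐬 = s ∷ [] ; 𝛆 = ε ∷ [] ; 𝛔 = σ ∷ [] ; weight = w }
  with refl ← trans (sym (ℕ.+-identityʳ s)) w = f ε σ
MixedIndex-view A f g record { 𝐬 = suc zero ∷ suc zero ∷ [] ; 𝛆 = ε ∷ ε′ ∷ [] ; 𝛔 = σ ∷ σ′ ∷ [] } = g ε ε′ σ σ′
MixedIndex-view A f g record { 𝐬 = suc zero ∷ suc (suc t) ∷ [] ; weight = () }
MixedIndex-view A f g record { 𝐬 = suc (suc zero) ∷ suc t ∷ [] ; weight = () }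
MixedIndex-view A f g record { 𝐬 = suc (suc (suc s)) ∷ suc t ∷ [] ; weight = () }
MixedIndex-view A f g record { 𝐬 = suc zero ∷ suc zero ∷ suc u ∷ _ ; weight = () }
MixedIndex-view A f g record { 𝐬 = suc zero ∷ suc (suc t) ∷ suc u ∷ _ ; weight = () }
MixedIndex-view A f g record { 𝐬 = suc (suc zero) ∷ suc t ∷ suc u ∷ _ ; weight = () }
MixedIndex-view A f g record { 𝐬 = suc (suc (suc s)) ∷ suc t ∷ suc u ∷ _ ; weight = () }
MixedIndex-view A f g record { 𝐬 = zero ∷ _ ∷ _ ; positive = record { nonZero = () } ∷ _ }
MixedIndex-view A f g record { 𝐬 = suc _ ∷ zero ∷ _ ; positive = _ ∷ record { nonZero = () } ∷ _ }
MixedIndex-view A f g record { 𝐬 = suc _ ∷ suc _ ∷ zero ∷ _ ; positive = _ ∷ _ ∷ record { nonZero = () } ∷ _ }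

mixedValue∈Span : ∀ i → Span 𝒜-vectorSpace basis (mixedValue i)
mixedValue∈Span = MixedIndex-view (Span 𝒜-vectorSpace basis)
  (λ ε σ → integerRelation⇒Span basis _ 8 3 (terms (coordinates₁ ε σ)) (relation₁ ε σ))
  (λ ε ε′ σ σ′ → integerRelation⇒Span basis _ 8 3 (terms (coordinates₂ ε ε′ σ σ′)) (relation₂ ε ε′ σ σ′))

-- The tables are inverted. One depth two value is q₂²/2, and the alternating values of depth one
-- are - G for odd and χG for even summation indices.
basis∈Span : ∀ k → Span 𝒜-vectorSpace mixedValue (basis k)
basis∈Span 0F =
  integerRelation⇒Span mixedValue _ 4 3 ((ℤ.+ 8 , index₂ Sign.+ Sign.+ Sign.+ Sign.+) ∷ []) λ P 3<p →
    mod-sym (mod-trans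
      (mod-+-cong (relation₂ Sign.+ Sign.+ Sign.+ Sign.+ P 3<p) (≡⇒mod {a = 0ℤ} refl))
      (≡⇒mod (lemma (basis 0F P) (basis 1F P) (basis 2F P) (basis 3F P))))
  where
  lemma : ∀ a b c d → ℤ.+ 4 * a + (0ℤ * b + (0ℤ * c + (0ℤ * d + 0ℤ))) + 0ℤ ≡ ℤ.+ 4 * a
  lemma = solve-∀
basis∈Span 1F =
  integerRelation⇒Span mixedValue _ 8 3 ((ℤ.- ℤ.+ 8 , index₁ Sign.- Sign.-) ∷ []) λ P 3<p →
    mod-sym (mod-trans (≡⇒mod (lemma₁ (mixedValue (index₁ Sign.- Sign.-) P)))
      (mod-trans (mod-neg-cong (relation₁ Sign.- Sign.- P 3<p))
        (≡⇒mod (lemma₂ (basis 0F P) (basis 1F P) (basis 2F P) (basis 3F P)))))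
  where
  lemma₁ : ∀ x → ℤ.- ℤ.+ 8 * x + 0ℤ ≡ - (ℤ.+ 8 * x)
  lemma₁ = solve-∀
  lemma₂ : ∀ a b c d → - (0ℤ * a + (ℤ.- ℤ.+ 8 * b + (0ℤ * c + (0ℤ * d + 0ℤ)))) ≡ ℤ.+ 8 * b
  lemma₂ = solve-∀
basis∈Span 2F =
  integerRelation⇒Span mixedValue _ 8 3
    -- Eight times the depth two value is 4χq₂² - 4G; the depth one value, - G, cancels the second
    -- term after doubling.
    ((ℤ.+ 16 , index₂ Sign.- Sign.+ Sign.- Sign.+) ∷ (ℤ.- ℤ.+ 8 , index₁ Sign.- Sign.-) ∷ []) λ P 3<p →
    mod-sym (mod-trans (≡⇒mod (lemma₁ (mixedValue (index₂ Sign.- Sign.+ Sign.- Sign.+) P) (mixedValue (index₁ Sign.- Sign.-) P)))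
      (mod-trans
        (mod-+-cong (mod-*-cong (≡⇒mod {a = ℤ.+ 2} refl) (relation₂ Sign.- Sign.+ Sign.- Sign.+ P 3<p))
                    (mod-neg-cong (relation₁ Sign.- Sign.- P 3<p)))
        (≡⇒mod (lemma₂ (basis 0F P) (basis 1F P) (basis 2F P) (basis 3F P)))))
  where
  lemma₁ : ∀ x y → ℤ.+ 16 * x + (ℤ.- ℤ.+ 8 * y + 0ℤ) ≡ ℤ.+ 2 * (ℤ.+ 8 * x) + - (ℤ.+ 8 * y)
  lemma₁ = solve-∀
  lemma₂ : ∀ a b c d → ℤ.+ 2 * (0ℤ * a + (ℤ.- ℤ.+ 4 * b + (ℤ.+ 4 * c + (0ℤ * d + 0ℤ)))) +
                       - (0ℤ * a + (ℤ.- ℤ.+ 8 * b + (0ℤ * c + (0ℤ * d + 0ℤ)))) ≡ ℤ.+ 8 * c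
  lemma₂ = solve-∀
basis∈Span 3F =
  integerRelation⇒Span mixedValue _ 8 3 ((ℤ.+ 8 , index₁ Sign.+ Sign.-) ∷ []) λ P 3<p →
    mod-sym (mod-trans
      (mod-+-cong (relation₁ Sign.+ Sign.- P 3<p) (≡⇒mod {a = 0ℤ} refl))
      (≡⇒mod (lemma (basis 0F P) (basis 1F P) (basis 2F P) (basis 3F P))))
  where
  lemma : ∀ a b c d → 0ℤ * a + (0ℤ * b + (0ℤ * c + (ℤ.+ 8 * d + 0ℤ))) + 0ℤ ≡ ℤ.+ 8 * d
  lemma = solve-∀

theorem4p5 : FAMMV 2 ≐ Span 𝒜-vectorSpace (lookup ((q₂ ⊗ q₂) ∷ G𝒜 ∷ ([-1]^p′ ⊗ (q₂ ⊗ q₂)) ∷ ([-1]^p′ ⊗ G𝒜) ∷ []))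
theorem4p5 = (λ {x} → Span-⊆ 𝒜-vectorSpace mixedValue∈Span {x}) , λ {x} → Span-⊆ 𝒜-vectorSpace basis∈Span {x}
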